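{- For all $\mu\in\mathrm{Par}^k$, $\tilde A^{(k)}_\mu=\mathfrak s^{(k)}_\mu$.
   Context: Fix $k\ge1$. $\Lambda=\mathbb Z[t][h_1,h_2,\dots]$ ($h_0=1$, $h_d=0$ for $d<0$); $s_\gamma=\det(h_{\gamma_i+j-i})_{1\le i,j\le\ell}$ for $\gamma\in\mathbb Z^\ell$. For a root ideal $\Psi\subseteq\Delta^+_\ell=\{(i,j):1\le i<j\le\ell\}$ (upper order ideal for $(a,b)\le(c,d)$ iff $a\ge c$, $b\le d$) and $\gamma\in\mathbb Z^\ell$, $H(\Psi;\gamma)=\sum_{m:\Psi\to\mathbb Z_{\ge0}}t^{\sum m}s_{\gamma+\sum_{(i,j)\in\Psi}m_{ij}(\epsilon_i-\epsilon_j)}\in\Lambda$. $\mathrm{Par}^k_\ell=\{\mu\in\mathbb Z^\ell:k\ge\mu_1\ge\dots\ge\mu_\ell\ge0\}$, $\mathrm{Par}^k$ = partitions with parts $\le k$. For $\mu\in\mathrm{Par}^k_\ell$, $\mathfrak s^{(k)}_\mu=H(\{(i,j):k-\mu_i+i<j\};\mu)$ (unchanged by appending zeros). $\Lambda^k=\mathrm{span}_{\mathbb Z[t]}\{H(\Delta^+_{\ell(\mu)};\mu):\mu\in\mathrm{Par}^k\}$. $\mathcal B_m=\sum_{i,j\ge0}(-1)^it^jh_{m+i+j}e_i^\perp h_j^\perp$ (Hall adjoints); $\tilde{\mathcal B}_\alpha=\mathcal B_{\alpha_1}\cdots\mathcal B_{\alpha_\ell}$; $\mathcal B_\alpha=\prod_{1\le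 i<j\le\ell}(1-t\mathbf R_{ij})\tilde{\mathcal B}_\alpha$ with $\mathbf R_{ij}\tilde{\mathcal B}_\beta=\tilde{\mathcal B}_{\beta+\epsilon_i-\epsilon_j}$. $k$-split of $\lambda\in\mathrm{Par}^k$: cut $\lambda$ (without rearranging) into consecutive blocks $\lambda^1,\dots,\lambda^d$, where block $\lambda^i$ has $r_i=k-(\lambda^i)_1+1$ entries, the last block $\lambda^d$ ($(\lambda^d)_1>0$) padded with zeros; the empty partition has $d=0$. The $k$-split polynomial is $G^{(k)}_\lambda=\mathcal B_{\lambda^1}\cdots\mathcal B_{\lambda^{d-1}}s_{\lambda^d}$, $G^{(k)}_\emptyset=1$. It is known that $\{G^{(k)}_\lambda:\lambda\in\mathrm{Par}^k\}$ is a $\mathbb Z[t]$-basis of $\Lambda^k$. Let $\tilde\Omega^{k,a}=\mathrm{span}_{\mathbb Z[t]}\{G^{(k)}_\lambda:\lambda\in\mathrm{Par}^k,\lambda_1=a\}$ for $0\le a\le k$ (with $\tilde\Omega^{k,0}$ spanned by $G^{(k)}_\emptyset=1$), so $\Lambda^k=\bigoplus_a\tilde\Omega^{k,a}$, and let $\pi^{k,d}:\Lambda^k\to\Lambda^k$ be the projection with kernel $\bigoplus_{a>d}\tilde\Omega^{k,a}$ that is the identity on $\bigoplus_{a\le d}\tilde\Omega^{k,a}$. Define recursively $\tilde A^{(k)}_\emptyset=1$ and, for $\ell(\mu)>0$, $\tilde A^{(k)}_\mu=\pi^{k,\mu_1}\big(\mathcal B_{\mu_1}\tilde A^{(k)}_{(\mu_2,\dots,\mu_{\ell(\mu)})}\big)$.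 -}

module Defs where

open import Data.Nat as ℕ using (ℕ; zero; suc; _≤_; _<_; _≤ᵇ_; _≡ᵇ_)
open import Data.Integer as ℤ using (ℤ; +_; -[1+_])
open import Data.List using (List; []; _∷_; _++_; map; concatMap; foldr; length; upTo; replicate; take; drop; applyUpTo)
open import Data.List.Relation.Unary.All using (All)
open import Data.List.Relation.Unary.Linked using (Linked)
open import Data.List.Properties using (≡-dec)
open import Data.Product using (_×_; _,_; Σ; proj₁; proj₂)
open import Data.Bool using (Bool; true; false; if_then_else_; _∧_)
open import Relation.Binary.PropositionalEquality using (_≡_)
open import Relation.Nullary.Decidable using (⌊_⌋)

-- The ring Λ = ℤ[t][h₁,h₂,…], elements represented as finite lists of
-- terms  c · t^n · h_{a₁} ⋯ h_{a_r}  (all aᵢ ≥ 1).  Equality of elements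
-- is equality of all monomial coefficients (see _≈_ below).

Mon : Set
Mon = ℕ × List ℕ            -- (exponent of t , multiset of h-indices)

Poly : Set
Poly = List (ℤ × Mon)

insertℕ : ℕ → List ℕ → List ℕ
insertℕ x [] = x ∷ []
insertℕ x (y ∷ ys) = if x ≤ᵇ y then x ∷ y ∷ ys else y ∷ insertℕ x ys

sortℕ : List ℕ → List ℕ
sortℕ = foldr insertℕ []

coeff : Poly → ℕ → List ℕ → ℤ
coeff [] n ms = + 0
coeff ((c , (m , hs)) ∷ p) n ms =
  (if (m ≡ᵇ n) ∧ ⌊ ≡-dec ℕ._≟_ (sortℕ hs) (sortℕ ms) ⌋ then c else + 0) ℤ.+ coeff p n ms

infix 4 _≈_
_≈_ : Poly → Poly → Set
p ≈ q = ∀ n ms → coeff p n ms ≡ coeff q n ms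

0P : Poly
0P = []

1P : Poly
1P = (+ 1 , (0 , [])) ∷ []

tP : Poly
tP = (+ 1 , (1 , [])) ∷ []

infixl 6 _+P_ _-P_
infixl 7 _*P_

_+P_ : Poly → Poly → Poly
p +P q = p ++ q

negP : Poly → Poly
negP = map (λ { (c , m) → (ℤ.- c , m) })

_-P_ : Poly → Poly → Poly
p -P q = p +P negP q

_*P_ : Poly → Poly → Poly
p *P q = concatMap (λ { (c , (n , hs)) →
           map (λ { (d , (m , ks)) → (c ℤ.* d , (n ℕ.+ m , sortℕ (hs ++ ks))) }) q }) p

sumP : List Poly → Poly
sumP = foldr _+P_ 0P

scaleZ : ℤ → Poly → Poly
scaleZ z = map (λ { (c , m) → (z ℤ.* c , m) })

powP : Poly → ℕ → Poly
powP p zero = 1P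
powP p (suc n) = p *P powP p n

signP : ℕ → Poly
signP zero = 1P
signP (suc n) = negP (signP n)

-- elements of ℤ[t] given by their list of coefficients (of t^0, t^1, …)
ZtPoly : Set
ZtPoly = List ℤ

fromZt : ZtPoly → Poly
fromZt cs = go 0 cs
  where
  go : ℕ → List ℤ → Poly
  go n [] = []
  go n (c ∷ cs) = (c , (n , [])) ∷ go (suc n) cs

hZ : ℤ → Poly
hZ (+ zero) = 1P
hZ (+ suc d) = (+ 1 , (0 , suc d ∷ [])) ∷ []
hZ -[1+ d ] = 0P

range : ℕ → List ℕ
range n = upTo (suc n)

degP : Poly → ℕ
degP = foldr (λ { (c , (n , hs)) d → foldr ℕ._+_ 0 hs ℕ.⊔ d }) 0

-- Jacobi–Trudi: s_γ = det (h_{γ_i + j - i})_{1 ≤ i,j ≤ ℓ}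

lookupZ : List ℤ → ℕ → ℤ       -- 1-based, default 0
lookupZ [] i = + 0
lookupZ (x ∷ xs) zero = + 0
lookupZ (x ∷ xs) (suc zero) = x
lookupZ (x ∷ xs) (suc (suc i)) = lookupZ xs (suc i)

removeAt : List ℕ → ℕ → List ℕ
removeAt [] i = []
removeAt (x ∷ xs) zero = xs
removeAt (x ∷ xs) (suc i) = x ∷ removeAt xs i

indexed : List ℕ → List (ℕ × ℕ)
indexed xs = go 0 xs
  where
  go : ℕ → List ℕ → List (ℕ × ℕ)
  go i [] = []
  go i (x ∷ xs) = (i , x) ∷ go (suc i) xs

-- Laplace expansion along the first remaining row
detAux : (M : ℕ → ℕ → Poly) → (fuel row : ℕ) → List ℕ → Poly
detAux M zero row cols = 1P
detAux M (suc f) row cols =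
  sumP (map (λ { (i , c) → signP i *P M row c *P detAux M f (suc row) (removeAt cols i) })
            (indexed cols))

schur : List ℤ → Poly
schur γ = detAux M ℓ 1 (applyUpTo suc ℓ)
  where
  ℓ = length γ
  M : ℕ → ℕ → Poly
  M i j = hZ (lookupZ γ i ℤ.+ + j ℤ.- + i)

-- Hall adjoints h_j^⊥ and e_i^⊥ on Λ.  They are determined by
-- h_j^⊥ h_a = h_{a-j}, e_1^⊥ h_a = h_{a-1}, e_i^⊥ h_a = 0 (i ≥ 2),
-- together with the coproduct rules
-- h_j^⊥(fg) = Σ_c h_c^⊥ f · h_{j-c}^⊥ g,  e_i^⊥(fg) = Σ_c e_c^⊥ f · e_{i-c}^⊥ g,
-- and ℤ[t]-linearity.

hperpMon : ℕ → List ℕ → Poly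
hperpMon zero [] = 1P
hperpMon (suc j) [] = 0P
hperpMon j (a ∷ as) =
  sumP (map (λ c → hZ (+ a ℤ.- + c) *P hperpMon (j ℕ.∸ c) as) (range j))

eperpMon : ℕ → List ℕ → Poly
eperpMon zero [] = 1P
eperpMon (suc i) [] = 0P
eperpMon zero (a ∷ as) = hZ (+ a) *P eperpMon zero as
eperpMon (suc i) (a ∷ as) =
  hZ (+ a) *P eperpMon (suc i) as +P hZ (+ a ℤ.- + 1) *P eperpMon i as

liftMon : (List ℕ → Poly) → Poly → Poly
liftMon F p = concatMap (λ { (c , (n , hs)) → scaleZ c (powP tP n *P F hs) }) p

hperp : ℕ → Poly → Poly
hperp j = liftMon (hperpMon j)

eperp : ℕ → Poly → Poly
eperp i = liftMon (eperpMon i)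

-- B_m f = Σ_{i,j ≥ 0} (-1)^i t^j h_{m+i+j} e_i^⊥ h_j^⊥ f.
-- Terms with i > deg f or j > deg f vanish identically, so the sum is
-- truncated at deg f.

Bop : ℤ → Poly → Poly
Bop m f = sumP (concatMap (λ i → map (λ j →
             signP i *P powP tP j *P hZ (m ℤ.+ + i ℤ.+ + j) *P eperp i (hperp j f))
           (range D)) (range D))
  where D = degP f

Btil : List ℤ → Poly → Poly
Btil α f = foldr Bop f α

posPairs : ℕ → List (ℕ × ℕ)
posPairs ℓ = concatMap (λ i → map (λ j → (i , j)) (drop i (applyUpTo suc ℓ))) (applyUpTo suc ℓ)

subsets : {A : Set} → List A → List (List A)
subsets [] = [] ∷ []
subsets (x ∷ xs) = let r = subsets xs in r ++ map (x ∷_) r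

shiftZ : ℕ → ℕ → ℤ → List ℤ → List ℤ
shiftZ i j a γ = go 1 γ
  where
  go : ℕ → List ℤ → List ℤ
  go p [] = []
  go p (x ∷ xs) = (if p ≡ᵇ i then x ℤ.+ a else if p ≡ᵇ j then x ℤ.- a else x) ∷ go (suc p) xs

-- B_α f = ∏_{i<j} (1 - t R_ij) B̃_α f = Σ_{S ⊆ pairs} (-t)^{|S|} B̃_{α + Σ_S (ε_i - ε_j)} f
Bvec : List ℤ → Poly → Poly
Bvec α f = sumP (map (λ S →
             signP (length S) *P powP tP (length S) *P
             Btil (foldr (λ { (i , j) γ → shiftZ i j (+ 1) γ }) α S) f)
           (subsets (posPairs (length α))))

IsParK : ℕ → List ℕ → Set
IsParK k lam = Linked (λ a b → b ≤ a) lam × All (λ a → 1 ≤ a × a ≤ k) lam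

headℕ : List ℕ → ℕ
headℕ [] = 0
headℕ (a ∷ _) = a

kSplitAux : ℕ → ℕ → List ℕ → List (List ℕ)
kSplitAux k zero lam = []
kSplitAux k (suc f) [] = []
kSplitAux k (suc f) (a ∷ lam) =
  let r = suc (k ℕ.∸ a)
      blk = take r (a ∷ lam)
  in (blk ++ replicate (r ℕ.∸ length blk) 0) ∷ kSplitAux k f (drop r (a ∷ lam))

kSplit : ℕ → List ℕ → List (List ℕ)
kSplit k lam = kSplitAux k (length lam) lam

toZ : List ℕ → List ℤ
toZ = map +_

Gk : ℕ → List ℕ → Poly
Gk k lam = go (kSplit k lam)
  where
  go : List (List ℕ) → Poly
  go [] = 1P
  go (b ∷ []) = schur (toZ b)
  go (b ∷ b' ∷ bs) = Bvec (toZ b) (go (b' ∷ bs))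

InSpanG : ℕ → (List ℕ → Set) → Poly → Set
InSpanG k P f = Σ (List (ZtPoly × List ℕ)) λ L →
  All (λ cλ → IsParK k (proj₂ cλ) × P (proj₂ cλ)) L ×
  (f ≈ sumP (map (λ { (c , lam) → fromZt c *P Gk k lam }) L))

-- g = π^{k,d}(f): g ∈ ⊕_{a ≤ d} Ω̃^{k,a} and f - g ∈ ⊕_{a > d} Ω̃^{k,a}
IsProj : ℕ → ℕ → Poly → Poly → Set
IsProj k d f g = InSpanG k (λ lam → headℕ lam ≤ d) g × InSpanG k (λ lam → d < headℕ lam) (f -P g)

-- Ã^{(k)}_μ as a relation:  ATilde k μ f  means  f = Ã^{(k)}_μ
data ATilde (k : ℕ) : List ℕ → Poly → Set where
  atNil  : ATilde k [] 1P
  atCons : ∀ {m μ g f} → ATilde k μ g → IsProj k m (Bop (+ m) g) f → ATilde k (m ∷ μ) f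

-- Catalan function H(Ψ;γ), a formal power series in t; coefficient of t^n.

comps : ℕ → ℕ → List (List ℕ)
comps zero zero = [] ∷ []
comps zero (suc n) = []
comps (suc p) n = concatMap (λ a → map (a ∷_) (comps p (n ℕ.∸ a))) (range n)

applyM : List (ℕ × ℕ) → List ℕ → List ℤ → List ℤ
applyM [] ms γ = γ
applyM (_ ∷ _) [] γ = γ
applyM ((i , j) ∷ Ψ) (m ∷ ms) γ = shiftZ i j (+ m) (applyM Ψ ms γ)

Hcoeff : List (ℕ × ℕ) → List ℤ → ℕ → Poly
Hcoeff Ψ γ n = sumP (map (λ ms → schur (applyM Ψ ms γ)) (comps (length Ψ) n))

lookupℕ : List ℕ → ℕ → ℕ       -- 1-based
lookupℕ [] i = 0
lookupℕ (x ∷ xs) zero = 0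
lookupℕ (x ∷ xs) (suc zero) = x
lookupℕ (x ∷ xs) (suc (suc i)) = lookupℕ xs (suc i)

kRootIdeal : ℕ → List ℕ → List (ℕ × ℕ)
kRootIdeal k μ = go (posPairs (length μ))
  where
  go : List (ℕ × ℕ) → List (ℕ × ℕ)
  go [] = []
  go ((i , j) ∷ ps) = if (suc ((k ℕ.∸ lookupℕ μ i) ℕ.+ i)) ≤ᵇ j
                        then (i , j) ∷ go ps else go ps

kSchurCoeff : ℕ → List ℕ → ℕ → Poly
kSchurCoeff k μ n = Hcoeff (kRootIdeal k μ) (toZ μ) n

-- f ∈ Λ equals the t-series Σ_n t^n F n  (F n free of t)
EqSeries : Poly → (ℕ → Poly) → Set
EqSeries f F = ∀ n ms → coeff f n ms ≡ coeff (F n) 0 ms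

{-# OPTIONS --safe #-}

-- Inverting the factors 1 − t R over the roots, the Catalan function s_μ of the k-root ideal of μ becomes
-- the product of 1 − t R over the non-roots applied to B̃_μ 1, because the product over all pairs gives the
-- Jacobi–Trudi determinant.  In this form row i interacts with the k − μ_i rows after it only.  Hence
-- B_m s_μ − s_(m,μ) is a combination of B_i B̃_γ 1 with m < i ≤ k, and the quadratic relation between the B's
-- straightens these into functions G_λ with λ_1 ≥ i > m.  On the other hand s_μ lies in the span of the
-- G_λ with λ_1 ≤ μ_1: let μ = (ν,σ) with ν the first block of the k-split, of length k − μ_1 + 1.  The
-- non-roots joining ν to σ fix the first entry of ν, raise the others and lower entries of σ.  The lowered
-- functions of σ are combinations of the s_τ, τ a partition (s_(ν,σ) − B_ν s_σ has larger first blocks, so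
-- B_ν s_σ can be rewritten in terms of the s_τ), hence of the G_λ by induction.  As B_ν is antisymmetric in
-- the entries of ν shifted by the staircase, the raised ν sorts to a partition, which still starts with μ_1
-- and whose B applied to G_λ is G again.  So s_(m,μ) is the projection of B_m s_μ, as the recursion requires.
module Submission where

open import Level using (0ℓ)
open import Algebra.Bundles using (AbelianGroup; CommutativeRing)
import Algebra.Properties.AbelianGroup
import Algebra.Properties.CommutativeSemigroup
open import Data.Nat as ℕ using (ℕ; zero; suc; _≡ᵇ_; _≤_; z≤n; s≤s; _≤ᵇ_)
open import Data.Integer as ℤ using (ℤ; +_; -[1+_])
import Data.Integer.Properties as ℤP
import Data.Nat.Properties as ℕP
open import Data.List using (List; []; _∷_; _++_; length; map; zipWith; foldr; replicate; concatMap; upTo; applyUpTo; drop; take)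
open import Data.List.Properties using (length-++; length-map; map-++; map-replicate; foldr-++; ++-assoc; ++-identityʳ; length-replicate; ≡-dec; map-∘; take-all; drop-all; length-drop)
open import Data.Product using (_×_; _,_; proj₁; proj₂; ∃; Σ)
open import Function using (_∘_)
open import Relation.Binary.PropositionalEquality as ≡ using (_≡_; refl)
import Relation.Binary.Reasoning.Setoid
open import Defs
open import Data.Bool using (Bool; true; false; if_then_else_; T; _∧_)
open import Data.List.Relation.Unary.All as All using (All; []; _∷_)
import Data.List.Relation.Unary.All.Properties as AllP
open import Data.Sum as Sum using (inj₁; inj₂; _⊎_)
open import Data.Unit using (⊤; tt)
open import Data.Empty using (⊥-elim; ⊥)
open import Data.List.Relation.Binary.Permutation.Propositional as Perm using (_↭_; prep; swap; ↭-sym; ↭-trans; ↭-refl)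
open import Data.List.Relation.Binary.Permutation.Propositional.Properties using (↭-length; All-resp-↭; ∈-resp-↭)
open import Relation.Binary using (tri<; tri≈; tri>; Setoid)
open import Data.List.Relation.Unary.Any using (here; there)
open import Data.List.Membership.Propositional using (_∈_)
open import Relation.Nullary using (yes; no; ¬_)
open import Data.Integer.Tactic.RingSolver as ℤSolver using (solve-∀)
open import Relation.Nullary.Decidable using (⌊_⌋)
open import Data.List.Relation.Unary.Linked using (Linked; []; [-]; _∷_)

-- The block length k - d + 1 is what keeps straightening within bounds. Add the staircase to the
-- entries of a block whose parts lie between lo and d, and call the results weights. A row gains at
-- most one for each non-root outside its block, and this takes its weight no further than k.
-- Lowering costs it at most what the staircase has added, so its weight stays at least lo. On k - d
-- + 1 rows, distinct weights between lo and k are exactly those of a partition with parts between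
-- lo and d, so sorting yields neither a part above d nor a negative entry. Straightening words in
-- the B's has no such lower bound: entries may become very negative. It terminates because each
-- step goes up lexicographically while no entry passes k. The Jacobi-Trudi formula and the identity
-- B_γ 1 = s_γ come from one formalism, used with t = 1 and multiplication by h_m, and with formal t
-- and B_m. The commutation rule of B_m with h_a links the two uses and also implies the quadratic
-- relation. The infinite series H is met only at the end, where it is compared with the finite form
-- one coefficient at a time.

-- Shifts of index lists

-- Lw n γ γ′: some of the first n entries of γ are lowered by one.
data Lw : ℕ → List ℤ → List ℤ → Set where
  stop : ∀ {γ} → Lw 0 γ γ
  nil  : ∀ {n} → Lw n [] []
  keep : ∀ {n g γ γ′} → Lw n γ γ′ → Lw (suc n) (g ∷ γ) (g ∷ γ′)
  down : ∀ {n g γ γ′} → Lw n γ γ′ → Lw (suc n) (g ∷ γ) (ℤ.pred g ∷ γ′)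

Lw-refl : ∀ n γ → Lw n γ γ
Lw-refl zero    γ       = stop
Lw-refl (suc n) []      = nil
Lw-refl (suc n) (g ∷ γ) = keep (Lw-refl n γ)

Lw-length : ∀ {n γ γ′} → Lw n γ γ′ → length γ′ ≡ length γ
Lw-length stop     = refl
Lw-length nil      = refl
Lw-length (keep l) = ≡.cong suc (Lw-length l)
Lw-length (down l) = ≡.cong suc (Lw-length l)

suc-+ : ∀ m n → ℤ.suc m ℤ.+ + n ≡ m ℤ.+ + suc n
suc-+ m n = ≡.trans (≡.cong (ℤ._+ + n) (ℤP.+-comm (+ 1) m)) (ℤP.+-assoc m (+ 1) (+ n))

mapIdx : (ℕ → ℤ → ℤ) → ℕ → List ℤ → List ℤ
mapIdx d p []      = []
mapIdx d p (x ∷ γ) = d p x ∷ mapIdx d (suc p) γ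

shiftEntry : ℕ → ℕ → ℤ → ℕ → ℤ → ℤ
shiftEntry i j a p x = if p ≡ᵇ i then x ℤ.+ a else if p ≡ᵇ j then x ℤ.- a else x

private
  mapIdx-unique : ∀ d (g : ℕ → List ℤ → List ℤ) → (∀ p → g p [] ≡ []) →
    (∀ p x γ → g p (x ∷ γ) ≡ d p x ∷ g (suc p) γ) → ∀ p γ → g p γ ≡ mapIdx d p γ
  mapIdx-unique d g e f p []      = e p
  mapIdx-unique d g e f p (x ∷ γ) = ≡.trans (f p x γ) (≡.cong (d p x ∷_) (mapIdx-unique d g e f (suc p) γ))

  -- The local function of shiftZ has no name here; abstracting its arguments one by one lets
  -- unification find it.
  shiftZ-∷ : ∀ i j a x (γ : ⊤ → List ℤ) u → shiftZ i j a (x ∷ γ u) ≡ mapIdx (shiftEntry i j a) 1 (x ∷ γ u)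
  shiftZ-∷ i j a x γ u with List._∷_ x (γ u)
  ... | w with γ u | 2 | mapIdx-unique (shiftEntry i j a) _ (λ _ → refl) (λ _ _ _ → refl)
  ... | v | p | unique = ≡.cong (_ ∷_) (unique p v)

shiftZ-mapIdx : ∀ i j a γ → shiftZ i j a γ ≡ mapIdx (shiftEntry i j a) 1 γ
shiftZ-mapIdx i j a []      = refl
shiftZ-mapIdx i j a (x ∷ γ) = shiftZ-∷ i j a x (λ _ → γ) tt

mapIdx-length : ∀ d p γ → length (mapIdx d p γ) ≡ length γ
mapIdx-length d p []      = refl
mapIdx-length d p (x ∷ γ) = ≡.cong suc (mapIdx-length d (suc p) γ)

shiftZ-length : ∀ i j a γ → length (shiftZ i j a γ) ≡ length γ
shiftZ-length i j a γ = ≡.trans (≡.cong length (shiftZ-mapIdx i j a γ)) (mapIdx-length (shiftEntry i j a) 1 γ)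

shiftEntry-+ : ∀ i j a p x b → shiftEntry i j a p (x ℤ.+ b) ≡ shiftEntry i j a p x ℤ.+ b
shiftEntry-+ i j a p x b with p ≡ᵇ i | p ≡ᵇ j
... | true  | _     = +-swap x b a
  where +-swap : ∀ x b a → x ℤ.+ b ℤ.+ a ≡ x ℤ.+ a ℤ.+ b
        +-swap x b a = ≡.trans (ℤP.+-assoc x b a) (≡.trans (≡.cong (λ z → x ℤ.+ z) (ℤP.+-comm b a)) (≡.sym (ℤP.+-assoc x a b)))
... | false | true  = ≡.trans (ℤP.+-assoc x b _) (≡.trans (≡.cong (λ z → x ℤ.+ z) (ℤP.+-comm b _)) (≡.sym (ℤP.+-assoc x _ b)))
... | false | false = refl

-- A shift adds an amount that depends on the position alone, which is why any two shifts commute.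
shiftEntry-offset : ∀ i j a p x → shiftEntry i j a p x ≡ x ℤ.+ shiftEntry i j a p (+ 0)
shiftEntry-offset i j a p x = ≡.trans (≡.cong (shiftEntry i j a p) (≡.sym (ℤP.+-identityˡ x)))
  (≡.trans (shiftEntry-+ i j a p (+ 0) x) (ℤP.+-comm _ x))

shiftEntry-comm : ∀ i j a i′ j′ a′ p x →
  shiftEntry i j a p (shiftEntry i′ j′ a′ p x) ≡ shiftEntry i′ j′ a′ p (shiftEntry i j a p x)
shiftEntry-comm i j a i′ j′ a′ p x = begin
  f (f′ x)                ≡⟨ ≡.cong f (shiftEntry-offset i′ j′ a′ p x) ⟩
  f (x ℤ.+ f′ (+ 0))      ≡⟨ shiftEntry-+ i j a p x _ ⟩
  f x ℤ.+ f′ (+ 0)        ≡⟨ shiftEntry-offset i′ j′ a′ p (f x) ⟨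
  f′ (f x) ∎
  where open ≡.≡-Reasoning
        f = shiftEntry i j a p
        f′ = shiftEntry i′ j′ a′ p

mapIdx-comm : ∀ d e → (∀ p x → d p (e p x) ≡ e p (d p x)) → ∀ p γ → mapIdx d p (mapIdx e p γ) ≡ mapIdx e p (mapIdx d p γ)
mapIdx-comm d e c p []      = refl
mapIdx-comm d e c p (x ∷ γ) = ≡.cong₂ _∷_ (c p x) (mapIdx-comm d e c (suc p) γ)

shiftZ-comm : ∀ i j a i′ j′ a′ γ → shiftZ i j a (shiftZ i′ j′ a′ γ) ≡ shiftZ i′ j′ a′ (shiftZ i j a γ)
shiftZ-comm i j a i′ j′ a′ γ = begin
  shiftZ i j a (shiftZ i′ j′ a′ γ)     ≡⟨ ≡.cong (shiftZ i j a) (shiftZ-mapIdx i′ j′ a′ γ) ⟩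
  shiftZ i j a (mapIdx e 1 γ)          ≡⟨ shiftZ-mapIdx i j a _ ⟩
  mapIdx d 1 (mapIdx e 1 γ)            ≡⟨ mapIdx-comm d e (shiftEntry-comm i j a i′ j′ a′) 1 γ ⟩
  mapIdx e 1 (mapIdx d 1 γ)            ≡⟨ shiftZ-mapIdx i′ j′ a′ _ ⟨
  shiftZ i′ j′ a′ (mapIdx d 1 γ)       ≡⟨ ≡.cong (shiftZ i′ j′ a′) (shiftZ-mapIdx i j a γ) ⟨
  shiftZ i′ j′ a′ (shiftZ i j a γ) ∎
  where open ≡.≡-Reasoning
        d = shiftEntry i j a
        e = shiftEntry i′ j′ a′

mapIdx-shift : ∀ i j a p γ → mapIdx (shiftEntry (suc i) (suc j) a) (suc p) γ ≡ mapIdx (shiftEntry i j a) p γ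
mapIdx-shift i j a p []      = refl
mapIdx-shift i j a p (x ∷ γ) = ≡.cong (_ ∷_) (mapIdx-shift i j a (suc p) γ)

shiftZ-suc : ∀ i j a m γ → 1 ≤ i → 1 ≤ j → shiftZ (suc i) (suc j) a (m ∷ γ) ≡ m ∷ shiftZ i j a γ
shiftZ-suc (suc i) (suc j) a m γ _ _ = ≡.trans (shiftZ-mapIdx _ _ a (m ∷ γ))
  (≡.cong (m ∷_) (≡.trans (mapIdx-shift (suc i) (suc j) a 1 γ) (≡.sym (shiftZ-mapIdx _ _ a γ))))

lower : ℕ → List ℤ → List ℤ
lower n       []      = []
lower zero    (g ∷ γ) = ℤ.pred g ∷ γ
lower (suc n) (g ∷ γ) = g ∷ lower n γ

private
  ≡ᵇ-refl : ∀ n → (n ≡ᵇ n) ≡ true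
  ≡ᵇ-refl zero    = refl
  ≡ᵇ-refl (suc n) = ≡ᵇ-refl n

  ≡ᵇ-less : ∀ {p q} → p ℕ.< q → (p ≡ᵇ q) ≡ false
  ≡ᵇ-less {zero}  {suc q} _       = refl
  ≡ᵇ-less {suc p} {suc q} (s≤s l) = ≡ᵇ-less l

  ≡ᵇ-greater : ∀ {p q} → q ℕ.< p → (p ≡ᵇ q) ≡ false
  ≡ᵇ-greater {suc p} {zero}  _       = refl
  ≡ᵇ-greater {suc p} {suc q} (s≤s l) = ≡ᵇ-greater l

  shiftEntry-other : ∀ {i j a p x} → (p ≡ᵇ i) ≡ false → (p ≡ᵇ j) ≡ false → shiftEntry i j a p x ≡ x
  shiftEntry-other {i} {j} {a} {p} e e′ rewrite e | e′ = refl

  beyond : ∀ i j a p γ → i ℕ.< p → j ℕ.< p → mapIdx (shiftEntry i j a) p γ ≡ γ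
  beyond i j a p []      i<p j<p = refl
  beyond i j a p (x ∷ γ) i<p j<p = ≡.cong₂ _∷_ (shiftEntry-other {i} {j} {a} {p} (≡ᵇ-greater i<p) (≡ᵇ-greater j<p))
    (beyond i j a (suc p) γ (ℕP.m≤n⇒m≤1+n i<p) (ℕP.m≤n⇒m≤1+n j<p))

  lower-mapIdx : ∀ n q γ → mapIdx (shiftEntry 1 (n ℕ.+ suc (suc q)) (+ 1)) (suc (suc q)) γ ≡ lower n γ
  lower-mapIdx n       q []      = refl
  lower-mapIdx zero    q (x ∷ γ) rewrite ≡ᵇ-refl q = ≡.cong₂ _∷_ (ℤP.+-comm x -[1+ 0 ]) (beyond 1 (suc (suc q)) (+ 1) (suc (suc (suc q))) γ (s≤s (s≤s z≤n)) ℕP.≤-refl)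
  lower-mapIdx (suc n) q (x ∷ γ) = ≡.cong₂ _∷_
    (shiftEntry-other {1} {suc n ℕ.+ suc (suc q)} {+ 1} {suc (suc q)} refl (≡ᵇ-less (s≤s (ℕP.m≤n+m (suc (suc q)) n))))
    (≡.trans (≡.cong (λ z → mapIdx (shiftEntry 1 z (+ 1)) (suc (suc (suc q))) γ) (≡.sym (ℕP.+-suc n (suc (suc q)))))
      (lower-mapIdx n (suc q) γ))

-- `lower` counts the tail from 0 while roots count all rows from 1, so column `n + 2` is entry `n`
-- of the tail.
shiftZ-first : ∀ n m γ → shiftZ 1 (suc (suc n)) (+ 1) (m ∷ γ) ≡ ℤ.suc m ∷ lower n γ
shiftZ-first n m γ = ≡.trans (shiftZ-mapIdx 1 (suc (suc n)) (+ 1) (m ∷ γ)) (≡.cong₂ _∷_ (ℤP.+-comm m (+ 1))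
  (≡.trans (≡.cong (λ z → mapIdx (shiftEntry 1 z (+ 1)) 2 γ) (ℕP.+-comm 2 n)) (lower-mapIdx n 0 γ)))

-- Root ideals described by the number of non-roots in each row

rowFrom : ℕ → ℕ → List (ℕ × ℕ)
rowFrom n zero    = []
rowFrom n (suc r) = (1 , suc (suc n)) ∷ rowFrom (suc n) r

bump : List (ℕ × ℕ) → List (ℕ × ℕ)
bump = map λ p → suc (proj₁ p) , suc (proj₂ p)

-- The roots (i , j) of a root ideal whose i-th row misses its first nᵢ roots.
rootPairs : List ℕ → List (ℕ × ℕ)
rootPairs []       = []
rootPairs (n ∷ ns) = rowFrom n (length ns ℕ.∸ n) ++ bump (rootPairs ns)

PositivePair : ℕ × ℕ → Set
PositivePair p = 1 ≤ proj₁ p × 1 ≤ proj₂ p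

rootPairs-positive : ∀ ns → All PositivePair (rootPairs ns)
rootPairs-positive []       = []
rootPairs-positive (n ∷ ns) = AllP.++⁺ (first n (length ns ℕ.∸ n)) (AllP.map⁺ (All.universal (λ _ → s≤s z≤n , s≤s z≤n) _))
  where
  first : ∀ n r → All PositivePair (rowFrom n r)
  first n zero    = []
  first n (suc r) = (s≤s z≤n , s≤s z≤n) ∷ first (suc n) r

-- The row lengths of the triangle of all pairs. With these counts the row form `Fr` below is the
-- operator B_γ.
stair : ℕ → List ℕ
stair zero    = []
stair (suc r) = r ∷ stair r

sumℤ : List ℤ → ℤ
sumℤ = foldr ℤ._+_ (+ 0)

-- The indices (γ , κ′) that occur when, for each row of ν in turn, the operators raising it at the cost of
-- the first N entries of κ are applied.
data OutTerm : List ℕ → List ℤ → List ℤ → List ℤ → List ℤ → Set where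
  []    : ∀ {ν κ} → OutTerm [] ν κ ν κ
  nil   : ∀ {N Ns κ} → OutTerm (N ∷ Ns) [] κ [] κ
  raise : ∀ {N Ns m i ν γ κ κ′ κ″} → m ℤ.≤ i → i ℤ.≤ m ℤ.+ + N → Lw N κ κ′ →
          OutTerm Ns ν κ′ γ κ″ → OutTerm (N ∷ Ns) (m ∷ ν) κ (i ∷ γ) κ″

OutTerm-sum : ∀ {Ns ν κ γ κ′} → OutTerm Ns ν κ γ κ′ → sumℤ ν ℤ.≤ sumℤ γ
OutTerm-sum []              = ℤP.≤-refl
OutTerm-sum nil             = ℤP.≤-refl
OutTerm-sum (raise p _ _ o) = ℤP.+-mono-≤ p (OutTerm-sum o)

-- Rows whose non-roots reach the last row: no pair is a root, and by `Fr-truncate` the counts act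
-- like a staircase.
data Tall : List ℕ → Set where
  []  : Tall []
  _∷_ : ∀ {n ns} → length ns ℕ.≤ n → Tall ns → Tall (n ∷ ns)

-- Weights of a block

data StrictBelow : ℤ → List ℤ → Set where
  []  : ∀ {u} → StrictBelow u []
  _∷_ : ∀ {u x w} → x ℤ.< u → StrictBelow x w → StrictBelow u (x ∷ w)

-- γ plus the staircase (r - 1, ..., 0): the coordinates in which the exchange of (a , b) for (b - 1
-- , a + 1) is a transposition.
weights : List ℤ → List ℤ
weights []      = []
weights (x ∷ γ) = (x ℤ.+ + length γ) ∷ weights γ

unweights : List ℤ → List ℤ
unweights []      = []
unweights (x ∷ w) = (x ℤ.- + length w) ∷ unweights w

length-weights : ∀ γ → length (weights γ) ≡ length γ
length-weights []      = refl
length-weights (x ∷ γ) = ≡.cong suc (length-weights γ)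

length-unweights : ∀ w → length (unweights w) ≡ length w
length-unweights []      = refl
length-unweights (x ∷ w) = ≡.cong suc (length-unweights w)

private
  +-cancelʳ : ∀ x y → x ℤ.+ y ℤ.- y ≡ x
  +-cancelʳ x y = ≡.trans (ℤP.+-assoc x y _) (≡.trans (≡.cong (λ z → x ℤ.+ z) (ℤP.+-inverseʳ y)) (ℤP.+-identityʳ x))

  -‿cancelʳ : ∀ x y → x ℤ.- y ℤ.+ y ≡ x
  -‿cancelʳ x y = ≡.trans (ℤP.+-assoc x _ y) (≡.trans (≡.cong (λ z → x ℤ.+ z) (ℤP.+-inverseˡ y)) (ℤP.+-identityʳ x))

unweights∘weights : ∀ γ → unweights (weights γ) ≡ γ
unweights∘weights []      = refl
unweights∘weights (x ∷ γ) = ≡.cong₂ _∷_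
  (≡.trans (≡.cong (λ l → x ℤ.+ + length γ ℤ.- + l) (length-weights γ)) (+-cancelʳ x _))
  (unweights∘weights γ)

weights∘unweights : ∀ w → weights (unweights w) ≡ w
weights∘unweights []      = refl
weights∘unweights (x ∷ w) = ≡.cong₂ _∷_
  (≡.trans (≡.cong (λ l → x ℤ.- + length w ℤ.+ + l) (length-unweights w)) (-‿cancelʳ x _))
  (weights∘unweights w)

private
  prefix : ℕ → List ℤ → List ℤ
  prefix n []      = []
  prefix n (x ∷ p) = (x ℤ.- + (length p ℕ.+ n)) ∷ prefix n p

  unweights-++ : ∀ p s → unweights (p ++ s) ≡ prefix (length s) p ++ unweights s
  unweights-++ []      s = refl
  unweights-++ (x ∷ p) s = ≡.cong₂ _∷_ (≡.cong (λ l → x ℤ.- + l) (length-++ p)) (unweights-++ p s)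

  pred-minus : ∀ b l → ℤ.pred (b ℤ.- + l) ≡ b ℤ.- + suc l
  pred-minus b l = ≡.trans (ℤP.+-comm -[1+ 0 ] (b ℤ.- + l)) (≡.trans (ℤP.+-assoc b _ _)
    (≡.cong (λ z → b ℤ.+ z) (≡.trans (≡.sym (ℤP.neg-distrib-+ (+ l) (+ 1))) (≡.cong ℤ.-_ (ℤP.+-comm (+ l) (+ 1))))))

  suc-minus : ∀ a l → ℤ.suc (a ℤ.- + suc l) ≡ a ℤ.- + l
  suc-minus a l = ≡.trans (≡.cong ℤ.suc (≡.sym (pred-minus a l))) (ℤP.suc-pred _)

-- Partitions, and how far a block can lower the rows behind it

-- Weakly decreasing lists with entries at most d.
data Dec : ℕ → List ℕ → Set where
  []  : ∀ {d} → Dec d []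
  _∷_ : ∀ {d x μ} → x ≤ d → Dec x μ → Dec d (x ∷ μ)

Dec-mono : ∀ {d e μ} → d ≤ e → Dec d μ → Dec e μ
Dec-mono p []      = []
Dec-mono p (q ∷ D) = ℕP.≤-trans q p ∷ D

-- Stairs p κ κ′ : κ′ is obtained from κ by lowering the c-th entry (counting from 1) by at most p ∸ c.
data Stairs : ℕ → List ℤ → List ℤ → Set where
  []   : ∀ {p} → Stairs p [] []
  cons : ∀ {p x y κ κ′} → y ℤ.≤ x → x ℤ.≤ y ℤ.+ + ℕ.pred p → Stairs (ℕ.pred p) κ κ′ →
         Stairs p (x ∷ κ) (y ∷ κ′)

Stairs-refl : ∀ p κ → Stairs p κ κ
Stairs-refl p []      = []
Stairs-refl p (x ∷ κ) = cons ℤP.≤-refl (ℤP.i≤i+j x _) (Stairs-refl (ℕ.pred p) κ)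

Stairs-mono : ∀ {p q κ κ′} → p ≤ q → Stairs p κ κ′ → Stairs q κ κ′
Stairs-mono p≤q []           = []
Stairs-mono p≤q (cons {y = y} a b S) =
  cons a (ℤP.≤-trans b (ℤP.+-monoʳ-≤ y (ℤ.+≤+ (ℕP.pred-mono-≤ p≤q)))) (Stairs-mono (ℕP.pred-mono-≤ p≤q) S)

Stairs-length : ∀ {p κ κ′} → Stairs p κ κ′ → length κ′ ≡ length κ
Stairs-length []           = refl
Stairs-length (cons _ _ S) = ≡.cong suc (Stairs-length S)

Stairs-zero : ∀ {κ κ′} → Stairs 0 κ κ′ → κ′ ≡ κ
Stairs-zero []           = refl
Stairs-zero (cons a b S) =
  ≡.cong₂ _∷_ (ℤP.≤-antisym a (ℤP.≤-trans b (ℤP.≤-reflexive (ℤP.+-identityʳ _)))) (Stairs-zero S)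

pred-+-suc : ∀ y n → ℤ.pred y ℤ.+ + suc n ≡ y ℤ.+ + n
pred-+-suc y n = ≡.trans (≡.sym (suc-+ (ℤ.pred y) n)) (≡.cong (ℤ._+ + n) (ℤP.suc-pred y))

-- An entry `c ≤ N` may already have lost `p ∸ c`, which is at most `N ∸ c`; the next staircase
-- allows `suc N ∸ c`, room for one more.
Stairs-Lw : ∀ {p N κ₀ κ κ′} → p ≤ N → Stairs p κ₀ κ → Lw N κ κ′ → Stairs (suc N) κ₀ κ′
Stairs-Lw p≤N S stop = Stairs-mono (ℕP.≤-trans p≤N (ℕP.n≤1+n _)) S
Stairs-Lw p≤N [] nil = []
Stairs-Lw p≤N (cons {y = y} a b S) (keep l) =
  cons a (ℤP.≤-trans b (ℤP.+-monoʳ-≤ y (ℤ.+≤+ (ℕP.≤-trans (ℕP.pred-mono-≤ p≤N) (ℕP.n≤1+n _)))))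
       (Stairs-Lw (ℕP.pred-mono-≤ p≤N) S l)
Stairs-Lw {N = suc N} p≤N (cons {y = y} a b S) (down l) =
  cons (ℤP.≤-trans (ℤP.i≤j⇒pred[i]≤j ℤP.≤-refl) a)
       (ℤP.≤-trans b (ℤP.≤-trans (ℤP.+-monoʳ-≤ y (ℤ.+≤+ (ℕP.pred-mono-≤ p≤N)))
         (ℤP.≤-reflexive (≡.sym (pred-+-suc y N)))))
       (Stairs-Lw (ℕP.pred-mono-≤ p≤N) S l)

data Increasing : ℕ → ℕ → List ℕ → Set where
  []  : ∀ {p q} → p ≤ q → Increasing p q []
  _∷_ : ∀ {p q N Ns} → p ≤ N → Increasing (suc N) q Ns → Increasing p q (N ∷ Ns)

Increasing-≤ : ∀ {p q Ns} → Increasing p q Ns → p ≤ q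
Increasing-≤ ([] p)  = p
Increasing-≤ (p ∷ I) = ℕP.≤-trans p (ℕP.≤-trans (ℕP.n≤1+n _) (Increasing-≤ I))

-- Only rows with count at least `c` reach the entry `c`. As the counts increase strictly from `p`
-- and stay below `q`, the losses add up to at most `q ∸ c`.
OutTerm-Stairs : ∀ {p q Ns ν κ₀ κ γ κ′} → Increasing p q Ns → OutTerm Ns ν κ γ κ′ →
                 Stairs p κ₀ κ → Stairs q κ₀ κ′
OutTerm-Stairs ([] p≤q)  []            S = Stairs-mono p≤q S
OutTerm-Stairs I@(_ ∷ _) nil           S = Stairs-mono (Increasing-≤ I) S
OutTerm-Stairs (p ∷ I)   (raise _ _ l o) S = OutTerm-Stairs I o (Stairs-Lw p S l)

OutTerm-length : ∀ {Ns ν κ γ κ′} → OutTerm Ns ν κ γ κ′ → length γ ≡ length ν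
OutTerm-length []              = refl
OutTerm-length nil             = refl
OutTerm-length (raise _ _ _ o) = ≡.cong suc (OutTerm-length o)

-- Confines the weights of a block to the window from `lo` to `k`, even after a row has gained one
-- for each of its `N` non-roots outside the block.
data RowBounds (lo : ℤ) (k : ℕ) : List ℕ → List ℤ → Set where
  []   : RowBounds lo k [] []
  cons : ∀ {N Ns y ν} → lo ℤ.≤ y ℤ.+ + length ν → y ℤ.+ + N ℤ.+ + length ν ℤ.≤ + k →
         RowBounds lo k Ns ν → RowBounds lo k (N ∷ Ns) (y ∷ ν)

≤⇒<suc : ∀ {i k} → i ℤ.≤ + k → i ℤ.< + suc k
≤⇒<suc p = ℤP.≤-<-trans p (ℤ.+<+ ℕP.≤-refl)

OutTerm-weights : ∀ {lo k Ns ν κ γ κ′} → RowBounds lo k Ns ν → OutTerm Ns ν κ γ κ′ →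
  All (lo ℤ.≤_) (weights γ) × All (ℤ._< + suc k) (weights γ)
OutTerm-weights []           []            = [] , []
OutTerm-weights {k = k} (cons {N} {_} {y} {ν} a b R) (raise {i = i} {γ = γ} p q _ o) with OutTerm-weights R o
... | A , A′ =
    (ℤP.≤-trans a (ℤP.≤-trans (ℤP.+-monoˡ-≤ (+ length ν) p) len≤)) ∷ A
  , ≤⇒<suc (ℤP.≤-trans (ℤP.≤-reflexive (≡.sym len)) (ℤP.≤-trans (ℤP.+-monoˡ-≤ (+ length ν) q) b)) ∷ A′
  where
  len : i ℤ.+ + length ν ≡ i ℤ.+ + length γ
  len = ≡.cong (λ l → i ℤ.+ + l) (≡.sym (OutTerm-length o))
  len≤ = ℤP.≤-reflexive len

module Excess (k : ℕ) where

  -- In the root ideal of a k-Schur function row i has k − μᵢ non-roots; excess ν lists how many of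
  -- them lie beyond the block formed by the rows of ν.
  excess : List ℕ → List ℕ
  excess []      = []
  excess (x ∷ ν) = (k ℕ.∸ x ℕ.∸ length ν) ∷ excess ν

  length-excess : ∀ ν → length (excess ν) ≡ length ν
  length-excess []      = refl
  length-excess (x ∷ ν) = ≡.cong suc (length-excess ν)

  tail-length : ∀ {d x l} → x ≤ d → suc l ≤ suc (k ℕ.∸ d) → l ≤ k ℕ.∸ x
  tail-length x≤d (s≤s p) = ℕP.≤-trans p (ℕP.∸-monoʳ-≤ k x≤d)

  -- Parts at most `d` give every row at least `k ∸ d` non-roots, enough to cover the rest of a
  -- block of at most `k ∸ d + 1` rows.
  non-roots : ∀ {d} ν → Dec d ν → length ν ≤ suc (k ℕ.∸ d) →
    map (k ℕ.∸_) ν ≡ zipWith ℕ._+_ (stair (length (excess ν))) (excess ν)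
  non-roots []      []       p = refl
  non-roots (x ∷ ν) (le ∷ D) p = ≡.cong₂ _∷_
    (≡.trans (≡.sym (ℕP.m+[n∸m]≡n (tail-length le p)))
             (≡.cong (ℕ._+ (k ℕ.∸ x ℕ.∸ length ν)) (≡.sym (length-excess ν))))
    (non-roots ν D (ℕP.≤-trans (tail-length le p) (ℕP.n≤1+n _)))

  -- From one row to the next the part does not grow and one row fewer of the block remains below,
  -- so the excess grows by at least one. The last row has excess `k ∸ x` with `x ≥ lo`, hence the
  -- upper end.
  excess-increasing : ∀ {d lo} p ν → Dec d ν → All (lo ≤_) ν → lo ≤ d → p ℕ.+ length ν ≤ suc (k ℕ.∸ d) →
    Increasing p (suc (k ℕ.∸ lo)) (excess ν)
  excess-increasing p []      []       []       lo≤d h =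
    [] (ℕP.≤-trans (ℕP.≤-reflexive (≡.sym (ℕP.+-identityʳ p)))
       (ℕP.≤-trans h (s≤s (ℕP.∸-monoʳ-≤ k lo≤d))))
  excess-increasing p (x ∷ ν) (le ∷ D) (lo≤x ∷ A) lo≤d h =
    ℕP.m+n≤o⇒m≤o∸n p p+l ∷
    excess-increasing _ ν D A lo≤x (s≤s (ℕP.≤-reflexive (ℕP.m∸n+n≡m l≤)))
    where
    p+l : p ℕ.+ length ν ≤ k ℕ.∸ x
    p+l = ℕP.≤-trans (ℕP.≤-pred (ℕP.≤-trans (ℕP.≤-reflexive (≡.sym (ℕP.+-suc p _))) h)) (ℕP.∸-monoʳ-≤ k le)
    l≤ : length ν ≤ k ℕ.∸ x
    l≤ = ℕP.m+n≤o⇒n≤o p p+l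

  -- An entry with `l` rows of the block below it loses at most `l`, which is what the staircase
  -- adds back in its weight. At the upper end, part, excess and remaining rows add up to `k`.
  excess-bounds : ∀ {d lo ν′} ν → Dec d ν → d ≤ k → All (lo ≤_) ν → length ν ≤ suc (k ℕ.∸ d) →
    Stairs (length ν) (toZ ν) ν′ → RowBounds (+ lo) k (excess ν) ν′
  excess-bounds []      []       d≤k []         p []           = []
  excess-bounds {ν′ = y ∷ ν′} (x ∷ ν) (le ∷ D) d≤k (lo≤x ∷ A) p (cons a b S) = cons
    (ℤP.≤-trans (ℤ.+≤+ lo≤x) (ℤP.≤-trans b (ℤP.≤-reflexive (≡.cong (λ l → y ℤ.+ + l) len))))
    (ℤP.≤-trans (ℤP.+-monoˡ-≤ _ (ℤP.+-monoˡ-≤ _ a)) (ℤ.+≤+ (ℕP.≤-reflexive total)))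
    (excess-bounds ν D (ℕP.≤-trans le d≤k) A (ℕP.≤-trans (tail-length le p) (ℕP.n≤1+n _)) S)
    where
    len : length ν ≡ length ν′
    len = ≡.trans (≡.sym (length-map +_ ν)) (≡.sym (Stairs-length S))
    total : x ℕ.+ (k ℕ.∸ x ℕ.∸ length ν) ℕ.+ length ν′ ≡ k
    total = ≡.trans (≡.cong (x ℕ.+ (k ℕ.∸ x ℕ.∸ length ν) ℕ.+_) (≡.sym len))
      (≡.trans (ℕP.+-assoc x _ _) (≡.trans (≡.cong (x ℕ.+_) (ℕP.m∸n+n≡m (tail-length le p)))
        (ℕP.m+[n∸m]≡n (ℕP.≤-trans le d≤k))))

-- What sorted weights can look like

-- Here the innermost operator has a negative index and kills 1; lowering entries keeps it so.
data LastNegative : List ℤ → Set where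
  last  : ∀ {x} → x ℤ.< + 0 → LastNegative (x ∷ [])
  there : ∀ {x y γ} → LastNegative (y ∷ γ) → LastNegative (x ∷ y ∷ γ)

Lw-LastNegative : ∀ {n γ γ′} → LastNegative γ → Lw n γ γ′ → LastNegative γ′
Lw-LastNegative L         stop            = L
Lw-LastNegative (last p)  (keep stop)     = last p
Lw-LastNegative (last p)  (keep nil)      = last p
Lw-LastNegative (last p)  (down stop)     = last (ℤP.≤-<-trans (ℤP.i≤j⇒pred[i]≤j ℤP.≤-refl) p)
Lw-LastNegative (last p)  (down nil)      = last (ℤP.≤-<-trans (ℤP.i≤j⇒pred[i]≤j ℤP.≤-refl) p)
Lw-LastNegative (there L) (keep stop)     = there L
Lw-LastNegative (there L) (keep (keep l)) = there (Lw-LastNegative L (keep l))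
Lw-LastNegative (there L) (keep (down l)) = there (Lw-LastNegative L (down l))
Lw-LastNegative (there L) (down stop)     = there L
Lw-LastNegative (there L) (down (keep l)) = there (Lw-LastNegative L (keep l))
Lw-LastNegative (there L) (down (down l)) = there (Lw-LastNegative L (down l))

weight-≤ : ∀ {x y} l → y ℤ.+ + l ℤ.< x ℤ.+ + suc l → y ℤ.≤ x
weight-≤ {x} {y} l p = ≡.subst (y ℤ.≤_) (ℤP.pred-suc x) (ℤP.i<j⇒i≤pred[j]
  (cancel (ℤP.<-≤-trans p (ℤP.≤-reflexive (≡.sym (suc-+ x l))))))
  where
  cancel : y ℤ.+ + l ℤ.< ℤ.suc x ℤ.+ + l → y ℤ.< ℤ.suc x
  cancel q = ℤP.≰⇒> λ r → ℤP.<⇒≱ q (ℤP.+-monoˡ-≤ (+ l) r)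

below-negative : ∀ x γ → x ℤ.< + 0 → StrictBelow (x ℤ.+ + length γ) (weights γ) → LastNegative (x ∷ γ)
below-negative x []      p []      = last p
below-negative x (y ∷ γ) p (q ∷ S) = there (below-negative y γ (ℤP.≤-<-trans (weight-≤ (length γ) q) p) S)

-- Strictly decreasing weights come from weakly decreasing entries, and the bound on the first
-- weight bounds the first part by `d`. Only the sign of the last entry can prevent a partition.
strict⇒Dec : ∀ d γ → StrictBelow (+ (d ℕ.+ length γ)) (weights γ) →
  LastNegative γ ⊎ (∃ λ ν → γ ≡ toZ ν × Dec d ν)
strict⇒Dec d []             []      = inj₂ ([] , refl , [])
strict⇒Dec d (-[1+ n ] ∷ γ) (p ∷ S) = inj₁ (below-negative -[1+ n ] γ ℤ.-<+ S)
strict⇒Dec d (+ n ∷ [])     (p ∷ S) = inj₂ (n ∷ [] , refl , ℤP.drop‿+≤+ (weight-≤ 0 p) ∷ [])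
strict⇒Dec d (+ n ∷ y ∷ γ)  (p ∷ S) with strict⇒Dec n (y ∷ γ) S
... | inj₁ L           = inj₁ (there L)
... | inj₂ (ν , e , D) =
  inj₂ (n ∷ ν , ≡.cong (+ n ∷_) e , ℤP.drop‿+≤+ (weight-≤ (suc (length γ)) p) ∷ D)

-- The last weight is the last entry itself.
LastNegative-weights : ∀ {lo γ} → LastNegative γ → All (+ lo ℤ.≤_) (weights γ) → ⊥
LastNegative-weights (last {x} p) (q ∷ []) =
  ℤP.<⇒≱ p (ℤP.≤-trans (ℤP.≤-trans (ℤ.+≤+ z≤n) q) (ℤP.≤-reflexive (ℤP.+-identityʳ x)))
LastNegative-weights (there L)    (_ ∷ A)  = LastNegative-weights L A

weights-≥ : ∀ {d lo} ν → Dec d ν → All (+ lo ℤ.≤_) (weights (toZ ν)) → All (lo ≤_) ν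
weights-≥ []          D           A        = []
weights-≥ (x ∷ [])    D           (q ∷ []) = ≡.subst (_ ≤_) (ℕP.+-identityʳ x) (ℤP.drop‿+≤+ q) ∷ []
weights-≥ (x ∷ y ∷ ν) (_ ∷ D)     (_ ∷ A)  with weights-≥ (y ∷ ν) D A
weights-≥ (x ∷ y ∷ ν) (_ ∷ y≤x ∷ D) (_ ∷ A) | lo≤y ∷ A′ = ℕP.≤-trans lo≤y y≤x ∷ lo≤y ∷ A′

private
  staircase-sum : ℕ → ℤ
  staircase-sum zero    = + 0
  staircase-sum (suc l) = + l ℤ.+ staircase-sum l

  open import Algebra.Properties.CommutativeSemigroup ℤP.+-commutativeSemigroup using (interchange)

  sum-weights : ∀ γ → sumℤ (weights γ) ≡ sumℤ γ ℤ.+ staircase-sum (length γ)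
  sum-weights []      = refl
  sum-weights (x ∷ γ) = ≡.trans (≡.cong (λ z → (x ℤ.+ + length γ) ℤ.+ z) (sum-weights γ))
                                (interchange x (+ length γ) (sumℤ γ) _)

  sum-↭ : ∀ {v w} → v ↭ w → sumℤ v ≡ sumℤ w
  sum-↭ Perm.refl          = refl
  sum-↭ (prep x π)         = ≡.cong (λ z → x ℤ.+ z) (sum-↭ π)
  sum-↭ (swap {v} {w} x y π) = ≡.trans (≡.cong (λ z → x ℤ.+ (y ℤ.+ z)) (sum-↭ π))
    (≡.trans (≡.sym (ℤP.+-assoc x y _)) (≡.trans (≡.cong (ℤ._+ sumℤ w) (ℤP.+-comm x y)) (ℤP.+-assoc y x _)))
  sum-↭ (Perm.trans π ρ)   = ≡.trans (sum-↭ π) (sum-↭ ρ)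

  +-cancel : ∀ {x y} z → x ℤ.+ z ≡ y ℤ.+ z → x ≡ y
  +-cancel {x} {y} z e = ℤP.≤-antisym (le (ℤP.≤-reflexive e)) (le (ℤP.≤-reflexive (≡.sym e)))
    where
    le : ∀ {x y} → x ℤ.+ z ℤ.≤ y ℤ.+ z → x ℤ.≤ y
    le q = ℤP.≮⇒≥ λ r → ℤP.<⇒≱ (ℤP.+-monoˡ-< z r) q

-- Sorting the weights keeps the sum of the block, the quantity on which the recursion in `prepend`
-- runs.
weights-↭-sum : ∀ {γ γ′} → length γ′ ≡ length γ → weights γ′ ↭ weights γ → sumℤ γ′ ≡ sumℤ γ
weights-↭-sum {γ} {γ′} e π = +-cancel (staircase-sum (length γ))
  (≡.trans (≡.cong (λ l → sumℤ γ′ ℤ.+ staircase-sum l) (≡.sym e))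
    (≡.trans (≡.sym (sum-weights γ′)) (≡.trans (sum-↭ π) (sum-weights γ))))

Dec-sum : ∀ {d} ν → Dec d ν → sumℤ (toZ ν) ℤ.≤ + (length ν ℕ.* d)
Dec-sum []          []      = ℤP.≤-refl
Dec-sum {d} (x ∷ ν) (p ∷ D) = ℤP.+-mono-≤ (ℤ.+≤+ p)
  (ℤP.≤-trans (Dec-sum ν D) (ℤ.+≤+ (ℕP.*-monoʳ-≤ (length ν) p)))

-- For nonempty ν, `lo` is its last part: the bound that separates ν from σ.
Dec-++ : ∀ {d} ν {σ} → Dec d (ν ++ σ) → Dec d ν × (∃ λ lo → lo ≤ d × All (lo ≤_) ν × Dec lo σ)
Dec-++ []      D       = [] , _ , ℕP.≤-refl , [] , D
Dec-++ (x ∷ ν) (p ∷ D) with Dec-++ ν D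
... | D′ , lo , lo≤x , A , E = p ∷ D′ , lo , ℕP.≤-trans lo≤x p , lo≤x ∷ A , E

++-Dec : ∀ {d lo ν σ} → Dec d ν → All (lo ≤_) ν → lo ≤ d → Dec lo σ → Dec d (ν ++ σ)
++-Dec []      []        lo≤d E = Dec-mono lo≤d E
++-Dec (p ∷ D) (q ∷ A)   lo≤d E = p ∷ ++-Dec D A q E

Stairs-++ : ∀ {p} ν {κ α} → length ν ≡ p → Stairs p (toZ ν ++ κ) α →
  ∃ λ ν′ → α ≡ ν′ ++ κ × Stairs p (toZ ν) ν′
Stairs-++ []      refl S = [] , Stairs-zero S , []
Stairs-++ (x ∷ ν) refl (cons {y = y} a b S) with Stairs-++ ν refl S
... | ν′ , refl , S′ = y ∷ ν′ , refl , cons a b S′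

split-at : ∀ r (μ : List ℕ) → r ≤ length μ → ∃ λ ν → ∃ λ σ → μ ≡ ν ++ σ × length ν ≡ r
split-at zero    μ       p       = [] , μ , refl , refl
split-at (suc r) (x ∷ μ) (s≤s p) with split-at r μ p
... | ν , σ , refl , refl = x ∷ ν , σ , refl , refl

strip-zeros : ∀ {d} μ → Dec d μ → ∃ λ ν → ∃ λ z → μ ≡ ν ++ replicate z 0 × All (1 ≤_) ν
strip-zeros []          []      = [] , 0 , refl , []
strip-zeros (zero ∷ μ)  (p ∷ D) = [] , suc (length μ) , ≡.cong (0 ∷_) (zeros D) , []
  where
  zeros : ∀ {μ} → Dec 0 μ → μ ≡ replicate (length μ) 0
  zeros []         = refl
  zeros (z≤n ∷ D)  = ≡.cong (0 ∷_) (zeros D)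
strip-zeros (suc x ∷ μ) (p ∷ D) with strip-zeros μ D
... | ν , z , refl , A = suc x ∷ ν , z , refl , s≤s z≤n ∷ A

length-stair : ∀ r → length (stair r) ≡ r
length-stair zero    = refl
length-stair (suc r) = ≡.cong suc (length-stair r)

toZ-length : ∀ μ → length (toZ μ) ≡ length μ
toZ-length = length-map +_

-- Lexicographic order, and the cases of straightening

data _≺_ : List ℤ → List ℤ → Set where
  here  : ∀ {x y γ δ} → x ℤ.< y → length γ ≡ length δ → (x ∷ γ) ≺ (y ∷ δ)
  there : ∀ {x γ δ} → γ ≺ δ → (x ∷ γ) ≺ (x ∷ δ)

≺-length : ∀ {γ δ} → γ ≺ δ → length γ ≡ length δ
≺-length (here _ e) = ≡.cong suc e
≺-length (there g)  = ≡.cong suc (≺-length g)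

≺-++ : ∀ p {γ δ} → γ ≺ δ → (p ++ γ) ≺ (p ++ δ)
≺-++ []      g = g
≺-++ (x ∷ p) g = there (≺-++ p g)

≺-++ʳ : ∀ {γ δ q} → γ ≺ δ → (γ ++ q) ≺ (δ ++ q)
≺-++ʳ {q = q} (here {γ = γ} {δ} lt e) =
  here lt (≡.trans (length-++ γ) (≡.trans (≡.cong (ℕ._+ length q) e) (≡.sym (length-++ δ))))
≺-++ʳ (there g) = there (≺-++ʳ g)

headℤ : List ℤ → ℤ
headℤ []      = + 0
headℤ (x ∷ _) = x

≺-head : ∀ {γ δ} → γ ≺ δ → headℤ γ ℤ.≤ headℤ δ
≺-head (here lt _) = ℤP.<⇒≤ lt
≺-head (there _)   = ℤP.≤-refl

-- A word in the B's vanishes on 1, is indexed by a partition, or has an ascent to which the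
-- quadratic relation applies.
data Shape (γ : List ℤ) : Set where
  negative  : LastNegative γ → Shape γ
  partition : ∀ {d} μ → Dec d μ → γ ≡ toZ μ → Shape γ
  ascent    : ∀ p x y q → x ℤ.< y → γ ≡ p ++ x ∷ y ∷ q → Shape γ

shape : ∀ γ → Shape γ
shape []             = partition {d = 0} [] [] refl
shape (-[1+ n ] ∷ []) = negative (last ℤ.-<+)
shape (+ n ∷ [])     = partition (n ∷ []) (ℕP.≤-refl ∷ []) refl
shape (x ∷ y ∷ γ)    = extend x (x ℤ.<? y) (shape (y ∷ γ))
  where
  extend : ∀ x {y γ} → Relation.Nullary.Dec (x ℤ.< y) → Shape (y ∷ γ) → Shape (x ∷ y ∷ γ)
  extend x (yes x<y) S                                          = ascent [] x _ _ x<y refl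
  extend x (no x≮y)  (negative L)                               = negative (there L)
  extend x (no x≮y)  (ascent p a b q a<b e)                     = ascent (x ∷ p) a b q a<b (≡.cong (x ∷_) e)
  extend (+ n) (no x≮y) (partition (m ∷ μ) (_ ∷ D) refl)        =
    partition (n ∷ m ∷ μ) (ℕP.≤-refl ∷ ℤP.drop‿+≤+ (ℤP.≮⇒≥ x≮y) ∷ D) refl
  extend -[1+ n ] (no x≮y) (partition (m ∷ μ) (_ ∷ D) refl)     = ⊥-elim (x≮y ℤ.-<+)

-- Products of factors 1 - t R along one row

-- `t` is any additive map because there are two cases of interest: the identity, with
-- multiplication by h_m as operators, for determinants; and multiplication by the variable t, with
-- the Bernstein operators, for Catalan functions.
module Rows (𝔸 : AbelianGroup 0ℓ 0ℓ)
  (t : AbelianGroup.Carrier 𝔸 → AbelianGroup.Carrier 𝔸)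
  (t-cong : ∀ {x y} → AbelianGroup._≈_ 𝔸 x y → AbelianGroup._≈_ 𝔸 (t x) (t y))
  (t-⊕ : ∀ x y → AbelianGroup._≈_ 𝔸 (t (AbelianGroup._∙_ 𝔸 x y)) (AbelianGroup._∙_ 𝔸 (t x) (t y)))
  where

  open AbelianGroup 𝔸 public
    renaming (Carrier to A; _≈_ to _≋_; _∙_ to _⊕_; ε to 𝟘; _⁻¹ to ⊝_; ∙-cong to ⊕-cong;
              ∙-congˡ to ⊕-congˡ; ∙-congʳ to ⊕-congʳ;
              ⁻¹-cong to ⊝-cong; identityˡ to ⊕-identityˡ; identityʳ to ⊕-identityʳ;
              inverseˡ to ⊕-inverseˡ; inverseʳ to ⊕-inverseʳ; assoc to ⊕-assoc; comm to ⊕-comm;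
              refl to ≋-refl; sym to ≋-sym; trans to ≋-trans; reflexive to ≋-reflexive)
    using (setoid; group; commutativeSemigroup)
  open Algebra.Properties.AbelianGroup 𝔸 public
    using () renaming (⁻¹-∙-comm to ⊝-⊕-comm; ε⁻¹≈ε to ⊝𝟘; ⁻¹-involutive to ⊝-involutive;
                       inverseʳ-unique to ⊕-inverse-unique)
  open Algebra.Properties.CommutativeSemigroup commutativeSemigroup public
    using () renaming (interchange to ⊕-interchange)
  module ≋-Reasoning = Relation.Binary.Reasoning.Setoid setoid

  record Additive (φ : A → A) : Set where
    field
      cong : ∀ {x y} → x ≋ y → φ x ≋ φ y
      ⊕-hom : ∀ x y → φ (x ⊕ y) ≋ φ x ⊕ φ y

    𝟘-hom : φ 𝟘 ≋ 𝟘
    𝟘-hom = begin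
      φ 𝟘                          ≈⟨ ⊕-identityʳ _ ⟨
      φ 𝟘 ⊕ 𝟘                      ≈⟨ ⊕-congˡ (⊕-inverseʳ (φ 𝟘)) ⟨
      φ 𝟘 ⊕ (φ 𝟘 ⊕ ⊝ φ 𝟘)          ≈⟨ ⊕-assoc _ _ _ ⟨
      (φ 𝟘 ⊕ φ 𝟘) ⊕ ⊝ φ 𝟘          ≈⟨ ⊕-congʳ (⊕-hom 𝟘 𝟘) ⟨
      φ (𝟘 ⊕ 𝟘) ⊕ ⊝ φ 𝟘            ≈⟨ ⊕-congʳ (cong (⊕-identityʳ 𝟘)) ⟩
      φ 𝟘 ⊕ ⊝ φ 𝟘                  ≈⟨ ⊕-inverseʳ _ ⟩
      𝟘 ∎
      where open ≋-Reasoning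

    ⊝-hom : ∀ x → φ (⊝ x) ≋ ⊝ φ x
    ⊝-hom x = ⊕-inverse-unique (φ x) (φ (⊝ x))
      (≋-trans (≋-sym (⊕-hom x (⊝ x))) (≋-trans (cong (⊕-inverseʳ x)) 𝟘-hom))

  t-additive : Additive t
  t-additive = record { cong = t-cong ; ⊕-hom = t-⊕ }

  open Additive t-additive public using () renaming (𝟘-hom to t-𝟘; ⊝-hom to t-⊝)

  record Linear (φ : A → A) : Set where
    field
      additive : Additive φ
      t-hom    : ∀ x → φ (t x) ≋ t (φ x)
    open Additive additive public

  infixl 6 _⊖_
  _⊖_ : A → A → A
  x ⊖ y = x ⊕ ⊝ t y

  ⊖-cong : ∀ {x x′ y y′} → x ≋ x′ → y ≋ y′ → x ⊖ y ≋ x′ ⊖ y′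
  ⊖-cong p q = ⊕-cong p (⊝-cong (t-cong q))

  ⊖-⊕ : ∀ a b c d → (a ⊕ b) ⊖ (c ⊕ d) ≋ (a ⊖ c) ⊕ (b ⊖ d)
  ⊖-⊕ a b c d = begin
    (a ⊕ b) ⊕ ⊝ t (c ⊕ d)           ≈⟨ ⊕-congˡ (⊝-cong (t-⊕ c d)) ⟩
    (a ⊕ b) ⊕ ⊝ (t c ⊕ t d)         ≈⟨ ⊕-congˡ (⊝-⊕-comm _ _) ⟨
    (a ⊕ b) ⊕ (⊝ t c ⊕ ⊝ t d)       ≈⟨ ⊕-interchange _ _ _ _ ⟩
    (a ⊖ c) ⊕ (b ⊖ d) ∎
    where open ≋-Reasoning

  ⊖-⊝ : ∀ a b → ⊝ (a ⊖ b) ≋ ⊝ a ⊖ ⊝ b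
  ⊖-⊝ a b = ≋-trans (≋-sym (⊝-⊕-comm a (⊝ t b))) (⊕-congˡ (⊝-cong (≋-sym (t-⊝ b))))

  -- The commutation of two factors 1 - t R and 1 - t R′, in expanded form.
  ⊖-medial : ∀ a b c d → (a ⊖ b) ⊖ (c ⊖ d) ≋ (a ⊖ c) ⊖ (b ⊖ d)
  ⊖-medial a b c d = begin
    (a ⊖ b) ⊖ (c ⊖ d)             ≈⟨ ⊖-⊕ a (⊝ t b) c (⊝ t d) ⟩
    (a ⊖ c) ⊕ (⊝ t b ⊖ ⊝ t d)     ≈⟨ ⊕-congˡ (⊖-⊝ (t b) (t d)) ⟨
    (a ⊖ c) ⊕ ⊝ (t b ⊖ t d)       ≈⟨ ⊕-congˡ (⊝-cong (⊕-congˡ (t-⊝ (t d)))) ⟨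
    (a ⊖ c) ⊕ ⊝ (t b ⊕ t (⊝ t d)) ≈⟨ ⊕-congˡ (⊝-cong (t-⊕ b _)) ⟨
    (a ⊖ c) ⊖ (b ⊖ d) ∎
    where open ≋-Reasoning

  ⊖-𝟘 : 𝟘 ⊖ 𝟘 ≋ 𝟘
  ⊖-𝟘 = ≋-trans (⊕-identityˡ _) (≋-trans (⊝-cong t-𝟘) ⊝𝟘)

  Linear-⊖ : ∀ {φ} → Linear φ → ∀ x y → φ (x ⊖ y) ≋ φ x ⊖ φ y
  Linear-⊖ L x y = ≋-trans (⊕-hom x _) (⊕-congˡ (≋-trans (⊝-hom _) (⊝-cong (t-hom y))))
    where open Linear L

  id-linear : Linear (λ x → x)
  id-linear = record { additive = record { cong = λ p → p ; ⊕-hom = λ _ _ → ≋-refl } ; t-hom = λ _ → ≋-refl }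

  ∘-linear : ∀ {φ ψ} → Linear φ → Linear ψ → Linear (φ ∘ ψ)
  ∘-linear P Q = record
    { additive = record
      { cong = λ e → P.cong (Q.cong e)
      ; ⊕-hom = λ x y → ≋-trans (P.cong (Q.⊕-hom x y)) (P.⊕-hom _ _) }
    ; t-hom = λ x → ≋-trans (P.cong (Q.t-hom x)) (P.t-hom _) }
    where module P = Linear P
          module Q = Linear Q

  ⊖-linear : ∀ {φ ψ} → Linear φ → Linear ψ → Linear (λ x → φ x ⊖ ψ x)
  ⊖-linear P Q = record
    { additive = record
      { cong = λ e → ⊖-cong (P.cong e) (Q.cong e)
      ; ⊕-hom = λ x y → ≋-trans (⊖-cong (P.⊕-hom x y) (Q.⊕-hom x y)) (⊖-⊕ _ _ _ _) }
    ; t-hom = λ x → ≋-trans (⊖-cong (P.t-hom x) (Q.t-hom x))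
                   (≋-sym (≋-trans (t-⊕ _ _) (⊕-congˡ (t-⊝ _)))) }
    where module P = Linear P
          module Q = Linear Q

  Family : Set
  Family = ℤ → List ℤ → A

  -- Rw n X m γ is the product of the operators 1 − t R over the pairs formed by the entry m and
  -- the first n entries of γ, applied to X; an R raising m and lowering a missing entry acts as 0.
  Rw : ℕ → Family → Family
  Rw zero    X m γ       = X m γ
  Rw (suc n) X m []      = X m []
  Rw (suc n) X m (g ∷ γ) = Rw n (λ i γ → X i (g ∷ γ)) m γ ⊖ Rw n (λ i γ → X i (ℤ.pred g ∷ γ)) (ℤ.suc m) γ

  Rw-cong-on : ∀ n {X Y} m γ → (∀ i {γ′} → Lw n γ γ′ → X i γ′ ≋ Y i γ′) → Rw n X m γ ≋ Rw n Y m γ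
  Rw-cong-on zero    m γ       e = e m stop
  Rw-cong-on (suc n) m []      e = e m nil
  Rw-cong-on (suc n) m (g ∷ γ) e = ⊖-cong (Rw-cong-on n m γ λ i l → e i (keep l))
                                          (Rw-cong-on n (ℤ.suc m) γ λ i l → e i (down l))

  Rw-cong : ∀ n {X Y} m γ → (∀ i γ′ → X i γ′ ≋ Y i γ′) → Rw n X m γ ≋ Rw n Y m γ
  Rw-cong n m γ e = Rw-cong-on n m γ λ i {γ′} _ → e i γ′

  Rw-⊖ : ∀ n X Y m γ → Rw n (λ i γ → X i γ ⊖ Y i γ) m γ ≋ Rw n X m γ ⊖ Rw n Y m γ
  Rw-⊖ zero    X Y m γ       = ≋-refl
  Rw-⊖ (suc n) X Y m []      = ≋-refl
  Rw-⊖ (suc n) X Y m (g ∷ γ) =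
    ≋-trans (⊖-cong (Rw-⊖ n _ _ m γ) (Rw-⊖ n _ _ (ℤ.suc m) γ)) (⊖-medial _ _ _ _)

  Rw-⊕ : ∀ n X Y m γ → Rw n (λ i γ → X i γ ⊕ Y i γ) m γ ≋ Rw n X m γ ⊕ Rw n Y m γ
  Rw-⊕ zero    X Y m γ       = ≋-refl
  Rw-⊕ (suc n) X Y m []      = ≋-refl
  Rw-⊕ (suc n) X Y m (g ∷ γ) =
    ≋-trans (⊖-cong (Rw-⊕ n _ _ m γ) (Rw-⊕ n _ _ (ℤ.suc m) γ)) (⊖-⊕ _ _ _ _)

  Rw-𝟘 : ∀ n m γ → Rw n (λ _ _ → 𝟘) m γ ≋ 𝟘
  Rw-𝟘 zero    m γ       = ≋-refl
  Rw-𝟘 (suc n) m []      = ≋-refl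
  Rw-𝟘 (suc n) m (g ∷ γ) = ≋-trans (⊖-cong (Rw-𝟘 n m γ) (Rw-𝟘 n _ γ)) ⊖-𝟘

  Rw-linear : ∀ {φ} → Linear φ → ∀ n X m γ → φ (Rw n X m γ) ≋ Rw n (λ i γ → φ (X i γ)) m γ
  Rw-linear L zero    X m γ       = ≋-refl
  Rw-linear L (suc n) X m []      = ≋-refl
  Rw-linear L (suc n) X m (g ∷ γ) =
    ≋-trans (Linear-⊖ L _ _) (⊖-cong (Rw-linear L n _ m γ) (Rw-linear L n _ _ γ))

  Rw-of-linear : ∀ n (Φ : ℤ → List ℤ → A → A) m γ → (∀ i γ → Linear (Φ i γ)) →
                 Linear (λ x → Rw n (λ i γ → Φ i γ x) m γ)
  Rw-of-linear zero    Φ m γ       L = L m γ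
  Rw-of-linear (suc n) Φ m []      L = L m []
  Rw-of-linear (suc n) Φ m (g ∷ γ) L =
    ⊖-linear (Rw-of-linear n _ m γ λ i γ → L i (g ∷ γ)) (Rw-of-linear n _ _ γ λ i γ → L i _)

  Rw-suc : ∀ n X m γ → Rw n X (ℤ.suc m) γ ≋ Rw n (λ i → X (ℤ.suc i)) m γ
  Rw-suc zero    X m γ       = ≋-refl
  Rw-suc (suc n) X m []      = ≋-refl
  Rw-suc (suc n) X m (g ∷ γ) = ⊖-cong (Rw-suc n _ m γ) (Rw-suc n _ (ℤ.suc m) γ)

  Rw-pred : ∀ n X m γ → Rw n X (ℤ.pred m) γ ≋ Rw n (λ i → X (ℤ.pred i)) m γ
  Rw-pred zero    X m γ       = ≋-refl
  Rw-pred (suc n) X m []      = ≋-refl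
  Rw-pred (suc n) X m (g ∷ γ) = ⊖-cong (Rw-pred n _ m γ) (≋-trans
    (≋-reflexive (≡.cong (λ i → Rw n (λ i γ → X i (ℤ.pred g ∷ γ)) i γ)
      (≡.trans (ℤP.suc-pred m) (≡.sym (ℤP.pred-suc m)))))
    (Rw-pred n _ (ℤ.suc m) γ))

  -- These two products share neither a raised index nor a list; in `Rw-comm-row` they share the
  -- raised index, in `Rw-comm-list` the lowered list.
  Rw-comm : ∀ a b (Z : ℤ → List ℤ → ℤ → List ℤ → A) m γ m′ κ →
    Rw a (λ i γ → Rw b (Z i γ) m′ κ) m γ ≋ Rw b (λ j κ → Rw a (λ i γ → Z i γ j κ) m γ) m′ κ
  Rw-comm zero    b Z m γ       m′ κ = ≋-refl
  Rw-comm (suc a) b Z m []      m′ κ = ≋-refl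
  Rw-comm (suc a) b Z m (g ∷ γ) m′ κ =
    ≋-trans (⊖-cong (Rw-comm a b _ m γ m′ κ) (Rw-comm a b _ (ℤ.suc m) γ m′ κ))
            (≋-sym (Rw-⊖ b _ _ m′ κ))

  Rw-comm-row : ∀ a b (Z : ℤ → List ℤ → List ℤ → A) m γ κ →
    Rw a (λ i γ → Rw b (λ i κ → Z i γ κ) i κ) m γ ≋ Rw b (λ i κ → Rw a (λ i γ → Z i γ κ) i γ) m κ
  Rw-comm-row zero    b Z m γ       κ = ≋-refl
  Rw-comm-row (suc a) b Z m []      κ = ≋-refl
  Rw-comm-row (suc a) b Z m (g ∷ γ) κ = begin
    Rw a (λ i γ → Rw b (λ i κ → Z i (g ∷ γ) κ) i κ) m γ
      ⊖ Rw a (λ i γ → Rw b (λ i κ → Z i (ℤ.pred g ∷ γ) κ) i κ) (ℤ.suc m) γ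
      ≈⟨ ⊖-cong (Rw-comm-row a b _ m γ κ) (Rw-comm-row a b _ (ℤ.suc m) γ κ) ⟩
    Rw b (λ i κ → Rw a (λ i γ → Z i (g ∷ γ) κ) i γ) m κ
      ⊖ Rw b (λ i κ → Rw a (λ i γ → Z i (ℤ.pred g ∷ γ) κ) i γ) (ℤ.suc m) κ
      ≈⟨ ⊖-cong ≋-refl (Rw-suc b _ m κ) ⟩
    _ ≈⟨ Rw-⊖ b _ _ m κ ⟨
    _ ∎
    where open ≋-Reasoning

  Rw-comm-list : ∀ a b (Z : ℤ → ℤ → List ℤ → A) m m′ γ →
    Rw a (λ i γ → Rw b (λ j γ → Z i j γ) m′ γ) m γ ≋ Rw b (λ j γ → Rw a (λ i γ → Z i j γ) m γ) m′ γ
  Rw-comm-list zero    b       Z m m′ γ       = ≋-refl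
  Rw-comm-list (suc a) b       Z m m′ []      = Rw-[] b
    where
    Rw-[] : ∀ b → Rw b (λ j γ → Z m j γ) m′ [] ≋ Rw b (λ j γ → Rw (suc a) (λ i γ → Z i j γ) m γ) m′ []
    Rw-[] zero    = ≋-refl
    Rw-[] (suc b) = ≋-refl
  Rw-comm-list (suc a) zero    Z m m′ (g ∷ γ) = ≋-refl
  Rw-comm-list (suc a) (suc b) Z m m′ (g ∷ γ) = begin
    _ ≈⟨ ⊖-cong (Rw-⊖ a _ _ m γ) (Rw-⊖ a _ _ (ℤ.suc m) γ) ⟩
    _ ≈⟨ ⊖-cong (⊖-cong (Rw-comm-list a b _ m m′ γ) (Rw-comm-list a b _ m (ℤ.suc m′) γ))
                (⊖-cong (Rw-comm-list a b _ (ℤ.suc m) m′ γ) (Rw-comm-list a b _ (ℤ.suc m) (ℤ.suc m′) γ)) ⟩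
    _ ≈⟨ ⊖-medial _ _ _ _ ⟩
    _ ≈⟨ ⊖-cong (Rw-⊖ b _ _ m′ γ) (Rw-⊖ b _ _ (ℤ.suc m′) γ) ⟨
    _ ∎
    where open ≋-Reasoning

  -- Separates the pairs of a row that stay in its block from the `b` pairs that leave it.
  Rw-++ : ∀ b X m γ κ → Rw (length γ ℕ.+ b) X m (γ ++ κ) ≋
                        Rw (length γ) (λ i γ → Rw b (λ i κ → X i (γ ++ κ)) i κ) m γ
  Rw-++ b X m []      κ = ≋-refl
  Rw-++ b X m (g ∷ γ) κ = ⊖-cong (Rw-++ b _ m γ κ) (Rw-++ b _ (ℤ.suc m) γ κ)

  Rw-truncate : ∀ n X m γ → length γ ℕ.≤ n → Rw n X m γ ≋ Rw (length γ) X m γ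
  Rw-truncate zero    X m []      p = ≋-refl
  Rw-truncate (suc n) X m []      p = ≋-refl
  Rw-truncate (suc n) X m (g ∷ γ) (ℕ.s≤s p) = ⊖-cong (Rw-truncate n _ m γ p) (Rw-truncate n _ _ γ p)

  -- The generated ℤ[t]-module as a closure: linear maps then act on it by induction, and explicit
  -- coefficients appear only in `Combination`.
  data Span (P : A → Set) : A → Set where
    gen  : ∀ {x} → P x → Span P x
    zer  : Span P 𝟘
    add  : ∀ {x y} → Span P x → Span P y → Span P (x ⊕ y)
    neg  : ∀ {x} → Span P x → Span P (⊝ x)
    tmul : ∀ {x} → Span P x → Span P (t x)
    resp : ∀ {x y} → x ≋ y → Span P x → Span P y

  Span-map : ∀ {P Q φ} → Linear φ → (∀ {x} → P x → Span Q (φ x)) → ∀ {x} → Span P x → Span Q (φ x)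
  Span-map L f (gen p)    = f p
  Span-map L f zer        = resp (≋-sym (Linear.𝟘-hom L)) zer
  Span-map L f (add a b)  = resp (≋-sym (Linear.⊕-hom L _ _)) (add (Span-map L f a) (Span-map L f b))
  Span-map L f (neg a)    = resp (≋-sym (Linear.⊝-hom L _)) (neg (Span-map L f a))
  Span-map L f (tmul a)   = resp (≋-sym (Linear.t-hom L _)) (tmul (Span-map L f a))
  Span-map L f (resp e a) = resp (Linear.cong L e) (Span-map L f a)

  Span-join : ∀ {P Q} → (∀ {x} → P x → Span Q x) → ∀ {x} → Span P x → Span Q x
  Span-join = Span-map id-linear

  Span-⊖ : ∀ {P x y} → Span P x → Span P y → Span P (x ⊖ y)
  Span-⊖ a b = add a (neg (tmul b))

  Rw-span : ∀ {P} n X m γ → (∀ {i γ′} → m ℤ.≤ i → i ℤ.≤ m ℤ.+ + n → Lw n γ γ′ → Span P (X i γ′)) →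
            Span P (Rw n X m γ)
  Rw-span zero    X m γ       f = f ℤP.≤-refl (ℤP.≤-reflexive (≡.sym (ℤP.+-identityʳ m))) stop
  Rw-span (suc n) X m []      f = f ℤP.≤-refl (ℤP.i≤i+j m (+ suc n)) nil
  Rw-span (suc n) X m (g ∷ γ) f = Span-⊖
    (Rw-span n _ m γ λ p q l → f p (ℤP.≤-trans q (ℤP.+-monoʳ-≤ m (ℤ.+≤+ (ℕP.n≤1+n n)))) (keep l))
    (Rw-span n _ (ℤ.suc m) γ λ p q l → f (ℤP.≤-trans (ℤP.i≤suc[i] m) p)
       (ℤP.≤-trans q (ℤP.≤-reflexive (suc-+ m n))) (down l))

  module Ops (B : ℤ → A → A) (B-linear : ∀ m → Linear (B m)) where

    infix 5 _∸̂_
    _∸̂_ : A → A → A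
    x ∸̂ y = x ⊕ ⊝ y

    telescope : ∀ x y z → (x ∸̂ y) ⊕ (y ∸̂ z) ≋ x ∸̂ z
    telescope x y z = begin
      (x ⊕ ⊝ y) ⊕ (y ⊕ ⊝ z)   ≈⟨ ⊕-assoc _ _ _ ⟩
      x ⊕ (⊝ y ⊕ (y ⊕ ⊝ z))   ≈⟨ ⊕-congˡ (⊕-assoc _ _ _) ⟨
      x ⊕ ((⊝ y ⊕ y) ⊕ ⊝ z)   ≈⟨ ⊕-congˡ (⊕-congʳ (⊕-inverseˡ y)) ⟩
      x ⊕ (𝟘 ⊕ ⊝ z)           ≈⟨ ⊕-congˡ (⊕-identityˡ _) ⟩
      x ⊕ ⊝ z ∎
      where open ≋-Reasoning

    recover : ∀ x y → (x ∸̂ y) ⊕ y ≋ x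
    recover x y = ≋-trans (⊕-assoc _ _ _) (≋-trans (⊕-congˡ (⊕-inverseˡ y)) (⊕-identityʳ x))

    Span-cancel : ∀ {P x y} → Span P (x ∸̂ y) → Span P y → Span P x
    Span-cancel p q = resp (recover _ _) (add p q)

    -- Every factor contributes its 1 or a raise of `m`; the only term in which `m` stays is
    -- `X m γ`.
    Rw-diff : ∀ {P} n X m γ →
      (∀ {i γ′} → m ℤ.< i → i ℤ.≤ m ℤ.+ + n → Lw n γ γ′ → Span P (X i γ′)) →
      Span P (Rw n X m γ ∸̂ X m γ)
    Rw-diff zero    X m γ       f = resp (≋-sym (⊕-inverseʳ _)) zer
    Rw-diff (suc n) X m []      f = resp (≋-sym (⊕-inverseʳ _)) zer
    Rw-diff (suc n) X m (g ∷ γ) f = resp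
      (begin
        (a ∸̂ c) ⊕ ⊝ t b      ≈⟨ ⊕-assoc _ _ _ ⟩
        a ⊕ (⊝ c ⊕ ⊝ t b)    ≈⟨ ⊕-congˡ (⊕-comm _ _) ⟩
        a ⊕ (⊝ t b ⊕ ⊝ c)    ≈⟨ ⊕-assoc _ _ _ ⟨
        (a ⊖ b) ∸̂ c ∎)
      (Span-⊖ (Rw-diff n _ m γ λ p q l → f p (ℤP.≤-trans q (ℤP.+-monoʳ-≤ m (ℤ.+≤+ (ℕP.n≤1+n n)))) (keep l))
              (Rw-span n _ (ℤ.suc m) γ λ p q l →
                f (ℤP.suc[i]≤j⇒i<j p) (ℤP.≤-trans q (ℤP.≤-reflexive (suc-+ m n))) (down l)))
      where
      open ≋-Reasoning
      a = Rw n (λ i γ → X i (g ∷ γ)) m γ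
      b = Rw n (λ i γ → X i (ℤ.pred g ∷ γ)) (ℤ.suc m) γ
      c = X m (g ∷ γ)

    -- Catalan functions as products over the non-roots

    -- The product of the 1 - t R over the non-roots, applied to B̃_γ f. The counts are kept apart
    -- from γ because γ gets shifted while the root ideal stays fixed.
    Fr : A → List ℕ → List ℤ → A
    Fr f []       γ       = f
    Fr f (n ∷ ns) []      = f
    Fr f (n ∷ ns) (m ∷ γ) = Rw n (λ i γ → B i (Fr f ns γ)) m γ

    Fr-linear : ∀ ns γ → Linear (λ f → Fr f ns γ)
    Fr-linear []       γ       = id-linear
    Fr-linear (n ∷ ns) []      = id-linear
    Fr-linear (n ∷ ns) (m ∷ γ) =
      Rw-of-linear n (λ i γ f → B i (Fr f ns γ)) m γ λ i γ → ∘-linear (B-linear i) (Fr-linear ns γ)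

    B-cong : ∀ m {x y} → x ≋ y → B m x ≋ B m y
    B-cong m = Linear.cong (B-linear m)

    Fr-truncate : ∀ f ns γ → Tall ns → length γ ≡ length ns → Fr f ns γ ≋ Fr f (stair (length ns)) γ
    Fr-truncate f []       []      T       e = ≋-refl
    Fr-truncate f (n ∷ ns) (m ∷ γ) (p ∷ T) e = begin
      Rw n (λ i γ → B i (Fr f ns γ)) m γ
        ≈⟨ Rw-cong-on n m γ (λ i l → B-cong i (Fr-truncate f ns _ T (≡.trans (Lw-length l) (ℕP.suc-injective e)))) ⟩
      Rw n X m γ            ≈⟨ Rw-truncate n X m γ (≡.subst (ℕ._≤ n) (≡.sym (ℕP.suc-injective e)) p) ⟩
      Rw (length γ) X m γ   ≡⟨ ≡.cong (λ l → Rw l X m γ) (ℕP.suc-injective e) ⟩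
      Rw (length ns) X m γ ∎
      where open ≋-Reasoning
            X = λ i γ → B i (Fr f (stair (length ns)) γ)

    -- The factors for pairs with one row in the block ν and the other in κ, applied to an arbitrary
    -- function `Y` of the two indices.
    Out : List ℕ → (List ℤ → List ℤ → A) → List ℤ → List ℤ → A
    Out []       Y ν       κ = Y ν κ
    Out (N ∷ Ns) Y []      κ = Y [] κ
    Out (N ∷ Ns) Y (m ∷ ν) κ = Rw N (λ i κ → Out Ns (λ γ → Y (i ∷ γ)) ν κ) m κ

    Out-⊖ : ∀ Ns Y Z ν κ → Out Ns (λ γ κ → Y γ κ ⊖ Z γ κ) ν κ ≋ Out Ns Y ν κ ⊖ Out Ns Z ν κ
    Out-⊖ []       Y Z ν       κ = ≋-refl
    Out-⊖ (N ∷ Ns) Y Z []      κ = ≋-refl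
    Out-⊖ (N ∷ Ns) Y Z (m ∷ ν) κ =
      ≋-trans (Rw-cong N m κ λ i κ → Out-⊖ Ns _ _ ν κ) (Rw-⊖ N _ _ m κ)

    Out-linear : ∀ {φ} → Linear φ → ∀ Ns Y ν κ → φ (Out Ns Y ν κ) ≋ Out Ns (λ γ κ → φ (Y γ κ)) ν κ
    Out-linear L []       Y ν       κ = ≋-refl
    Out-linear L (N ∷ Ns) Y []      κ = ≋-refl
    Out-linear L (N ∷ Ns) Y (m ∷ ν) κ =
      ≋-trans (Rw-linear L N _ m κ) (Rw-cong N m κ λ i κ → Out-linear L Ns _ ν κ)

    -- All factors commute, but the row of `m` lowers entries of ν that `Out` raises; `Rw-pred`
    -- rewrites that lowering as a shift of the argument.
    Rw-Out : ∀ a Ns (Z : ℤ → List ℤ → List ℤ → A) m ν κ →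
      Rw a (λ i ν → Out Ns (Z i) ν κ) m ν ≋ Out Ns (λ γ κ → Rw a (λ i γ → Z i γ κ) m γ) ν κ
    Rw-Out a       []       Z m ν       κ = ≋-refl
    Rw-Out zero    (N ∷ Ns) Z m ν       κ = ≋-refl
    Rw-Out (suc a) (N ∷ Ns) Z m []      κ = ≋-refl
    Rw-Out (suc a) (N ∷ Ns) Z m (x ∷ ν) κ = begin
      Rw a (λ i ν → Rw N (λ j κ → Out Ns (λ γ → Z i (j ∷ γ)) ν κ) x κ) m ν
        ⊖ Rw a (λ i ν → Rw N (λ j κ → Out Ns (λ γ → Z i (j ∷ γ)) ν κ) (ℤ.pred x) κ) (ℤ.suc m) ν
        ≈⟨ ⊖-cong (Rw-comm a N _ m ν x κ) (Rw-comm a N _ (ℤ.suc m) ν (ℤ.pred x) κ) ⟩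
      Rw N (λ j κ → Rw a (λ i ν → Out Ns (λ γ → Z i (j ∷ γ)) ν κ) m ν) x κ
        ⊖ Rw N (λ j κ → Rw a (λ i ν → Out Ns (λ γ → Z i (j ∷ γ)) ν κ) (ℤ.suc m) ν) (ℤ.pred x) κ
        ≈⟨ ⊖-cong (Rw-cong N x κ λ j κ → Rw-Out a Ns _ m ν κ)
                  (Rw-cong N (ℤ.pred x) κ λ j κ → Rw-Out a Ns _ (ℤ.suc m) ν κ) ⟩
      Rw N (λ j κ → Out Ns (λ γ κ → Rw a (λ i γ → Z i (j ∷ γ) κ) m γ) ν κ) x κ
        ⊖ Rw N (λ j κ → Out Ns (λ γ κ → Rw a (λ i γ → Z i (j ∷ γ) κ) (ℤ.suc m) γ) ν κ) (ℤ.pred x) κ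
        ≈⟨ ⊖-cong ≋-refl (Rw-pred N _ x κ) ⟩
      Rw N (λ j κ → Out Ns (λ γ κ → Rw a (λ i γ → Z i (j ∷ γ) κ) m γ) ν κ) x κ
        ⊖ Rw N (λ j κ → Out Ns (λ γ κ → Rw a (λ i γ → Z i (ℤ.pred j ∷ γ) κ) (ℤ.suc m) γ) ν κ) x κ
        ≈⟨ Rw-⊖ N _ _ x κ ⟨
      Rw N (λ j κ → Out Ns (λ γ κ → Rw a (λ i γ → Z i (j ∷ γ) κ) m γ) ν κ
                  ⊖ Out Ns (λ γ κ → Rw a (λ i γ → Z i (ℤ.pred j ∷ γ) κ) (ℤ.suc m) γ) ν κ) x κ
        ≈⟨ Rw-cong N x κ (λ j κ → Out-⊖ Ns _ _ ν κ) ⟨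
      _ ∎
      where open ≋-Reasoning

    -- Each count splits into the rest of the block and an excess. As all factors commute, those of
    -- the excess can be moved outside, which leaves B_γ applied to a Catalan function of the rows
    -- behind the block.
    Fr-Out : ∀ f ns Ns ν κ → length ν ≡ length Ns →
      Fr f (zipWith ℕ._+_ (stair (length Ns)) Ns ++ ns) (ν ++ κ) ≋
      Out Ns (λ γ κ → Fr (Fr f ns κ) (stair (length Ns)) γ) ν κ
    Fr-Out f ns []       []      κ e = ≋-refl
    Fr-Out f ns (N ∷ Ns) (m ∷ ν) κ e = begin
      Rw (r ℕ.+ N) X m (ν ++ κ)
        ≡⟨ ≡.cong (λ l → Rw (l ℕ.+ N) X m (ν ++ κ)) e′ ⟨
      Rw (length ν ℕ.+ N) X m (ν ++ κ)
        ≈⟨ Rw-++ N X m ν κ ⟩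
      Rw (length ν) (λ i ν → Rw N (λ i κ → X i (ν ++ κ)) i κ) m ν
        ≡⟨ ≡.cong (λ l → Rw l (λ i ν → Rw N (λ i κ → X i (ν ++ κ)) i κ) m ν) e′ ⟩
      Rw r (λ i ν → Rw N (λ i κ → X i (ν ++ κ)) i κ) m ν
        ≈⟨ Rw-cong-on r m ν (λ i l → Rw-cong N i κ λ i κ →
             ≋-trans (B-cong i (Fr-Out f ns Ns _ κ (≡.trans (Lw-length l) e′))) (Out-linear (B-linear i) Ns Y _ κ)) ⟩
      Rw r (λ i ν → Rw N (λ i κ → Out Ns (λ γ κ → B i (Y γ κ)) ν κ) i κ) m ν
        ≈⟨ Rw-comm-row r N _ m ν κ ⟩
      Rw N (λ i κ → Rw r (λ i ν → Out Ns (λ γ κ → B i (Y γ κ)) ν κ) i ν) m κ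
        ≈⟨ Rw-cong N m κ (λ i κ → Rw-Out r Ns _ i ν κ) ⟩
      _ ∎
      where
      open ≋-Reasoning
      r = length Ns
      e′ = ℕP.suc-injective e
      X = λ i α → B i (Fr f (zipWith ℕ._+_ (stair r) Ns ++ ns) α)
      Y = λ γ κ → Fr (Fr f ns κ) (stair r) γ

    Out-span : ∀ {P} Ns Y ν κ → (∀ {γ κ′} → OutTerm Ns ν κ γ κ′ → Span P (Y γ κ′)) → Span P (Out Ns Y ν κ)
    Out-span []       Y ν       κ f = f []
    Out-span (N ∷ Ns) Y []      κ f = f nil
    Out-span (N ∷ Ns) Y (m ∷ ν) κ f =
      Rw-span N _ m κ λ p q l → Out-span Ns _ ν _ λ o → f (raise p q l o)

    -- Each factor contributes 1 or raises an entry of the block, so all terms but the leading one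
    -- have a larger block sum.
    Out-diff : ∀ {P} Ns Y ν κ → (∀ {γ κ′} → OutTerm Ns ν κ γ κ′ → sumℤ ν ℤ.< sumℤ γ → Span P (Y γ κ′)) →
               Span P (Out Ns Y ν κ ∸̂ Y ν κ)
    Out-diff []       Y ν       κ f = resp (≋-sym (⊕-inverseʳ _)) zer
    Out-diff (N ∷ Ns) Y []      κ f = resp (≋-sym (⊕-inverseʳ _)) zer
    Out-diff (N ∷ Ns) Y (m ∷ ν) κ f = resp (telescope _ _ _) (add
      (Rw-diff N (λ i κ → Out Ns (λ γ → Y (i ∷ γ)) ν κ) m κ λ p q l → Out-span Ns _ ν _ λ o →
        f (raise (ℤP.<⇒≤ p) q l o) (ℤP.+-mono-<-≤ p (OutTerm-sum o)))
      (Out-diff Ns _ ν κ λ o p →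
        f (raise ℤP.≤-refl (ℤP.i≤i+j m (+ N)) (Lw-refl N κ) o) (ℤP.+-monoʳ-< m p)))

    -- Products over lists of pairs

    pairOp : ℕ × ℕ → (List ℤ → A) → List ℤ → A
    pairOp (i , j) X γ = X γ ⊖ X (shiftZ i j (+ 1) γ)

    pairOps : List (ℕ × ℕ) → (List ℤ → A) → List ℤ → A
    pairOps []       X = X
    pairOps (p ∷ ps) X = pairOps ps (pairOp p X)

    pairOps-++ : ∀ ps qs X γ → pairOps (ps ++ qs) X γ ≡ pairOps qs (pairOps ps X) γ
    pairOps-++ []       qs X γ = refl
    pairOps-++ (p ∷ ps) qs X γ = pairOps-++ ps qs (pairOp p X) γ

    pairOps-cong-on : ∀ ps {X Y} γ → (∀ γ′ → length γ′ ≡ length γ → X γ′ ≋ Y γ′) → pairOps ps X γ ≋ pairOps ps Y γ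
    pairOps-cong-on []             γ e = e γ refl
    pairOps-cong-on ((i , j) ∷ ps) γ e = pairOps-cong-on ps γ λ γ′ l →
      ⊖-cong (e γ′ l) (e _ (≡.trans (shiftZ-length i j (+ 1) γ′) l))

    pairOps-linear : ∀ {φ} → Linear φ → ∀ ps X γ → φ (pairOps ps X γ) ≋ pairOps ps (φ ∘ X) γ
    pairOps-linear L []       X γ = ≋-refl
    pairOps-linear L (p ∷ ps) X γ = ≋-trans (pairOps-linear L ps (pairOp p X) γ)
      (pairOps-cong-on ps γ λ γ′ _ → Linear-⊖ L _ _)

    Rw-mapIdx : ∀ d → (∀ p x → d p (ℤ.pred x) ≡ ℤ.pred (d p x)) → ∀ n X m p γ →
      Rw n X m (mapIdx d p γ) ≋ Rw n (λ i γ → X i (mapIdx d p γ)) m γ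
    Rw-mapIdx d c zero    X m p γ       = ≋-refl
    Rw-mapIdx d c (suc n) X m p []      = ≋-refl
    Rw-mapIdx d c (suc n) X m p (g ∷ γ) = ⊖-cong (Rw-mapIdx d c n _ m (suc p) γ)
      (≋-trans (Rw-mapIdx d c n _ (ℤ.suc m) (suc p) γ)
        (Rw-cong n (ℤ.suc m) γ λ i γ → ≋-reflexive (≡.cong (λ z → X i (z ∷ mapIdx d (suc p) γ)) (≡.sym (c p g)))))

    Rw-shiftZ : ∀ i j a n X m γ → Rw n X m (shiftZ i j a γ) ≋ Rw n (λ l γ → X l (shiftZ i j a γ)) m γ
    Rw-shiftZ i j a n X m γ = begin
      Rw n X m (shiftZ i j a γ)                        ≡⟨ ≡.cong (Rw n X m) (shiftZ-mapIdx i j a γ) ⟩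
      Rw n X m (mapIdx (shiftEntry i j a) 1 γ)         ≈⟨ Rw-mapIdx (shiftEntry i j a) commutes n X m 1 γ ⟩
      Rw n (λ l γ → X l (mapIdx (shiftEntry i j a) 1 γ)) m γ
        ≈⟨ Rw-cong n m γ (λ l γ → ≋-reflexive (≡.cong (X l) (≡.sym (shiftZ-mapIdx i j a γ)))) ⟩
      Rw n (λ l γ → X l (shiftZ i j a γ)) m γ ∎
      where
      open ≋-Reasoning
      commutes : ∀ p x → shiftEntry i j a p (ℤ.pred x) ≡ ℤ.pred (shiftEntry i j a p x)
      commutes p x = ≡.trans (≡.cong (shiftEntry i j a p) (ℤP.+-comm -[1+ 0 ] x))
        (≡.trans (shiftEntry-+ i j a p x -[1+ 0 ]) (ℤP.+-comm (shiftEntry i j a p x) -[1+ 0 ]))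

    Rw-pairOps : ∀ ps n X m γ → Rw n (λ i → pairOps ps (X i)) m γ ≋ pairOps ps (Rw n X m) γ
    Rw-pairOps []             n X m γ = ≋-refl
    Rw-pairOps ((i , j) ∷ ps) n X m γ = ≋-trans (Rw-pairOps ps n _ m γ) (pairOps-cong-on ps γ λ γ′ _ →
      ≋-trans (Rw-⊖ n _ _ m γ′) (⊖-cong ≋-refl (≋-sym (Rw-shiftZ i j (+ 1) n X m γ′))))

    uncons : Family → List ℤ → A
    uncons X []      = 𝟘
    uncons X (m ∷ γ) = X m γ

    pairOps-bump : ∀ ps → All PositivePair ps → ∀ Y m γ → pairOps (bump ps) (uncons Y) (m ∷ γ) ≋ pairOps ps (Y m) γ
    pairOps-bump []             []            Y m γ = ≋-refl
    pairOps-bump ((i , j) ∷ ps) ((p , q) ∷ P) Y m γ = ≋-trans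
      (pairOps-cong-on (bump ps) {Y = uncons (λ m → pairOp (i , j) (Y m))} (m ∷ γ) λ { (m′ ∷ γ′) _ →
        ⊖-cong ≋-refl (≋-reflexive (≡.cong (uncons Y) (shiftZ-suc i j (+ 1) m′ γ′ p q))) })
      (pairOps-bump ps P (λ m → pairOp (i , j) (Y m)) m γ)

    Rw-next : ∀ n X m γ → n ℕ.< length γ → Rw n X m γ ⊖ Rw n X (ℤ.suc m) (lower n γ) ≋ Rw (suc n) X m γ
    Rw-next zero    X m (g ∷ γ) p       = ≋-refl
    Rw-next (suc n) X m (g ∷ γ) (s≤s p) = ≋-trans (⊖-medial _ _ _ _)
      (⊖-cong (Rw-next n _ m γ p) (Rw-next n _ (ℤ.suc m) γ p))

    pairOps-row : ∀ r n X m γ → n ℕ.+ r ≡ length γ → pairOps (rowFrom n r) (uncons (Rw n X)) (m ∷ γ) ≋ Rw (n ℕ.+ r) X m γ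
    pairOps-row zero    n X m γ e = ≋-reflexive (≡.cong (λ l → Rw l X m γ) (≡.sym (ℕP.+-identityʳ n)))
    pairOps-row (suc r) n X m γ e = ≋-trans
      (pairOps-cong-on (rowFrom (suc n) r) {Y = uncons (Rw (suc n) X)} (m ∷ γ) λ { (m′ ∷ γ′) l →
        ≋-trans (⊖-cong ≋-refl (≋-reflexive (≡.cong (uncons (Rw n X)) (shiftZ-first n m′ γ′))))
          (Rw-next n X m′ γ′ (≡.subst (n ℕ.<_) (≡.trans e (≡.sym (ℕP.suc-injective l)))
            (ℕP.≤-trans (s≤s (ℕP.m≤m+n n r)) (ℕP.≤-reflexive (≡.sym (ℕP.+-suc n r)))))) })
      (≋-trans (pairOps-row r (suc n) X m γ (≡.trans (≡.sym (ℕP.+-suc n r)) e))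
        (≋-reflexive (≡.cong (λ l → Rw l X m γ) (≡.sym (ℕP.+-suc n r)))))

    -- Roots and non-roots together are all pairs, so the factors over the roots extend every row to
    -- the full triangle. Together with `coeff-pairOps-inverse` this equates the non-root form with
    -- the Catalan series.
    pairOps-roots : ∀ f ns γ → length γ ≡ length ns → pairOps (rootPairs ns) (Fr f ns) γ ≋ Fr f (stair (length ns)) γ
    pairOps-roots f []       []      e = ≋-refl
    pairOps-roots f (n ∷ ns) (m ∷ γ) e = begin
      pairOps (rowFrom n (length ns ℕ.∸ n) ++ bump (rootPairs ns)) (Fr f (n ∷ ns)) (m ∷ γ)
        ≡⟨ pairOps-++ (rowFrom n (length ns ℕ.∸ n)) _ _ (m ∷ γ) ⟩
      pairOps (bump (rootPairs ns)) (pairOps (rowFrom n (length ns ℕ.∸ n)) (Fr f (n ∷ ns))) (m ∷ γ)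
        ≈⟨ pairOps-cong-on (bump (rootPairs ns)) (m ∷ γ) (λ { (m′ ∷ γ′) l → first-row m′ γ′ (≡.trans (ℕP.suc-injective l) e′) }) ⟩
      pairOps (bump (rootPairs ns)) (uncons (Rw L X)) (m ∷ γ)
        ≈⟨ pairOps-bump (rootPairs ns) (rootPairs-positive ns) (Rw L X) m γ ⟩
      pairOps (rootPairs ns) (Rw L X m) γ
        ≈⟨ Rw-pairOps (rootPairs ns) L X m γ ⟨
      Rw L (λ i → pairOps (rootPairs ns) (X i)) m γ
        ≈⟨ Rw-cong-on L m γ (λ i {γ′} l → ≋-trans (≋-sym (pairOps-linear (B-linear i) (rootPairs ns) (Fr f ns) γ′))
             (B-cong i (pairOps-roots f ns γ′ (≡.trans (Lw-length l) e′)))) ⟩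
      Rw L (λ i γ → B i (Fr f (stair L) γ)) m γ ∎
      where
      open ≋-Reasoning
      L = length ns
      e′ = ℕP.suc-injective e
      X : Family
      X i γ = B i (Fr f ns γ)
      first-row : ∀ m γ → length γ ≡ L → pairOps (rowFrom n (L ℕ.∸ n)) (Fr f (n ∷ ns)) (m ∷ γ) ≋ Rw L X m γ
      first-row m γ l with ℕP.≤-total n L
      ... | inj₁ n≤L = ≋-trans (pairOps-cong-on (rowFrom n (L ℕ.∸ n)) {Y = uncons (Rw n X)} (m ∷ γ) λ { (m′ ∷ γ′) _ → ≋-refl })
        (≋-trans (pairOps-row (L ℕ.∸ n) n X m γ (≡.trans (ℕP.m+[n∸m]≡n n≤L) (≡.sym l)))
          (≋-reflexive (≡.cong (λ l → Rw l X m γ) (ℕP.m+[n∸m]≡n n≤L))))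
      -- There is no root in this row, and its factors towards missing rows act as 1.
      ... | inj₂ L≤n = ≋-trans (≋-reflexive (≡.cong (λ r → pairOps (rowFrom n r) (Fr f (n ∷ ns)) (m ∷ γ)) (ℕP.m≤n⇒m∸n≡0 L≤n)))
        (≋-trans (Rw-truncate n X m γ (ℕP.≤-trans (ℕP.≤-reflexive l) L≤n)) (≋-reflexive (≡.cong (λ r → Rw r X m γ) l)))

-- The action on the vacuum 1

module Straightening (𝔸 : AbelianGroup 0ℓ 0ℓ)
  (t : AbelianGroup.Carrier 𝔸 → AbelianGroup.Carrier 𝔸)
  (t-cong : ∀ {x y} → AbelianGroup._≈_ 𝔸 x y → AbelianGroup._≈_ 𝔸 (t x) (t y))
  (t-⊕ : ∀ x y → AbelianGroup._≈_ 𝔸 (t (AbelianGroup._∙_ 𝔸 x y)) (AbelianGroup._∙_ 𝔸 (t x) (t y)))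
  (B : ℤ → AbelianGroup.Carrier 𝔸 → AbelianGroup.Carrier 𝔸)
  (B-linear : ∀ m → Rows.Linear 𝔸 t t-cong t-⊕ (B m))
  where

  open Rows 𝔸 t t-cong t-⊕
  open Ops B B-linear

  module Vacuum (one : A) (B-zero : B (+ 0) one ≋ one) (B-negative : ∀ n → B -[1+ n ] one ≋ 𝟘) where

    -- No row raises the last entry, so in every term the innermost operator has a negative index.
    Fr-LastNegative : ∀ ns γ → length γ ≡ length ns → LastNegative γ → Fr one ns γ ≋ 𝟘
    Fr-LastNegative (n ∷ [])     (-[1+ x ] ∷ [])    e (last p)    = ≋-trans (Rw-[] n) (B-negative x)
      where
      Rw-[] : ∀ n {X m} → Rw n X m [] ≋ X m []
      Rw-[] zero    = ≋-refl
      Rw-[] (suc n) = ≋-refl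
    Fr-LastNegative (n ∷ [])     (+ x ∷ [])         e (last (ℤ.+<+ ()))
    Fr-LastNegative (n ∷ ns)     (x ∷ γ@(_ ∷ _))    e (there L)   = ≋-trans
      (Rw-cong-on n x γ λ i l → ≋-trans
        (B-cong i (Fr-LastNegative ns _ (≡.trans (Lw-length l) (ℕP.suc-injective e)) (Lw-LastNegative L l)))
        (Linear.𝟘-hom (B-linear i)))
      (Rw-𝟘 n x γ)

    ⊖-identityʳ : ∀ x → x ⊖ 𝟘 ≋ x
    ⊖-identityʳ x = ≋-trans (⊕-congˡ (≋-trans (⊝-cong t-𝟘) ⊝𝟘)) (⊕-identityʳ x)

    -- A factor that involves the new row lowers its 0 to -1, and the term vanishes; what is left
    -- has B_0 1 = 1 in the innermost place.
    Fr-snoc-zero : ∀ r γ → length γ ≡ r → Fr one (stair (suc r)) (γ ++ + 0 ∷ []) ≋ Fr one (stair r) γ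
    Fr-snoc-zero zero    []      refl = B-zero
    Fr-snoc-zero (suc r) (m ∷ γ) refl = begin
      Rw (suc r) X m (γ ++ + 0 ∷ [])
        ≡⟨ ≡.cong (λ l → Rw l X m (γ ++ + 0 ∷ [])) (ℕP.+-comm 1 r) ⟩
      Rw (r ℕ.+ 1) X m (γ ++ + 0 ∷ [])
        ≈⟨ Rw-++ 1 X m γ _ ⟩
      Rw r (λ i γ → X i (γ ++ + 0 ∷ []) ⊖ X (ℤ.suc i) (γ ++ -[1+ 0 ] ∷ [])) m γ
        ≈⟨ Rw-cong-on r m γ (λ i {γ′} l → ≋-trans
             (⊖-cong (B-cong i (Fr-snoc-zero r γ′ (Lw-length l)))
               (≋-trans (B-cong (ℤ.suc i) (Fr-LastNegative (stair (suc r)) (γ′ ++ -[1+ 0 ] ∷ []) (len γ′ (Lw-length l)) (neg-last γ′)))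
                        (Linear.𝟘-hom (B-linear (ℤ.suc i)))))
             (⊖-identityʳ _)) ⟩
      Rw r (λ i γ → B i (Fr one (stair r) γ)) m γ ∎
      where
      open ≋-Reasoning
      X = λ i α → B i (Fr one (stair (suc r)) α)
      len : ∀ γ′ → length γ′ ≡ r → length (γ′ ++ -[1+ 0 ] ∷ []) ≡ length (stair (suc r))
      len γ′ e = ≡.trans (length-++ γ′) (≡.trans (ℕP.+-comm _ 1) (≡.cong suc (≡.trans e (≡.sym (length-stair r)))))
      neg-last : ∀ γ′ → LastNegative (γ′ ++ -[1+ 0 ] ∷ [])
      neg-last []          = last ℤ.-<+
      neg-last (x ∷ [])    = there (last ℤ.-<+)
      neg-last (x ∷ y ∷ γ) = there (neg-last (y ∷ γ))

    Fr-zeros : ∀ r z γ → length γ ≡ r → Fr one (stair (z ℕ.+ r)) (γ ++ replicate z (+ 0)) ≋ Fr one (stair r) γ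
    Fr-zeros r zero    γ e = ≋-reflexive (≡.cong (Fr one (stair r)) (++-identityʳ γ))
    Fr-zeros r (suc z) γ e = begin
      Fr one (stair (suc z ℕ.+ r)) (γ ++ + 0 ∷ replicate z (+ 0))
        ≡⟨ ≡.cong₂ (λ l γ → Fr one (stair l) γ) (≡.sym (ℕP.+-suc z r)) (≡.sym (++-assoc γ (+ 0 ∷ []) _)) ⟩
      Fr one (stair (z ℕ.+ suc r)) ((γ ++ + 0 ∷ []) ++ replicate z (+ 0))
        ≈⟨ Fr-zeros (suc r) z (γ ++ + 0 ∷ []) (≡.trans (length-++ γ) (≡.trans (ℕP.+-comm _ 1) (≡.cong suc e))) ⟩
      Fr one (stair (suc r)) (γ ++ + 0 ∷ [])
        ≈⟨ Fr-snoc-zero r γ e ⟩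
      Fr one (stair r) γ ∎
      where open ≋-Reasoning

  -- Antisymmetry of B_γ in the weights

  module Alt
    (B-quadratic : ∀ a b x →
      (B a (B b x) ⊖ B (ℤ.suc a) (B (ℤ.pred b) x)) ⊕ (B (ℤ.pred b) (B (ℤ.suc a) x) ⊖ B b (B a x)) ≋ 𝟘)
    (torsion-free : ∀ x → x ⊕ x ≋ 𝟘 → x ≋ 𝟘)
    where

    -- Apart from the pair they form with each other, the two rows have the same `n` non-roots, so
    -- the factors towards `q` are compatible with the exchange and can be pulled out; what remains
    -- is the quadratic relation for each pair of shifted indices.
    Fr-swap-top : ∀ f n ns a b q →
      Fr f (suc n ∷ n ∷ ns) (a ∷ b ∷ q) ⊕ Fr f (suc n ∷ n ∷ ns) (ℤ.pred b ∷ ℤ.suc a ∷ q) ≋ 𝟘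
    Fr-swap-top f n ns a b q = begin
      Fr f (suc n ∷ n ∷ ns) (a ∷ b ∷ q) ⊕ Fr f (suc n ∷ n ∷ ns) (ℤ.pred b ∷ ℤ.suc a ∷ q)
        ≈⟨ ⊕-cong (top a b) (top (ℤ.pred b) (ℤ.suc a)) ⟩
      (D a b ⊖ D (ℤ.suc a) (ℤ.pred b)) ⊕ (D (ℤ.pred b) (ℤ.suc a) ⊖ D (ℤ.suc (ℤ.pred b)) (ℤ.pred (ℤ.suc a)))
        ≈⟨ ⊕-cong (⊖-cong ≋-refl D₂) (⊖-cong D₃ D₄) ⟩
      (W Z ⊖ W Z₂) ⊕ (W Z₃ ⊖ W Z₄)
        ≈⟨ ⊕-cong (W-⊖ Z Z₂) (W-⊖ Z₃ Z₄) ⟨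
      W (λ i j q → Z i j q ⊖ Z₂ i j q) ⊕ W (λ i j q → Z₃ i j q ⊖ Z₄ i j q)
        ≈⟨ Rw-⊕ n _ _ a q ⟨
      _ ≈⟨ Rw-cong n a q (λ i q → ≋-sym (Rw-⊕ n _ _ b q)) ⟩
      W (λ i j q → (Z i j q ⊖ Z₂ i j q) ⊕ (Z₃ i j q ⊖ Z₄ i j q))
        ≈⟨ Rw-cong n a q (λ i q → Rw-cong n b q λ j q → B-quadratic i j (Fr f ns q)) ⟩
      W (λ i j q → 𝟘)
        ≈⟨ Rw-cong n a q (λ i q → Rw-𝟘 n b q) ⟩
      Rw n (λ _ _ → 𝟘) a q
        ≈⟨ Rw-𝟘 n a q ⟩
      𝟘 ∎
      where
      open ≋-Reasoning
      Z Z₂ Z₃ Z₄ : ℤ → ℤ → List ℤ → A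
      Z i j q = B i (B j (Fr f ns q))
      Z₂ i j q = Z (ℤ.suc i) (ℤ.pred j) q
      Z₃ i j q = Z (ℤ.pred j) (ℤ.suc i) q
      Z₄ i j q = Z j i q
      W : (ℤ → ℤ → List ℤ → A) → A
      W Z = Rw n (λ i q → Rw n (λ j q → Z i j q) b q) a q
      D : ℤ → ℤ → A
      D a b = Rw n (λ i q → Rw n (λ j q → Z i j q) b q) a q
      top : ∀ a b → Fr f (suc n ∷ n ∷ ns) (a ∷ b ∷ q) ≋ D a b ⊖ D (ℤ.suc a) (ℤ.pred b)
      top a b = ⊖-cong (Rw-cong n a q λ i q → Rw-linear (B-linear i) n _ b q)
                       (Rw-cong n (ℤ.suc a) q λ i q → Rw-linear (B-linear i) n _ (ℤ.pred b) q)
      D₂ : D (ℤ.suc a) (ℤ.pred b) ≋ W Z₂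
      D₂ = ≋-trans (Rw-suc n _ a q) (Rw-cong n a q λ i q → Rw-pred n _ b q)
      D₃ : D (ℤ.pred b) (ℤ.suc a) ≋ W Z₃
      D₃ = ≋-trans (Rw-comm-list n n Z (ℤ.pred b) (ℤ.suc a) q)
           (≋-trans (Rw-suc n _ a q) (Rw-cong n a q λ i q → Rw-pred n _ b q))
      D₄ : D (ℤ.suc (ℤ.pred b)) (ℤ.pred (ℤ.suc a)) ≋ W Z₄
      D₄ = ≋-trans (≋-reflexive (≡.cong₂ D (ℤP.suc-pred b) (ℤP.pred-suc a))) (Rw-comm-list n n Z b a q)
      W-⊖ : ∀ X Y → W (λ i j q → X i j q ⊖ Y i j q) ≋ W X ⊖ W Y
      W-⊖ X Y = ≋-trans (Rw-cong n a q λ i q → Rw-⊖ n _ _ b q) (Rw-⊖ n _ _ a q)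

    Alternating : (List ℤ → A) → ℕ → Set
    Alternating X r = ∀ p a b q → length (p ++ a ∷ b ∷ q) ≡ r →
      X (p ++ a ∷ b ∷ q) ⊕ X (p ++ ℤ.pred b ∷ ℤ.suc a ∷ q) ≋ 𝟘

    -- An outer row that sees both exchanged rows treats them alike; `r ≤ n` says that it sees them.
    Rw-swap : ∀ n X r m p a b q → (∀ i → Alternating (X i) r) → length (p ++ a ∷ b ∷ q) ≡ r → r ℕ.≤ n →
      Rw n X m (p ++ a ∷ b ∷ q) ⊕ Rw n X m (p ++ ℤ.pred b ∷ ℤ.suc a ∷ q) ≋ 𝟘
    Rw-swap (suc (suc n)) X r m [] a b q alt refl _ = begin
      ((R a b m ⊖ R a b′ m₁) ⊖ (R (ℤ.pred a) b m₁ ⊖ R (ℤ.pred a) b′ m₂))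
        ⊕ ((R b′ a′ m ⊖ R b′ (ℤ.pred a′) m₁) ⊖ (R (ℤ.pred b′) a′ m₁ ⊖ R (ℤ.pred b′) (ℤ.pred a′) m₂))
        -- In the exchanged list `a` stands second, so the middle terms there trade places before
        -- the two expansions are added term by term.
        ≈⟨ ⊕-congˡ (⊖-medial _ _ _ _) ⟩
      ((R a b m ⊖ R a b′ m₁) ⊖ (R (ℤ.pred a) b m₁ ⊖ R (ℤ.pred a) b′ m₂))
        ⊕ ((R b′ a′ m ⊖ R (ℤ.pred b′) a′ m₁) ⊖ (R b′ (ℤ.pred a′) m₁ ⊖ R (ℤ.pred b′) (ℤ.pred a′) m₂))
        ≈⟨ ⊖-⊕ _ _ _ _ ⟨
      _ ≈⟨ ⊖-cong (⊖-⊕ _ _ _ _) (⊖-⊕ _ _ _ _) ⟨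
      _ ≈⟨ ⊖-cong (⊖-cong (R-swap a b m) (R-swap a b′ m₁)) (⊖-cong (R-swap′ b) (R-swap′ b′)) ⟩
      (𝟘 ⊖ 𝟘) ⊖ (𝟘 ⊖ 𝟘) ≈⟨ ⊖-cong ⊖-𝟘 ⊖-𝟘 ⟩
      𝟘 ⊖ 𝟘             ≈⟨ ⊖-𝟘 ⟩
      𝟘 ∎
      where
      open ≋-Reasoning
      a′ = ℤ.suc a
      b′ = ℤ.pred b
      m₁ = ℤ.suc m
      m₂ = ℤ.suc m₁
      R : ℤ → ℤ → ℤ → A
      R x y m = Rw n (λ i q → X i (x ∷ y ∷ q)) m q
      R-swap : ∀ a b m → R a b m ⊕ R (ℤ.pred b) (ℤ.suc a) m ≋ 𝟘
      R-swap a b m = ≋-trans (≋-sym (Rw-⊕ n _ _ m q)) (≋-trans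
        (Rw-cong-on n m q λ i l → alt i [] a b _ (≡.cong (λ l → suc (suc l)) (Lw-length l)))
        (Rw-𝟘 n m q))
      R-swap′ : ∀ b {m} → R (ℤ.pred a) b m ⊕ R (ℤ.pred b) (ℤ.pred a′) m ≋ 𝟘
      R-swap′ b {m} = ≋-trans
        (⊕-congˡ (≋-reflexive (≡.cong (λ x → R (ℤ.pred b) x m) (≡.trans (ℤP.pred-suc a) (≡.sym (ℤP.suc-pred a))))))
        (R-swap (ℤ.pred a) b m)
    Rw-swap (suc zero) X r m [] a b q alt refl (ℕ.s≤s ())
    Rw-swap zero X r m (g ∷ p) a b q alt refl ()
    Rw-swap (suc n) X r m (g ∷ p) a b q alt refl (ℕ.s≤s le) = ≋-trans (≋-sym (⊖-⊕ _ _ _ _)) (≋-trans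
      (⊖-cong (Rw-swap n _ _ m p a b q (λ i p a b q e → alt i (g ∷ p) a b q (≡.cong suc e)) refl le)
              (Rw-swap n _ _ (ℤ.suc m) p a b q (λ i p a b q e → alt i (ℤ.pred g ∷ p) a b q (≡.cong suc e)) refl le))
      ⊖-𝟘)

    Fr-swap : ∀ f r → Alternating (Fr f (stair r)) r
    Fr-swap f (suc r) []      a b q refl = Fr-swap-top f (length q) (stair (length q)) a b q
    Fr-swap f (suc r) (m ∷ p) a b q e    = Rw-swap r _ r m p a b q
      (λ i p a b q e → ≋-trans (≋-sym (Linear.⊕-hom (B-linear i) _ _))
        (≋-trans (B-cong i (Fr-swap f r p a b q e)) (Linear.𝟘-hom (B-linear i))))
      (ℕP.suc-injective e) ℕP.≤-refl

    Antisymmetric : (List ℤ → A) → ℕ → Set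
    Antisymmetric V r = ∀ p a b q → length (p ++ a ∷ b ∷ q) ≡ r → V (p ++ a ∷ b ∷ q) ⊕ V (p ++ b ∷ a ∷ q) ≋ 𝟘

    Fr-unweights-antisymmetric : ∀ f r → Antisymmetric (λ w → Fr f (stair r) (unweights w)) r
    Fr-unweights-antisymmetric f r p a b q e = ≋-trans
      (⊕-cong (≋-reflexive (≡.cong (Fr f (stair r)) (unweights-++ p (a ∷ b ∷ q))))
              (≋-reflexive (≡.cong (Fr f (stair r)) (≡.trans (unweights-++ p (b ∷ a ∷ q))
                (≡.cong₂ (λ x y → prefix (length (b ∷ a ∷ q)) p ++ x ∷ y ∷ unweights q)
                  (≡.sym (pred-minus b (length q))) (≡.sym (suc-minus a (length q))))))))
      (Fr-swap f r (prefix (suc (suc (length q))) p) _ _ (unweights q) (≡.trans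
        (≡.cong length (≡.sym (unweights-++ p (a ∷ b ∷ q)))) (≡.trans (length-unweights (p ++ a ∷ b ∷ q)) e)))

    module _ {P : A → Set} where

      insert-span : ∀ {r} (V : List ℤ → A) → Antisymmetric V r →
        ∀ {u} a s → length (a ∷ s) ≡ r → a ℤ.< u → StrictBelow u s →
        (∀ w → StrictBelow u w → w ↭ a ∷ s → Span P (V w)) → Span P (V (a ∷ s))
      insert-span V alt a []      e a<u []        k = k (a ∷ []) (a<u ∷ []) ↭-refl
      insert-span V alt a (b ∷ s) e a<u (b<u ∷ S) k with ℤP.<-cmp a b
      ... | tri> _ _ b<a  = k (a ∷ b ∷ s) (a<u ∷ b<a ∷ S) ↭-refl
      -- Equal weights make the value its own negative; in the absence of 2-torsion it is zero.
      ... | tri≈ _ refl _ = resp (≋-sym (torsion-free _ (alt [] a a s e))) zer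
      insert-span {suc r} V alt a (b ∷ s) e a<u (b<u ∷ S) k
          | tri< a<b _ _  = resp (≋-sym (⊕-inverse-unique _ _ (≋-trans (⊕-comm _ _) (alt [] a b s e))))
        (neg (insert-span {r} (λ w → V (b ∷ w)) (λ p x y q e → alt (b ∷ p) x y q (≡.cong suc e))
          a s (ℕP.suc-injective e) a<b S
          λ w S′ π → k (b ∷ w) (b<u ∷ S′) (↭-trans (prep b π) (swap b a ↭-refl))))

      sort-span : ∀ {r} (V : List ℤ → A) → Antisymmetric V r →
        ∀ {u} w → length w ≡ r → All (ℤ._< u) w → (∀ s → StrictBelow u s → s ↭ w → Span P (V s)) → Span P (V w)
      sort-span V alt []      e []       k = k [] [] ↭-refl
      sort-span {suc r} V alt (x ∷ w) e (lt ∷ A) k =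
        sort-span {r} (λ w → V (x ∷ w)) (λ p x y q e → alt (_ ∷ p) x y q (≡.cong suc e)) w (ℕP.suc-injective e) A
          λ s S π → insert-span V alt x s (≡.cong suc (≡.trans (↭-length π) (ℕP.suc-injective e))) lt S
            λ w′ S′ π′ → k w′ S′ (↭-trans π′ (prep x π))

      -- Up to sign the value at γ is that at the sorted weights, or zero if two weights agree, so
      -- only strictly decreasing weights need to be treated.
      block-span : ∀ f γ {u} → All (ℤ._< u) (weights γ) →
        (∀ γ′ → length γ′ ≡ length γ → StrictBelow u (weights γ′) → weights γ′ ↭ weights γ →
                Span P (Fr f (stair (length γ)) γ′)) →
        Span P (Fr f (stair (length γ)) γ)
      block-span f γ {u} A k = ≡.subst (λ z → Span P (Fr f (stair r) z)) (unweights∘weights γ)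
        (sort-span V (Fr-unweights-antisymmetric f r) (weights γ) (length-weights γ) A
          λ s S π → k (unweights s)
            (≡.trans (length-unweights s) (≡.trans (↭-length π) (length-weights γ)))
            (≡.subst (StrictBelow u) (≡.sym (weights∘unweights s)) S)
            (≡.subst (_↭ weights γ) (≡.sym (weights∘unweights s)) π))
        where
        r = length γ
        V = λ w → Fr f (stair r) (unweights w)

    -- Lowered k-Schur functions in terms of k-Schur functions

    module Theory
      (one : A) (B-zero : B (+ 0) one ≋ one) (B-negative : ∀ n → B -[1+ n ] one ≋ 𝟘) (k : ℕ)
      (G : List ℕ → A) (G-nil : G [] ≋ one)
      (G-block : ∀ x ν → All (1 ≤_) (x ∷ ν) → length ν ≤ k ℕ.∸ x →
        G (x ∷ ν) ≋ Fr one (stair (suc (length ν))) (toZ (x ∷ ν)))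
      (G-++ : ∀ x ν y λ′ → All (1 ≤_) (x ∷ ν ++ y ∷ λ′) → length ν ≡ k ℕ.∸ x →
        G (x ∷ ν ++ y ∷ λ′) ≋ Fr (G (y ∷ λ′)) (stair (suc (length ν))) (toZ (x ∷ ν)))
      where

      open Vacuum one B-zero B-negative public
      open Excess k public

      module _ {P : A → Set} where

        -- With `d + length γ ≡ suc k` the highest admissible weight `k` is that of a first part
        -- `d`, so weights up to `k` sort to parts at most `d`. The lower bound excludes negative
        -- entries and keeps all parts at least `lo`.
        block-partition-span : ∀ f γ {d lo} → d ℕ.+ length γ ≡ suc k →
          All (+ lo ℤ.≤_) (weights γ) → All (ℤ._< + suc k) (weights γ) →
          (∀ ν → length ν ≡ length γ → Dec d ν → All (lo ≤_) ν → sumℤ (toZ ν) ≡ sumℤ γ →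
                 weights (toZ ν) ↭ weights γ → Span P (Fr f (stair (length γ)) (toZ ν))) →
          Span P (Fr f (stair (length γ)) γ)
        block-partition-span f γ {d} {lo} e A A′ h = block-span f γ A′ step
          where
          step : ∀ γ′ → length γ′ ≡ length γ → StrictBelow (+ suc k) (weights γ′) → weights γ′ ↭ weights γ →
                 Span P (Fr f (stair (length γ)) γ′)
          step γ′ l S π with strict⇒Dec d γ′
            (≡.subst (λ z → StrictBelow (+ z) (weights γ′)) (≡.trans (≡.sym e) (≡.cong (d ℕ.+_) (≡.sym l))) S)
          ... | inj₁ L             = ⊥-elim (LastNegative-weights L (All-resp-↭ (↭-sym π) A))
          ... | inj₂ (ν , refl , D) =
            h ν (≡.trans (≡.sym (toZ-length ν)) l) D (weights-≥ ν D (All-resp-↭ (↭-sym π) A)) (weights-↭-sum l π) π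

      -- The k-Schur function in its finite form; `s-EqSeries` identifies it with the series H.
      s : List ℕ → A
      s μ = Fr one (map (k ℕ.∸_) μ) (toZ μ)

      -- Zeros are allowed as parts: straightening keeps the number of rows, on which the induction
      -- runs, but may create zeros.
      record KGen (d ℓ : ℕ) (x : A) : Set where
        constructor kgen
        field
          μ     : List ℕ
          len   : length μ ≡ ℓ
          dec   : Dec d μ
          value : x ≋ s μ

      KSpan : ℕ → ℕ → A → Set
      KSpan d ℓ = Span (KGen d ℓ)

      block⇒Tall : ∀ {d} ν → Dec d ν → length ν ≤ suc (k ℕ.∸ d) → Tall (map (k ℕ.∸_) ν)
      block⇒Tall []      []       p = []
      block⇒Tall (x ∷ ν) (le ∷ D) p =
        ℕP.≤-trans (ℕP.≤-reflexive (length-map (k ℕ.∸_) ν)) (tail-length le p) ∷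
        block⇒Tall ν D (ℕP.≤-trans (tail-length le p) (ℕP.n≤1+n _))

      Fr-block : ∀ {d} f ν γ → Dec d ν → length ν ≤ suc (k ℕ.∸ d) → length γ ≡ length ν →
        Fr f (map (k ℕ.∸_) ν) γ ≋ Fr f (stair (length ν)) γ
      Fr-block f ν γ D p e = ≋-trans
        (Fr-truncate f (map (k ℕ.∸_) ν) γ (block⇒Tall ν D p) (≡.trans e (≡.sym (length-map (k ℕ.∸_) ν))))
        (≋-reflexive (≡.cong (λ l → Fr f (stair l) γ) (length-map (k ℕ.∸_) ν)))

      -- The index is lowered while the counts remain those of κ, so in general this is not itself a
      -- k-Schur function. The bound `suc (k ∸ d)` is what a preceding block with parts at least `d`
      -- can inflict.
      LoweredInK : ℕ → Set
      LoweredInK ℓ = ∀ {d} κ κ′ → length κ ≡ ℓ → Dec d κ → d ≤ k → Stairs (suc (k ℕ.∸ d)) (toZ κ) κ′ →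
                     KSpan d ℓ (Fr one (map (k ℕ.∸_) κ) κ′)

      -- Here ν acts without the factors that join it to σ, so in general this is not `s (ν ++ σ)`.
      PrependInK : ℕ → Set
      PrependInK ℓ = ∀ {d lo} ν σ → d ℕ.+ length ν ≡ suc k → d ≤ k → Dec d ν → All (lo ≤_) ν → lo ≤ d →
                     Dec lo σ → length σ ≡ ℓ → KSpan d (length ν ℕ.+ ℓ) (Fr (s σ) (stair (length ν)) (toZ ν))

      private
        block-size : ∀ {d l} → d ≤ k → d ℕ.+ l ≡ suc k → l ≡ suc (k ℕ.∸ d)
        block-size {d} d≤k e = ℕP.+-cancelˡ-≡ d _ _ (≡.trans e
          (≡.sym (≡.trans (ℕP.+-suc d _) (≡.cong suc (ℕP.m+[n∸m]≡n d≤k)))))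

        block-size′ : ∀ {d l} → d ≤ k → l ≡ suc (k ℕ.∸ d) → d ℕ.+ l ≡ suc k
        block-size′ {d} d≤k refl = ≡.trans (ℕP.+-suc d _) (≡.cong suc (ℕP.m+[n∸m]≡n d≤k))

      s-++ : ∀ {d} ν σ κ → Dec d ν → length ν ≤ suc (k ℕ.∸ d) → length κ ≡ length ν → ∀ ρ →
        Fr one (map (k ℕ.∸_) (ν ++ σ)) (κ ++ ρ) ≋
        Out (excess ν) (λ γ κ → Fr (Fr one (map (k ℕ.∸_) σ) κ) (stair (length ν)) γ) κ ρ
      s-++ ν σ κ D p e ρ = begin
        Fr one (map (k ℕ.∸_) (ν ++ σ)) (κ ++ ρ)
          ≡⟨ ≡.cong (λ ns → Fr one ns (κ ++ ρ)) (≡.trans (map-++ (k ℕ.∸_) ν σ)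
               (≡.cong (_++ map (k ℕ.∸_) σ) (non-roots ν D p))) ⟩
        Fr one (zipWith ℕ._+_ (stair (length (excess ν))) (excess ν) ++ map (k ℕ.∸_) σ) (κ ++ ρ)
          ≈⟨ Fr-Out one (map (k ℕ.∸_) σ) (excess ν) κ ρ (≡.trans e (≡.sym (length-excess ν))) ⟩
        Out (excess ν) (λ γ κ → Fr (Fr one (map (k ℕ.∸_) σ) κ) (stair (length (excess ν))) γ) κ ρ
          ≡⟨ ≡.cong (λ l → Out (excess ν) (λ γ κ → Fr (Fr one (map (k ℕ.∸_) σ) κ) (stair l) γ) κ ρ) (length-excess ν) ⟩
        _ ∎
        where open ≋-Reasoning

      ∸̂-flip : ∀ x y → ⊝ (x ∸̂ y) ≋ (y ∸̂ x)
      ∸̂-flip x y = ≋-trans (≋-sym (⊝-⊕-comm x (⊝ y))) (≋-trans (⊕-congˡ (⊝-involutive y)) (⊕-comm _ _))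

      -- The terms of s (ν ++ σ) other than B_ν s_σ itself have a strictly larger first block, and the sum
      -- of the first block is at most d * length ν.
      prepend : ∀ {ℓ} → LoweredInK ℓ → PrependInK ℓ
      prepend {ℓ} lowered {d} {lo} ν σ size d≤k D Lo lo≤d E e =
        loop (length ν ℕ.* d) ν σ size D Lo E e start
        where
        start : + (length ν ℕ.* d) ℤ.≤ sumℤ (toZ ν) ℤ.+ + (length ν ℕ.* d)
        start = ℤP.≤-trans (ℤP.≤-reflexive (≡.sym (ℤP.+-identityˡ _))) (ℤP.+-monoˡ-≤ (+ (length ν ℕ.* d)) (nonneg ν))
          where
          nonneg : ∀ ν → + 0 ℤ.≤ sumℤ (toZ ν)
          nonneg []      = ℤP.≤-refl
          nonneg (x ∷ ν) = ℤP.+-mono-≤ (ℤ.+≤+ (z≤n {x})) (nonneg ν)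

        loop : ∀ n ν σ → d ℕ.+ length ν ≡ suc k → Dec d ν → All (lo ≤_) ν → Dec lo σ → length σ ≡ ℓ →
          + (length ν ℕ.* d) ℤ.≤ sumℤ (toZ ν) ℤ.+ + n →
          KSpan d (length ν ℕ.+ ℓ) (Fr (s σ) (stair (length ν)) (toZ ν))
        loop n ν σ size D Lo E e bound = Span-cancel
          (resp (∸̂-flip _ _) (neg (Out-diff (excess ν) Y (toZ ν) (toZ σ) terms)))
          (gen (kgen (ν ++ σ) (≡.trans (length-++ ν) (≡.cong (length ν ℕ.+_) e)) (++-Dec D Lo lo≤d E)
            (≋-sym (≋-trans (≋-reflexive (≡.cong (Fr one (map (k ℕ.∸_) (ν ++ σ))) (map-++ +_ ν σ)))
                            (s-++ ν σ (toZ ν) D ν≤ (toZ-length ν) (toZ σ))))))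
          where
          ν≤ : length ν ≤ suc (k ℕ.∸ d)
          ν≤ = ℕP.≤-reflexive (block-size d≤k size)
          Y : List ℤ → List ℤ → A
          Y γ κ = Fr (Fr one (map (k ℕ.∸_) σ) κ) (stair (length ν)) γ
          bigger : ∀ ν′ τ → length ν′ ≡ length ν → Dec d ν′ → All (lo ≤_) ν′ → Dec lo τ → length τ ≡ ℓ →
            sumℤ (toZ ν) ℤ.< sumℤ (toZ ν′) → ∀ m → + (length ν ℕ.* d) ℤ.≤ sumℤ (toZ ν) ℤ.+ + m → m ≡ n →
            KSpan d (length ν′ ℕ.+ ℓ) (Fr (s τ) (stair (length ν′)) (toZ ν′))
          bigger ν′ τ l D′ Lo′ E′ e′ lt zero    bound refl = ⊥-elim (ℤP.<⇒≱ lt (ℤP.≤-trans (Dec-sum ν′ D′)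
            (ℤP.≤-trans (ℤP.≤-reflexive (≡.cong (λ l → + (l ℕ.* d)) l))
              (ℤP.≤-trans bound (ℤP.≤-reflexive (ℤP.+-identityʳ _))))))
          bigger ν′ τ l D′ Lo′ E′ e′ lt (suc m) bound refl =
            loop m ν′ τ (≡.trans (≡.cong (d ℕ.+_) l) size) D′ Lo′ E′ e′
              (ℤP.≤-trans (ℤP.≤-reflexive (≡.cong (λ l → + (l ℕ.* d)) l))
                (ℤP.≤-trans bound (ℤP.≤-trans (ℤP.≤-reflexive (≡.sym (suc-+ (sumℤ (toZ ν)) m)))
                  (ℤP.+-monoˡ-≤ (+ m) (ℤP.i<j⇒suc[i]≤j lt)))))
          terms : ∀ {γ κ′} → OutTerm (excess ν) (toZ ν) (toZ σ) γ κ′ → sumℤ (toZ ν) ℤ.< sumℤ γ →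
            KSpan d (length ν ℕ.+ ℓ) (Y γ κ′)
          terms {γ} {κ′} o lt = Span-map (Fr-linear (stair (length ν)) γ) on-generator
            (lowered σ κ′ e E (ℕP.≤-trans lo≤d d≤k)
              (OutTerm-Stairs (excess-increasing 0 ν D Lo lo≤d ν≤) o (Stairs-refl 0 (toZ σ))))
            where
            γ-length : length γ ≡ length ν
            γ-length = ≡.trans (OutTerm-length o) (toZ-length ν)
            bounds = OutTerm-weights (excess-bounds ν D d≤k Lo ν≤ (Stairs-refl _ _)) o
            on-generator : ∀ {x} → KGen lo ℓ x → KSpan d (length ν ℕ.+ ℓ) (Fr x (stair (length ν)) γ)
            on-generator {x} (kgen τ τ-length E′ x≋s) = resp
              (Linear.cong (Fr-linear (stair (length ν)) γ) (≋-sym x≋s))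
              (≡.subst (λ l → KSpan d (length ν ℕ.+ ℓ) (Fr (s τ) (stair l) γ)) γ-length
                (block-partition-span (s τ) γ (≡.trans (≡.cong (d ℕ.+_) γ-length) size) (proj₁ bounds) (proj₂ bounds)
                  λ ν′ l D′ Lo′ same-sum _ → ≡.subst₂
                    (λ a b → KSpan d (a ℕ.+ ℓ) (Fr (s τ) (stair b) (toZ ν′))) (≡.trans l γ-length) l
                    (bigger ν′ τ (≡.trans l γ-length) D′ Lo′ E′ τ-length
                      (ℤP.<-≤-trans lt (ℤP.≤-reflexive (≡.sym same-sum))) n bound refl)))

      -- All of κ fits into one block, so every pair is a non-root. Antisymmetry then sorts κ′ into
      -- a partition, unless the value is zero because of a repeated weight or a negative last
      -- entry.
      lowered-short : ∀ {d} κ κ′ → Dec d κ → length κ ≤ suc (k ℕ.∸ d) → Stairs (suc (k ℕ.∸ d)) (toZ κ) κ′ →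
        KSpan d (length κ) (Fr one (map (k ℕ.∸_) κ) κ′)
      lowered-short {d} κ κ′ D p S = resp
        (≋-trans (≋-reflexive (≡.cong (λ l → Fr one (stair l) κ′) κ′-length)) (≋-sym (Fr-block one κ κ′ D p κ′-length)))
        (block-span one κ′ {+ (d ℕ.+ length κ′)} (below κ D S) λ γ′ l SB π → outcome γ′ l SB (strict⇒Dec d γ′
          (≡.subst (λ z → StrictBelow (+ (d ℕ.+ z)) (weights γ′)) (≡.sym l) SB)))
        where
        κ′-length : length κ′ ≡ length κ
        κ′-length = ≡.trans (Stairs-length S) (toZ-length κ)
        below : ∀ {d p κ′} κ → Dec d κ → Stairs p (toZ κ) κ′ → All (ℤ._< + (d ℕ.+ length κ′)) (weights κ′)
        below []      []       []           = []
        below {d} {κ′ = y ∷ κ′} (x ∷ κ) (le ∷ D) (cons a b S) =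
          ℤP.≤-<-trans (ℤP.+-monoˡ-≤ (+ length κ′) (ℤP.≤-trans a (ℤ.+≤+ le)))
            (ℤ.+<+ (ℕP.≤-reflexive (≡.sym (ℕP.+-suc d (length κ′))))) ∷
          All.map (λ q → ℤP.<-≤-trans q (ℤ.+≤+ (ℕP.+-mono-≤ le (ℕP.n≤1+n (length κ′))))) (below κ D S)
        outcome : ∀ γ′ → length γ′ ≡ length κ′ → StrictBelow (+ (d ℕ.+ length κ′)) (weights γ′) →
          LastNegative γ′ ⊎ (∃ λ ν → γ′ ≡ toZ ν × Dec d ν) → KSpan d (length κ) (Fr one (stair (length κ′)) γ′)
        outcome γ′ l SB (inj₁ L) = resp (≋-sym (Fr-LastNegative (stair (length κ′)) γ′
          (≡.trans l (≡.sym (length-stair (length κ′)))) L)) zer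
        outcome γ′ l SB (inj₂ (ν , refl , D′)) = gen (kgen ν ν-length D′
          (≋-trans (≋-reflexive (≡.cong (λ l → Fr one (stair l) (toZ ν)) (≡.trans κ′-length (≡.sym ν-length))))
            (≋-sym (Fr-block one ν (toZ ν) D′ (ℕP.≤-trans (ℕP.≤-reflexive ν-length) p) (toZ-length ν)))))
          where
          ν-length : length ν ≡ length κ
          ν-length = ≡.trans (≡.sym (toZ-length ν)) (≡.trans l κ′-length)

      -- The staircase ends inside the first block, so σ is untouched at the outset. The factors
      -- leaving the block lower σ by no more than the staircase for `lo`, which bounds its parts,
      -- so induction on the number of rows treats σ before the block is sorted.
      lowered : ∀ n {ℓ} → ℓ ℕ.< n → LoweredInK ℓ
      lowered (suc n) (s≤s ℓ≤n) {d} κ κ′ refl D d≤k S with length κ ℕ.≤? suc (k ℕ.∸ d)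
      ... | yes p = lowered-short κ κ′ D p S
      ... | no ¬p with split-at (suc (k ℕ.∸ d)) κ (ℕP.<⇒≤ (ℕP.≰⇒> ¬p))
      ... | ν , σ , refl , size with Stairs-++ ν {toZ σ} size (≡.subst (λ z → Stairs _ z κ′) (map-++ +_ ν σ) S)
                                   | Dec-++ ν D
      ... | ν′ , refl , S′ | D′ , lo , lo≤d , Lo , E = resp (≋-sym (s-++ ν σ ν′ D′ ν≤ ν′-length (toZ σ)))
        (Out-span (excess ν) _ ν′ (toZ σ) terms)
        where
        ν≤ : length ν ≤ suc (k ℕ.∸ d)
        ν≤ = ℕP.≤-reflexive size
        ν′-length : length ν′ ≡ length ν
        ν′-length = ≡.trans (Stairs-length S′) (toZ-length ν)
        d+ν : d ℕ.+ length ν ≡ suc k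
        d+ν = block-size′ d≤k size
        shorter : length σ ℕ.< n
        shorter = ℕP.≤-trans (ℕP.≤-trans (ℕP.+-monoˡ-≤ (length σ) (ℕP.≤-trans (s≤s z≤n) (ℕP.≤-reflexive (≡.sym size))))
          (ℕP.≤-reflexive (≡.sym (length-++ ν)))) ℓ≤n
        terms : ∀ {γ κ″} → OutTerm (excess ν) ν′ (toZ σ) γ κ″ →
          KSpan d (length (ν ++ σ)) (Fr (Fr one (map (k ℕ.∸_) σ) κ″) (stair (length ν)) γ)
        terms {γ} {κ″} o = Span-map (Fr-linear (stair (length ν)) γ) on-generator
          (lowered n shorter σ κ″ refl E (ℕP.≤-trans lo≤d d≤k)
            (OutTerm-Stairs (excess-increasing 0 ν D′ Lo lo≤d ν≤) o (Stairs-refl 0 (toZ σ))))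
          where
          γ-length : length γ ≡ length ν
          γ-length = ≡.trans (OutTerm-length o) ν′-length
          bounds = OutTerm-weights (excess-bounds ν D′ d≤k Lo ν≤ (≡.subst (λ p → Stairs p (toZ ν) ν′) (≡.sym size) S′)) o
          on-generator : ∀ {x} → KGen lo (length σ) x → KSpan d (length (ν ++ σ)) (Fr x (stair (length ν)) γ)
          on-generator {x} (kgen τ τ-length E′ x≋s) = resp
            (Linear.cong (Fr-linear (stair (length ν)) γ) (≋-sym x≋s))
            (≡.subst (λ l → KSpan d (length (ν ++ σ)) (Fr (s τ) (stair l) γ)) γ-length
              (block-partition-span (s τ) γ (≡.trans (≡.cong (d ℕ.+_) γ-length) d+ν) (proj₁ bounds) (proj₂ bounds)
                λ ν″ l D″ Lo″ _ _ → ≡.subst₂ (λ a b → KSpan d a (Fr (s τ) (stair b) (toZ ν″)))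
                  (≡.trans (≡.cong (ℕ._+ length σ) (≡.trans l γ-length)) (≡.sym (length-++ ν))) l
                  (prepend (lowered n shorter) ν″ τ (≡.trans (≡.cong (d ℕ.+_) (≡.trans l γ-length)) d+ν)
                    d≤k D″ Lo″ lo≤d E′ τ-length)))

      -- k-Schur functions in terms of k-split polynomials

      record GGen (Q : List ℕ → Set) (x : A) : Set where
        constructor ggen
        field
          lam      : List ℕ
          dec      : Dec k lam
          positive : All (1 ≤_) lam
          holds    : Q lam
          value    : x ≋ G lam

      GSpan : (List ℕ → Set) → A → Set
      GSpan Q = Span (GGen Q)

      GSpan-mono : ∀ {Q R x} → (∀ {lam} → Q lam → R lam) → GSpan Q x → GSpan R x
      GSpan-mono f = Span-join λ { (ggen l D p q v) → gen (ggen l D p (f q) v) }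

      toZ-zeros : ∀ ν z → toZ (ν ++ replicate z 0) ≡ toZ ν ++ replicate z (+ 0)
      toZ-zeros ν z = ≡.trans (map-++ +_ ν (replicate z 0)) (≡.cong (toZ ν ++_) (map-replicate +_ z 0))

      -- Trailing zeros are dropped by `Fr-zeros`, and the rest is a single block of its own
      -- k-split.
      block-G : ∀ {d} μ → Dec d μ → length μ ≤ suc (k ℕ.∸ d) → d ≤ k →
        GSpan (Dec d) (Fr one (stair (length μ)) (toZ μ))
      block-G {d} μ D p d≤k with strip-zeros μ D
      ... | ν , z , refl , pos = resp (≋-trans (≋-sym (Fr-zeros (length ν) z (toZ ν) (toZ-length ν)))
              (≋-reflexive (≡.cong₂ (λ l γ → Fr one (stair l) γ) (≡.sym len) (≡.sym (toZ-zeros ν z)))))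
            (stripped ν pos (proj₁ (Dec-++ ν D)) (ℕP.≤-trans (ℕP.m≤n+m _ z) (ℕP.≤-trans (ℕP.≤-reflexive (≡.sym len)) p)))
        where
        len : length (ν ++ replicate z 0) ≡ z ℕ.+ length ν
        len = ≡.trans (length-++ ν) (≡.trans (ℕP.+-comm (length ν) _) (≡.cong (ℕ._+ length ν) (length-replicate z)))
        stripped : ∀ ν → All (1 ≤_) ν → Dec d ν → length ν ≤ suc (k ℕ.∸ d) →
          GSpan (Dec d) (Fr one (stair (length ν)) (toZ ν))
        stripped []      pos D        p = gen (ggen [] [] [] [] (≋-sym G-nil))
        stripped (x ∷ ν) pos (le ∷ D) p = gen (ggen (x ∷ ν) (ℕP.≤-trans le d≤k ∷ D) pos (le ∷ D)
          (≋-sym (G-block x ν pos (tail-length le p))))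

      weights-< : ∀ {d w} ν → Dec d ν → w ∈ weights (toZ ν) → w ℤ.< + (d ℕ.+ length ν)
      weights-< {d} (x ∷ ν) (le ∷ D) (here refl) = ℤ.+<+ (ℕP.≤-trans
        (s≤s (ℕP.+-mono-≤ le (ℕP.≤-reflexive (toZ-length ν)))) (ℕP.≤-reflexive (≡.sym (ℕP.+-suc d _))))
      weights-< {d} (x ∷ ν) (le ∷ D) (there m)   =
        ℤP.<-≤-trans (weights-< ν D m) (ℤ.+≤+ (ℕP.+-mono-≤ le (ℕP.n≤1+n _)))

      -- `x + length ν` is the largest weight available to parts at most `x`, and only the first
      -- place can attain it.
      first-entry : ∀ {x} y ν → Dec x (y ∷ ν) → + (x ℕ.+ length ν) ∈ weights (toZ (y ∷ ν)) → y ≡ x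
      first-entry {x} y ν (le ∷ D) (here e)  = ≡.sym (ℕP.+-cancelʳ-≡ (length ν) _ _ (≡.trans (ℤP.+-injective e)
        (≡.cong (y ℕ.+_) (toZ-length ν))))
      first-entry {x} y ν (le ∷ D) (there m) =
        ⊥-elim (ℤP.<⇒≱ (weights-< ν D m) (ℤ.+≤+ (ℕP.+-monoˡ-≤ (length ν) le)))

      -- With no non-root outside the block, the first row takes part in no factor of `Out`.
      first-row-fixed : ∀ {Ns x ν κ γ κ′} → OutTerm (0 ∷ Ns) (x ∷ ν) κ γ κ′ → ∃ λ γ₁ → γ ≡ x ∷ γ₁
      first-row-fixed (raise {γ = γ} p q _ _) =
        γ , ≡.cong (_∷ γ) (ℤP.≤-antisym (ℤP.≤-trans q (ℤP.≤-reflexive (ℤP.+-identityʳ _))) p)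

      s-in-G : ∀ n {d} μ → length μ ℕ.< n → Dec d μ → d ≤ k → GSpan (Dec d) (s μ)
      s-in-G (suc n) []      lt       D        d≤k = gen (ggen [] [] [] [] (≋-sym G-nil))
      s-in-G (suc n) {d} (x ∷ μ) (s≤s lt) (le ∷ D) d≤k = GSpan-mono (Dec-mono le) main
        where
        x≤k = ℕP.≤-trans le d≤k
        main : GSpan (Dec x) (s (x ∷ μ))
        main with length μ ℕ.≤? k ℕ.∸ x
        ... | yes p = resp (≋-sym (Fr-block one (x ∷ μ) (toZ (x ∷ μ)) (ℕP.≤-refl ∷ D) (s≤s p) (toZ-length (x ∷ μ))))
                           (block-G (x ∷ μ) (ℕP.≤-refl ∷ D) (s≤s p) x≤k)
        ... | no ¬p with split-at (k ℕ.∸ x) μ (ℕP.<⇒≤ (ℕP.≰⇒> ¬p))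
        ... | ν₁ , σ , refl , size with Dec-++ {x} (x ∷ ν₁) (ℕP.≤-refl ∷ D)
        ... | D′ , lo , lo≤x , Lo , E = resp (≋-sym (≋-trans
            (≋-reflexive (≡.cong (Fr one (map (k ℕ.∸_) (x ∷ ν₁ ++ σ))) (map-++ +_ (x ∷ ν₁) σ)))
            (s-++ (x ∷ ν₁) σ (toZ (x ∷ ν₁)) D′ ν≤ (toZ-length (x ∷ ν₁)) (toZ σ))))
          (Out-span (excess ν) _ (toZ ν) (toZ σ) terms)
          where
          ν = x ∷ ν₁
          ν≤ : length ν ≤ suc (k ℕ.∸ x)
          ν≤ = ℕP.≤-reflexive (≡.cong suc size)
          x+ν : x ℕ.+ length ν ≡ suc k
          x+ν = block-size′ x≤k (≡.cong suc size)
          shorter : length σ ℕ.< n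
          shorter = ℕP.≤-trans (s≤s (ℕP.≤-trans (ℕP.m≤n+m _ (length ν₁)) (ℕP.≤-reflexive (≡.sym (length-++ ν₁))))) lt
          -- The block has `k ∸ x + 1` rows, so the `k ∸ x` non-roots of its first row all lie
          -- inside it.
          full-excess : excess ν ≡ 0 ∷ excess ν₁
          full-excess = ≡.cong (_∷ excess ν₁) (≡.trans (≡.cong (k ℕ.∸ x ℕ.∸_) size) (ℕP.n∸n≡0 (k ℕ.∸ x)))
          terms : ∀ {γ κ″} → OutTerm (excess ν) (toZ ν) (toZ σ) γ κ″ →
            GSpan (Dec x) (Fr (Fr one (map (k ℕ.∸_) σ) κ″) (stair (length ν)) γ)
          terms {γ} {κ″} o with first-row-fixed (≡.subst (λ Ns → OutTerm Ns (toZ ν) (toZ σ) γ κ″) full-excess o)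
          ... | γ₁ , refl = Span-map (Fr-linear (stair (length ν)) γ) on-K
            (lowered (suc (length σ)) ℕP.≤-refl σ κ″ refl E (ℕP.≤-trans lo≤x x≤k)
              (OutTerm-Stairs (excess-increasing 0 ν D′ Lo lo≤x ν≤) o (Stairs-refl 0 (toZ σ))))
            where
            γ-length : length γ ≡ length ν
            γ-length = ≡.trans (OutTerm-length o) (toZ-length ν)
            bounds = OutTerm-weights (excess-bounds ν D′ x≤k Lo ν≤ (Stairs-refl _ _)) o
            on-G : ∀ {y} → GGen (Dec lo) y → GSpan (Dec x) (Fr y (stair (length ν)) γ)
            on-G {y} (ggen lam _ pos Dlo y≋G) = resp
              (Linear.cong (Fr-linear (stair (length ν)) γ) (≋-sym y≋G))
              (≡.subst (λ l → GSpan (Dec x) (Fr (G lam) (stair l) γ)) γ-length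
                (block-partition-span (G lam) γ (≡.trans (≡.cong (x ℕ.+_) γ-length) x+ν) (proj₁ bounds) (proj₂ bounds)
                  λ { (y ∷ ν″) l D″ Lo″ _ π → ≡.subst (λ b → GSpan (Dec x) (Fr (G lam) (stair b) (toZ (y ∷ ν″)))) l
                    (concat y ν″ (ℕP.suc-injective (≡.trans l γ-length)) D″ Lo″
                      -- The unraised first row carries the largest possible weight, which survives
                      -- sorting, so the sorted block still starts with `x`.
                      (first-entry y ν″ D″ (≡.subst (_∈ weights (toZ (y ∷ ν″)))
                        (≡.cong (λ l → + (x ℕ.+ l)) (≡.sym (ℕP.suc-injective l)))
                        (∈-resp-↭ (↭-sym π) (here refl)))) lam pos Dlo) }))
              where
              concat : ∀ y ν″ → length ν″ ≡ length ν₁ → Dec x (y ∷ ν″) → All (lo ≤_) (y ∷ ν″) → y ≡ x →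
                ∀ lam → All (1 ≤_) lam → Dec lo lam → GSpan (Dec x) (Fr (G lam) (stair (length (y ∷ ν″))) (toZ (y ∷ ν″)))
              -- With nothing behind it the block is the last one, and it may end in zeros, which
              -- `block-G` strips.
              concat y ν″ l D″ Lo″ refl [] pos Dlo = resp
                (Linear.cong (Fr-linear (stair (length (y ∷ ν″))) (toZ (y ∷ ν″))) (≋-sym G-nil))
                (block-G (y ∷ ν″) D″ (ℕP.≤-reflexive (≡.cong suc (≡.trans l size))) x≤k)
              concat y ν″ l D″ Lo″ refl (z ∷ lam) pos@(z≥1 ∷ _) (z≤lo ∷ D₀) =
                gen (ggen (y ∷ ν″ ++ z ∷ lam) (Dec-mono x≤k all-dec) all-pos all-dec
                  (≋-sym (G-++ y ν″ z lam all-pos (≡.trans l size))))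
                where
                all-dec : Dec x (y ∷ ν″ ++ z ∷ lam)
                all-dec = ++-Dec D″ Lo″ lo≤x (z≤lo ∷ D₀)
                all-pos : All (1 ≤_) (y ∷ ν″ ++ z ∷ lam)
                all-pos = AllP.++⁺ (All.map (ℕP.≤-trans (ℕP.≤-trans z≥1 z≤lo)) Lo″) pos
            on-K : ∀ {y} → KGen lo (length σ) y → GSpan (Dec x) (Fr y (stair (length ν)) γ)
            on-K {y} (kgen τ τ-length E′ y≋s) = resp
              (Linear.cong (Fr-linear (stair (length ν)) γ) (≋-sym y≋s))
              (Span-map (Fr-linear (stair (length ν)) γ) on-G
                (s-in-G n τ (≡.subst (ℕ._< n) (≡.sym τ-length) shorter) E′ (ℕP.≤-trans lo≤x x≤k)))

      -- Words in the B's in terms of k-split polynomials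

      E : List ℤ → A
      E = foldr B one

      foldr-B-linear : ∀ p → Linear (λ x → foldr B x p)
      foldr-B-linear []      = id-linear
      foldr-B-linear (m ∷ p) = ∘-linear (B-linear m) (foldr-B-linear p)

      E-++ : ∀ p q → E (p ++ q) ≡ foldr B (E q) p
      E-++ p q = foldr-++ B one p q

      B-𝟘 : ∀ m {x} → x ≋ 𝟘 → B m x ≋ 𝟘
      B-𝟘 m e = ≋-trans (B-cong m e) (Linear.𝟘-hom (B-linear m))

      E-LastNegative : ∀ {γ} → LastNegative γ → E γ ≋ 𝟘
      E-LastNegative (last { -[1+ n ]} p)     = B-negative n
      E-LastNegative (last {+ n} (ℤ.+<+ ()))
      E-LastNegative (there {x} L)            = B-𝟘 x (E-LastNegative L)

      E-zeros : ∀ γ z → E (γ ++ replicate z (+ 0)) ≋ E γ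
      E-zeros γ z = ≋-trans (≋-reflexive (E-++ γ _)) (Linear.cong (foldr-B-linear γ) (zeros z))
        where
        zeros : ∀ z → E (replicate z (+ 0)) ≋ one
        zeros zero    = ≋-refl
        zeros (suc z) = ≋-trans (B-cong (+ 0) (zeros z)) B-zero

      Bounded : List ℤ → Set
      Bounded = All (ℤ._≤ + k)

      -- A row of index `m` with `n` non-roots rises to at most `m + n`; this keeps all words of the
      -- expansion bounded by `k`.
      data Fits : List ℕ → List ℤ → Set where
        []  : Fits [] []
        _∷_ : ∀ {n ns m γ} → m ℤ.+ + n ℤ.≤ + k → Fits ns γ → Fits (n ∷ ns) (m ∷ γ)

      Fits-Bounded : ∀ {ns γ} → Fits ns γ → Bounded γ
      Fits-Bounded []      = []
      Fits-Bounded (p ∷ F) = ℤP.≤-trans (ℤP.i≤i+j _ _) p ∷ Fits-Bounded F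

      Fits-Lw : ∀ {ns γ N γ′} → Fits ns γ → Lw N γ γ′ → Fits ns γ′
      Fits-Lw F       stop     = F
      Fits-Lw []      nil      = []
      Fits-Lw (p ∷ F) (keep l) = p ∷ Fits-Lw F l
      Fits-Lw (_∷_ {n} {m = m} p F) (down l) =
        ℤP.≤-trans (ℤP.+-monoˡ-≤ (+ n) (ℤP.i≤j⇒pred[i]≤j (ℤP.≤-refl {m}))) p ∷ Fits-Lw F l

      record EGen (γ : List ℤ) (x : A) : Set where
        constructor egen
        field
          γ′      : List ℤ
          bounded : Bounded γ′
          greater : γ ≺ γ′
          value   : x ≋ E γ′

      -- In every term other than B̃_γ 1 the earliest row that is shifted is only raised, so the
      -- word is lexicographically larger: the expansion is unitriangular.
      Fr-E : ∀ ns γ → Fits ns γ → Span (EGen γ) (Fr one ns γ ∸̂ E γ)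
      Fr-E []       []      []      = resp (≋-sym (⊕-inverseʳ _)) zer
      Fr-E (n ∷ ns) (m ∷ γ) (p ∷ F) = resp (telescope _ _ _) (add
        (Rw-diff n (λ i γ → B i (Fr one ns γ)) m γ λ {i} {γ′} m<i i≤ l →
          let F′ = Fits-Lw F l
              bound = ℤP.≤-trans i≤ p
          in Span-cancel {y = E (i ∷ γ′)}
            (resp (B-∸̂ i _ _) (Span-map (B-linear i)
              (λ { (egen β b g v) → gen (egen (i ∷ β) (bound ∷ b) (here m<i (≡.trans (≡.sym (Lw-length l)) (≺-length g)))
                                             (B-cong i v)) })
              (Fr-E ns γ′ F′)))
            (gen (egen (i ∷ γ′) (bound ∷ Fits-Bounded F′) (here m<i (≡.sym (Lw-length l))) ≋-refl)))
        (resp (B-∸̂ m _ _) (Span-map (B-linear m)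
          (λ { (egen β b g v) → gen (egen (m ∷ β) (ℤP.≤-trans (ℤP.i≤i+j m _) p ∷ b) (there g) (B-cong m v)) })
          (Fr-E ns γ F))))
        where
        B-∸̂ : ∀ i x y → B i (x ∸̂ y) ≋ (B i x ∸̂ B i y)
        B-∸̂ i x y = ≋-trans (Linear.⊕-hom (B-linear i) _ _) (⊕-congˡ (Linear.⊝-hom (B-linear i) _))

      -- Accessibility for the increase of bounded lists, along which straightening terminates.
      data Up (γ : List ℤ) : Set where
        up : (∀ γ′ → Bounded γ′ → γ ≺ γ′ → Up γ′) → Up γ

      -- `n` bounds how far the head can still climb before it reaches `k`. When the head rises the
      -- tail may become anything of the same length, hence the hypothesis on all tails.
      Up-∷ : ∀ n m → + k ℤ.≤ m ℤ.+ + n → ∀ {γ} → (∀ γ′ → length γ′ ≡ length γ → Up γ′) → Up γ → Up (m ∷ γ)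
      Up-∷ n m h {γ} tails (up f) = up step
        where
        step : ∀ γ′ → Bounded γ′ → (m ∷ γ) ≺ γ′ → Up γ′
        step (m′ ∷ γ′) (b ∷ _) (here m<m′ e) = fewer n h
          where
          fewer : ∀ n → + k ℤ.≤ m ℤ.+ + n → Up (m′ ∷ γ′)
          fewer zero    h = ⊥-elim (ℤP.<⇒≱ m<m′ (ℤP.≤-trans b (ℤP.≤-trans h (ℤP.≤-reflexive (ℤP.+-identityʳ m)))))
          fewer (suc n) h = Up-∷ n m′ (ℤP.≤-trans h (ℤP.≤-trans (ℤP.≤-reflexive (≡.sym (suc-+ m n)))
            (ℤP.+-monoˡ-≤ (+ n) (ℤP.i<j⇒suc[i]≤j m<m′))))
            (λ γ″ l → tails γ″ (≡.trans l (≡.sym e))) (tails γ′ (≡.sym e))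
        step (.m ∷ γ′) (_ ∷ b) (there g) =
          Up-∷ n m h (λ γ″ l → tails γ″ (≡.trans l (≡.sym (≺-length g)))) (f γ′ b g)

      all-Up : ∀ l γ → length γ ≡ l → Up γ
      all-Up zero    []      refl = up λ { γ′ _ () }
      -- The head may be negative, so `k + |m|` steps are allowed for.
      all-Up (suc l) (m ∷ γ) refl = Up-∷ (k ℕ.+ ℤ.∣ m ∣) m enough (λ γ′ e → all-Up l γ′ e) (all-Up l γ refl)
        where
        enough : + k ℤ.≤ m ℤ.+ + (k ℕ.+ ℤ.∣ m ∣)
        enough = ℤP.≤-trans (ℤP.≤-reflexive (≡.sym (ℤP.+-identityʳ (+ k))))
          (ℤP.≤-trans (ℤP.+-monoʳ-≤ (+ k) (0≤m+∣m∣ m)) (ℤP.≤-reflexive (lemma m (+ k) (+ ℤ.∣ m ∣))))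
          where
          0≤m+∣m∣ : ∀ m → + 0 ℤ.≤ m ℤ.+ + ℤ.∣ m ∣
          0≤m+∣m∣ (+ n)    = ℤ.+≤+ z≤n
          0≤m+∣m∣ -[1+ n ] = ℤP.≤-reflexive (≡.sym (ℤP.+-inverseˡ (+ suc n)))
          lemma : ∀ m a b → a ℤ.+ (m ℤ.+ b) ≡ m ℤ.+ (a ℤ.+ b)
          lemma m a b = ≡.trans (≡.sym (ℤP.+-assoc a m b))
            (≡.trans (≡.cong (ℤ._+ b) (ℤP.+-comm a m)) (ℤP.+-assoc m a b))

      Fr-concat : ∀ f ns γ κ → Fr f (stair (length γ) ++ ns) (γ ++ κ) ≋ Fr (Fr f ns κ) (stair (length γ)) γ
      Fr-concat f ns γ κ = go (length γ) γ refl
        where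
        go : ∀ r γ → length γ ≡ r → Fr f (stair r ++ ns) (γ ++ κ) ≋ Fr (Fr f ns κ) (stair r) γ
        go zero    []      e    = ≋-refl
        go (suc r) (m ∷ γ) refl = begin
          Rw r X m (γ ++ κ)                    ≡⟨ ≡.cong (λ l → Rw l X m (γ ++ κ)) (ℕP.+-identityʳ r) ⟨
          Rw (r ℕ.+ 0) X m (γ ++ κ)            ≈⟨ Rw-++ 0 X m γ κ ⟩
          Rw r (λ i γ → X i (γ ++ κ)) m γ      ≈⟨ Rw-cong-on r m γ (λ i l → B-cong i (go r _ (Lw-length l))) ⟩
          _ ∎
          where open ≋-Reasoning
                X = λ i α → B i (Fr f (stair r ++ ns) α)

      stair-Fits : ∀ {d} ν → Dec d ν → d ≤ k → length ν ≤ suc (k ℕ.∸ d) → Fits (stair (length ν)) (toZ ν)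
      stair-Fits []      []       d≤k p = []
      stair-Fits {d} (x ∷ ν) (le ∷ D) d≤k p =
        ℤ.+≤+ (ℕP.≤-trans (ℕP.+-monoʳ-≤ x (tail-length le p)) (ℕP.≤-reflexive (ℕP.m+[n∸m]≡n x≤k))) ∷
        stair-Fits ν D x≤k (ℕP.≤-trans (tail-length le p) (ℕP.n≤1+n _))
        where x≤k = ℕP.≤-trans le d≤k

      Fits-++ : ∀ {ns γ ns′ γ′} → Fits ns γ → Fits ns′ γ′ → Fits (ns ++ ns′) (γ ++ γ′)
      Fits-++ []      F′ = F′
      Fits-++ (p ∷ F) F′ = p ∷ Fits-++ F F′

      -- The non-roots are the pairs within a common block of the k-split. A part `x` has at most
      -- `k ∸ x` rows after it in its block, so all rows fit under `k` and `Fr-E` applies to G as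
      -- well.
      G-as-Fr : ∀ n lam → length lam ℕ.< n → Dec k lam → All (1 ≤_) lam →
        ∃ λ ns → Fits ns (toZ lam) × G lam ≋ Fr one ns (toZ lam)
      G-as-Fr (suc n) []      lt       D        pos = [] , [] , G-nil
      G-as-Fr (suc n) (x ∷ μ) (s≤s lt) (x≤k ∷ D) pos with length μ ℕ.≤? k ℕ.∸ x
      ... | yes p = stair (suc (length μ)) , stair-Fits (x ∷ μ) (ℕP.≤-refl ∷ D) x≤k (s≤s p) , G-block x μ pos p
      ... | no ¬p with split-at (k ℕ.∸ x) μ (ℕP.<⇒≤ (ℕP.≰⇒> ¬p))
      ... | ν , [] , refl , size = ⊥-elim (¬p (ℕP.≤-reflexive (≡.trans (≡.cong length (++-identityʳ ν)) size)))
      ... | ν , z ∷ σ , refl , size with Dec-++ {k} (x ∷ ν) (x≤k ∷ D)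
      ... | _ ∷ D′ , lo , lo≤k , Lo , E′ with G-as-Fr n (z ∷ σ)
          (ℕP.≤-trans (s≤s (ℕP.≤-trans (ℕP.m≤n+m _ (length ν)) (ℕP.≤-reflexive (≡.sym (length-++ ν))))) lt)
          (Dec-mono lo≤k E′) (AllP.++⁻ʳ (x ∷ ν) pos)
      ... | ns , F , e = stair (suc (length ν)) ++ ns
          , ≡.subst (Fits (stair (suc (length ν)) ++ ns)) (≡.sym (map-++ +_ (x ∷ ν) (z ∷ σ)))
              (Fits-++ (stair-Fits (x ∷ ν) (ℕP.≤-refl ∷ D′) x≤k (ℕP.≤-reflexive (≡.cong suc size))) F)
          , (begin
              G (x ∷ ν ++ z ∷ σ)
                ≈⟨ G-++ x ν z σ pos size ⟩
              Fr (G (z ∷ σ)) (stair (suc (length ν))) (toZ (x ∷ ν))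
                ≈⟨ Linear.cong (Fr-linear (stair (suc (length ν))) (toZ (x ∷ ν))) e ⟩
              Fr (Fr one ns (toZ (z ∷ σ))) (stair (suc (length ν))) (toZ (x ∷ ν))
                ≡⟨ ≡.cong (λ l → Fr (Fr one ns (toZ (z ∷ σ))) (stair (suc l)) (toZ (x ∷ ν))) (toZ-length ν) ⟨
              Fr (Fr one ns (toZ (z ∷ σ))) (stair (length (toZ (x ∷ ν)))) (toZ (x ∷ ν))
                ≈⟨ Fr-concat one ns (toZ (x ∷ ν)) (toZ (z ∷ σ)) ⟨
              Fr one (stair (length (toZ (x ∷ ν))) ++ ns) (toZ (x ∷ ν) ++ toZ (z ∷ σ))
                ≡⟨ ≡.cong₂ (λ l γ → Fr one (stair (suc l) ++ ns) γ) (toZ-length ν) (≡.sym (map-++ +_ (x ∷ ν) (z ∷ σ))) ⟩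
              Fr one (stair (suc (length ν)) ++ ns) (toZ (x ∷ ν ++ z ∷ σ)) ∎)
        where open ≋-Reasoning

      HeadAbove : ℤ → List ℕ → Set
      HeadAbove h lam = h ℤ.≤ + headℕ lam

      -- Every step leads to lexicographically larger words: an ascent is removed by the quadratic
      -- relation, and a partition is replaced by its G minus the larger words in the expansion of
      -- G. Hence heads never drop below `h`.
      E-in-G : ∀ {h} γ → Up γ → Bounded γ → h ℤ.≤ headℤ γ → GSpan (HeadAbove h) (E γ)
      E-in-G {h} γ (up f) b h≤ with shape γ
      ... | negative L = resp (≋-sym (E-LastNegative L)) zer
      ... | ascent p x y q x<y refl = resp (≋-reflexive (≡.sym (E-++ p (x ∷ y ∷ q))))
        (Span-map (foldr-B-linear p) on-terms (straighten x y x<y (E q)))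
        where
        greater : ∀ u v → x ℤ.< u → u ℤ.≤ y → v ℤ.≤ y → GSpan (HeadAbove h) (foldr B (B u (B v (E q))) p)
        greater u v x<u u≤y v≤y = resp (≋-reflexive (E-++ p (u ∷ v ∷ q))) (E-in-G (p ++ u ∷ v ∷ q)
          (f _ b′ lt) b′ (ℤP.≤-trans h≤ (≺-head lt)))
          where
          b₁ = AllP.++⁻ʳ p b
          y≤k = All.head (All.tail b₁)
          b′ : Bounded (p ++ u ∷ v ∷ q)
          b′ = AllP.++⁺ (AllP.++⁻ˡ p b) (ℤP.≤-trans u≤y y≤k ∷ ℤP.≤-trans v≤y y≤k ∷ All.tail (All.tail b₁))
          lt : (p ++ x ∷ y ∷ q) ≺ (p ++ u ∷ v ∷ q)
          lt = ≺-++ p (here x<u refl)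
        Term : A → Set
        Term z = ∃ λ u → ∃ λ v → x ℤ.< u × u ℤ.≤ y × v ℤ.≤ y × z ≋ B u (B v (E q))
        on-terms : ∀ {z} → Term z → GSpan (HeadAbove h) (foldr B z p)
        on-terms (u , v , x<u , u≤y , v≤y , e) =
          resp (Linear.cong (foldr-B-linear p) (≋-sym e)) (greater u v x<u u≤y v≤y)
        -- When y = x + 1 the quadratic relation reads 2 (B x B y − t B y B x) = 0.
        straighten : ∀ x′ y′ → x′ ℤ.< y′ → ∀ z → Span
          (λ w → ∃ λ u → ∃ λ v → x′ ℤ.< u × u ℤ.≤ y′ × v ℤ.≤ y′ × w ≋ B u (B v z)) (B x′ (B y′ z))
        straighten x′ y′ lt z with ℤ.suc x′ ℤ.≟ y′
        ... | yes refl = resp (≋-sym (⊖⇒≋ (torsion-free _ (≋-trans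
                (≋-reflexive (≡.cong (λ w → (B x′ (B y′ z) ⊖ B y′ (B w z)) ⊕ (B w (B y′ z) ⊖ B y′ (B x′ z)))
                  (≡.sym (ℤP.pred-suc x′))))
                (B-quadratic x′ y′ z)))))
              (tmul (gen (y′ , x′ , lt , ℤP.≤-refl , ℤP.<⇒≤ lt , ≋-refl)))
          where
          ⊖⇒≋ : ∀ {u v} → u ⊖ v ≋ 𝟘 → u ≋ t v
          ⊖⇒≋ {u} {v} e = ≋-trans (≋-sym (recover u (t v))) (≋-trans (⊕-congʳ e) (⊕-identityˡ _))
        ... | no ¬e = resp (solve (B x′ (B y′ z)) _ _ (B-quadratic x′ y′ z))
              (add (tmul (gen (ℤ.suc x′ , ℤ.pred y′ , ℤP.≤-<-trans ℤP.≤-refl (x<suc x′) , suc≤ , pred≤ , ≋-refl)))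
                   (neg (Span-⊖ (gen (ℤ.pred y′ , ℤ.suc x′ , x<pred , pred≤ , suc≤ , ≋-refl))
                                (gen (y′ , x′ , lt , ℤP.≤-refl , ℤP.<⇒≤ lt , ≋-refl)))))
          where
          x<suc : ∀ i → i ℤ.< ℤ.suc i
          x<suc i = ℤP.suc[i]≤j⇒i<j ℤP.≤-refl
          suc≤ : ℤ.suc x′ ℤ.≤ y′
          suc≤ = ℤP.i<j⇒suc[i]≤j lt
          pred≤ : ℤ.pred y′ ℤ.≤ y′
          pred≤ = ℤP.i≤j⇒pred[i]≤j ℤP.≤-refl
          x<pred : x′ ℤ.< ℤ.pred y′
          x<pred = ℤP.suc[i]≤j⇒i<j (ℤP.i<j⇒i≤pred[j] (ℤP.≤∧≢⇒< suc≤ ¬e))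
          solve : ∀ a b c → (a ⊖ b) ⊕ c ≋ 𝟘 → t b ⊕ ⊝ c ≋ a
          solve a b c e = begin
            t b ⊕ ⊝ c                   ≈⟨ ⊕-congˡ (⊕-inverse-unique c (a ⊖ b) (≋-trans (⊕-comm _ _) e)) ⟨
            t b ⊕ (a ⊖ b)               ≈⟨ ⊕-comm _ _ ⟩
            (a ⊖ b) ⊕ t b               ≈⟨ recover a (t b) ⟩
            a ∎
            where open ≋-Reasoning
      E-in-G {h} γ (up f) b h≤ | partition μ D refl with strip-zeros μ D
      ... | ν , z , refl , pos = resp (≋-sym (≋-trans (≋-reflexive (≡.cong E (toZ-zeros ν z))) (E-zeros (toZ ν) z))) in-G
        where
        -- The zeros stripped from the partition are put back, since the order compares lists of
        -- equal length.
        padded : ∀ γ → List ℤ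
        padded γ = γ ++ replicate z (+ 0)
        Dν : Dec k ν
        Dν = Dec-bounded ν (proj₁ (Dec-++ ν D)) (AllP.++⁻ˡ (toZ ν) (≡.subst Bounded (toZ-zeros ν z) b))
          where
          Dec-bounded : ∀ {d} ν → Dec d ν → Bounded (toZ ν) → Dec k ν
          Dec-bounded []      []       []      = []
          Dec-bounded (x ∷ ν) (_ ∷ D)  (b ∷ _) = ℤP.drop‿+≤+ b ∷ D
        in-G : GSpan (HeadAbove h) (E (toZ ν))
        in-G with G-as-Fr (suc (length ν)) ν ℕP.≤-refl Dν pos
        ... | ns , F , e = Span-cancel
          (resp (∸̂-flip _ _) (neg (Span-join on-terms (Fr-E ns (toZ ν) F))))
          (gen (ggen ν Dν pos (ℤP.≤-trans h≤ (ℤP.≤-reflexive (head-zeros ν z))) (≋-sym e)))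
          where
          head-zeros : ∀ ν z → headℤ (toZ (ν ++ replicate z 0)) ≡ + headℕ ν
          head-zeros []      zero    = refl
          head-zeros []      (suc z) = refl
          head-zeros (x ∷ ν) z       = refl
          zeros-bounded : ∀ z → Bounded (replicate z (+ 0))
          zeros-bounded zero    = []
          zeros-bounded (suc z) = ℤ.+≤+ z≤n ∷ zeros-bounded z
          on-terms : ∀ {x} → EGen (toZ ν) x → GSpan (HeadAbove h) x
          on-terms (egen γ′ b′ g v) = resp (≋-trans (E-zeros γ′ z) (≋-sym v))
            (E-in-G (padded γ′) (f (padded γ′) b″ lt) b″ (ℤP.≤-trans h≤ (≺-head lt)))
            where
            b″ : Bounded (padded γ′)
            b″ = AllP.++⁺ b′ (zeros-bounded z)
            lt : toZ (ν ++ replicate z 0) ≺ padded γ′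
            lt = ≡.subst (_≺ padded γ′) (≡.sym (toZ-zeros ν z)) (≺-++ʳ g)

      -- The row of `m` has just `k ∸ m` non-roots, so its raised indices never pass `k`, the bound
      -- under which words are straightened.
      prepend-row-in-G : ∀ {m} μ → Dec k (m ∷ μ) → GSpan (λ lam → m ℕ.< headℕ lam) (B (+ m) (s μ) ∸̂ s (m ∷ μ))
      prepend-row-in-G {m} μ (m≤k ∷ D) = resp (∸̂-flip _ _) (neg (Rw-diff (k ℕ.∸ m) X (+ m) (toZ μ) terms))
        where
        X = λ i γ → B i (Fr one (map (k ℕ.∸_) μ) γ)
        all-Fits : ∀ {d} μ → Dec d μ → d ≤ k → Fits (map (k ℕ.∸_) μ) (toZ μ)
        all-Fits []      []       d≤k = []
        all-Fits (x ∷ μ) (le ∷ D) d≤k = ℤ.+≤+ (ℕP.≤-reflexive (ℕP.m+[n∸m]≡n x≤k)) ∷ all-Fits μ D x≤k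
          where x≤k = ℕP.≤-trans le d≤k
        terms : ∀ {i γ} → + m ℤ.< i → i ℤ.≤ + m ℤ.+ + (k ℕ.∸ m) → Lw (k ℕ.∸ m) (toZ μ) γ →
          GSpan (λ lam → m ℕ.< headℕ lam) (X i γ)
        terms {i} {γ} m<i i≤ l = GSpan-mono (λ h → ℤP.drop‿+<+ (ℤP.<-≤-trans m<i h))
          (Span-map (B-linear i) on-E (Span-cancel (Span-join (λ { (egen γ′ b g v) → gen (γ′ , b , v) })
            (Fr-E (map (k ℕ.∸_) μ) γ F)) (gen (γ , Fits-Bounded F , ≋-refl))))
          where
          F = Fits-Lw (all-Fits μ D m≤k) l
          i≤k : i ℤ.≤ + k
          i≤k = ℤP.≤-trans i≤ (ℤ.+≤+ (ℕP.≤-reflexive (ℕP.m+[n∸m]≡n m≤k)))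
          on-E : ∀ {x} → (∃ λ γ → Bounded γ × x ≋ E γ) → GSpan (HeadAbove i) (B i x)
          on-E (γ , b , v) = resp (B-cong i (≋-sym v)) (E-in-G (i ∷ γ) (all-Up _ _ refl) (i≤k ∷ b) ℤP.≤-refl)

-- Term lists up to equality of coefficients form a commutative ring

≤ᵇ-true : ∀ {x y} → x ℕ.≤ y → (x ≤ᵇ y) ≡ true
≤ᵇ-true {x} {y} p with x ≤ᵇ y | ℕP.≤⇒≤ᵇ p
... | true | _ = refl

≤ᵇ-false : ∀ {x y} → y ℕ.< x → (x ≤ᵇ y) ≡ false
≤ᵇ-false {x} {y} p with x ≤ᵇ y in eq
... | false = refl
... | true  = ⊥-elim (ℕP.<⇒≱ p (ℕP.≤ᵇ⇒≤ x y (≡.subst T (≡.sym eq) _)))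

-- Holds for unsorted lists too: insertℕ x puts x in front of the first entry that is at least x.
insert-comm : ∀ x y l → insertℕ x (insertℕ y l) ≡ insertℕ y (insertℕ x l)
insert-comm x y l = Sum.reduce (Sum.map (ordered x y l) (λ p → ≡.sym (ordered y x l p)) (ℕP.≤-total x y))
  where
  front : ∀ {x y} l → x ℕ.≤ y → insertℕ x (y ∷ l) ≡ x ∷ y ∷ l
  front {x} {y} l p rewrite ≤ᵇ-true p = refl
  back : ∀ {x y} l → y ℕ.< x → insertℕ x (y ∷ l) ≡ y ∷ insertℕ x l
  back {x} {y} l p rewrite ≤ᵇ-false p = refl
  ordered : ∀ x y l → x ℕ.≤ y → insertℕ x (insertℕ y l) ≡ insertℕ y (insertℕ x l)
  ordered x y [] p with ℕP.m≤n⇒m<n∨m≡n p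
  ... | inj₂ refl = refl
  ... | inj₁ q    = ≡.trans (front [] p) (≡.sym (back [] q))
  ordered x y (z ∷ l) p with ℕP.m≤n⇒m<n∨m≡n p
  ... | inj₂ refl = refl
  ... | inj₁ q with ℕP.≤-<-connex y z | ℕP.≤-<-connex x z
  ... | inj₁ y≤z | _        = ≡.trans (≡.cong (insertℕ x) (front l y≤z)) (≡.trans (front (z ∷ l) p)
        (≡.sym (≡.trans (≡.cong (insertℕ y) (front l (ℕP.≤-trans p y≤z)))
          (≡.trans (back (z ∷ l) q) (≡.cong (x ∷_) (front l y≤z))))))
  ... | inj₂ z<y | inj₁ x≤z = ≡.trans (≡.cong (insertℕ x) (back l z<y)) (≡.trans (front _ x≤z)
        (≡.sym (≡.trans (≡.cong (insertℕ y) (front l x≤z)) (≡.trans (back (z ∷ l) q) (≡.cong (x ∷_) (back l z<y))))))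
  ... | inj₂ z<y | inj₂ z<x = ≡.trans (≡.cong (insertℕ x) (back l z<y)) (≡.trans (back _ z<x)
        (≡.trans (≡.cong (z ∷_) (ordered x y l p))
        (≡.sym (≡.trans (≡.cong (insertℕ y) (back l z<x)) (back _ z<y)))))

insertAll : List ℕ → List ℕ → List ℕ
insertAll hs l = foldr insertℕ l hs

insertAll-insert : ∀ hs x l → insertAll hs (insertℕ x l) ≡ insertℕ x (insertAll hs l)
insertAll-insert []       x l = refl
insertAll-insert (y ∷ hs) x l = ≡.trans (≡.cong (insertℕ y) (insertAll-insert hs x l)) (insert-comm y x (insertAll hs l))

insertAll-insertℕ : ∀ x hs l → insertAll (insertℕ x hs) l ≡ insertℕ x (insertAll hs l)
insertAll-insertℕ x []       l = refl
insertAll-insertℕ x (y ∷ hs) l with x ≤ᵇ y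
... | true  = refl
... | false = ≡.trans (≡.cong (insertℕ y) (insertAll-insertℕ x hs l)) (insert-comm y x (insertAll hs l))

insertAll-sort : ∀ hs l → insertAll (sortℕ hs) l ≡ insertAll hs l
insertAll-sort []       l = refl
insertAll-sort (x ∷ hs) l = ≡.trans (insertAll-insertℕ x (sortℕ hs) l) (≡.cong (insertℕ x) (insertAll-sort hs l))

sort-sort : ∀ hs → sortℕ (sortℕ hs) ≡ sortℕ hs
sort-sort hs = insertAll-sort hs []

sort-++ : ∀ hs ks → sortℕ (hs ++ ks) ≡ insertAll hs (sortℕ ks)
sort-++ []       ks = refl
sort-++ (x ∷ hs) ks = ≡.cong (insertℕ x) (sort-++ hs ks)

sort-++-sortˡ : ∀ hs ks → sortℕ (sortℕ hs ++ ks) ≡ sortℕ (hs ++ ks)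
sort-++-sortˡ hs ks = ≡.trans (sort-++ (sortℕ hs) ks) (≡.trans (insertAll-sort hs _) (≡.sym (sort-++ hs ks)))

sort-++-sortʳ : ∀ hs ks → sortℕ (hs ++ sortℕ ks) ≡ sortℕ (hs ++ ks)
sort-++-sortʳ hs ks = ≡.trans (sort-++ hs (sortℕ ks)) (≡.trans (≡.cong (insertAll hs) (sort-sort ks)) (≡.sym (sort-++ hs ks)))

sort-++-comm : ∀ hs ks → sortℕ (hs ++ ks) ≡ sortℕ (ks ++ hs)
sort-++-comm []       ks = ≡.cong sortℕ (≡.sym (++-identityʳ ks))
sort-++-comm (x ∷ hs) ks = ≡.trans (≡.cong (insertℕ x) (sort-++-comm hs ks)) (≡.sym (≡.trans (sort-++ ks (x ∷ hs))
  (≡.trans (insertAll-insert ks x (sortℕ hs)) (≡.cong (insertℕ x) (≡.sym (sort-++ ks hs))))))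

record SameKey (m : ℕ) (hs : List ℕ) (n : ℕ) (ms : List ℕ) : Set where
  constructor _,_
  field
    t-exponent : m ≡ n
    h-indices  : sortℕ hs ≡ sortℕ ms

sameKey : ℕ → List ℕ → ℕ → List ℕ → Bool
sameKey m hs n ms = (m ≡ᵇ n) ∧ ⌊ ≡-dec ℕ._≟_ (sortℕ hs) (sortℕ ms) ⌋

data SameKeyView (m : ℕ) (hs : List ℕ) (n : ℕ) (ms : List ℕ) : Bool → Set where
  same : SameKey m hs n ms → SameKeyView m hs n ms true
  diff : ¬ SameKey m hs n ms → SameKeyView m hs n ms false

sameKey-view : ∀ m hs n ms → SameKeyView m hs n ms (sameKey m hs n ms)
sameKey-view m hs n ms with m ≡ᵇ n in eq | ≡-dec ℕ._≟_ (sortℕ hs) (sortℕ ms)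
... | true  | yes p = same (ℕP.≡ᵇ⇒≡ m n (≡.subst T (≡.sym eq) _) , p)
... | true  | no ¬p = diff λ { (_ , q) → ¬p q }
... | false | yes p = diff λ { (q , _) → ≡.subst T eq (ℕP.≡⇒≡ᵇ m n q) }
... | false | no ¬p = diff λ { (_ , q) → ¬p q }

sameKey-cong : ∀ m hs m′ hs′ n ms n′ ms′ → SameKey m hs m′ hs′ → SameKey n ms n′ ms′ →
               sameKey m hs n ms ≡ sameKey m′ hs′ n′ ms′
sameKey-cong m hs _ hs′ n ms _ ms′ (refl , p) (refl , q) = ≡.cong₂ (λ u v → _ ∧ ⌊ ≡-dec ℕ._≟_ u v ⌋) p q

coeff-++ : ∀ p q n ms → coeff (p ++ q) n ms ≡ coeff p n ms ℤ.+ coeff q n ms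
coeff-++ []                   q n ms = ≡.sym (ℤP.+-identityˡ _)
coeff-++ ((c , (m , hs)) ∷ p) q n ms =
  ≡.trans (≡.cong (λ z → (if sameKey m hs n ms then c else + 0) ℤ.+ z) (coeff-++ p q n ms))
    (≡.sym (ℤP.+-assoc (if sameKey m hs n ms then c else + 0) (coeff p n ms) (coeff q n ms)))

coeff-neg : ∀ p n ms → coeff (negP p) n ms ≡ ℤ.- coeff p n ms
coeff-neg []                   n ms = refl
coeff-neg ((c , (m , hs)) ∷ p) n ms with sameKey m hs n ms
... | true  = ≡.trans (≡.cong (λ z → ℤ.- c ℤ.+ z) (coeff-neg p n ms)) (≡.sym (ℤP.neg-distrib-+ c _))
... | false = ≡.trans (≡.cong (λ z → + 0 ℤ.+ z) (coeff-neg p n ms)) (≡.sym (ℤP.neg-distrib-+ (+ 0) (coeff p n ms)))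

-- The linear extension of `g` from monomials to term lists. Coefficients of products and of
-- adjoints have this form, which is how these operations are shown to respect `≈`.
pairing : (ℕ → List ℕ → ℤ) → Poly → ℤ
pairing g []                   = + 0
pairing g ((c , (n , hs)) ∷ p) = c ℤ.* g n hs ℤ.+ pairing g p

private
  without : ℕ → List ℕ → Poly → Poly
  without n ms []                   = []
  without n ms ((c , (m , hs)) ∷ p) =
    if sameKey m hs n ms then without n ms p else (c , (m , hs)) ∷ without n ms p

  without-length : ∀ n ms p → length (without n ms p) ℕ.≤ length p
  without-length n ms []                   = ℕ.z≤n
  without-length n ms ((c , (m , hs)) ∷ p) with sameKey m hs n ms
  ... | true  = ℕP.≤-trans (without-length n ms p) (ℕP.n≤1+n _)
  ... | false = ℕ.s≤s (without-length n ms p)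

  pairing-without : ∀ g n ms p → (∀ {m hs m′ hs′} → SameKey m hs m′ hs′ → g m hs ≡ g m′ hs′) →
    pairing g p ≡ coeff p n ms ℤ.* g n ms ℤ.+ pairing g (without n ms p)
  pairing-without g n ms []                   e = refl
  pairing-without g n ms ((c , (m , hs)) ∷ p) e with sameKey m hs n ms | sameKey-view m hs n ms
  ... | _ | same s = ≡.trans (≡.cong₂ (λ u v → c ℤ.* u ℤ.+ v) (e s) (pairing-without g n ms p e))
                             (lemma c (coeff p n ms) (g n ms) _)
    where lemma : ∀ c d g z → c ℤ.* g ℤ.+ (d ℤ.* g ℤ.+ z) ≡ (c ℤ.+ d) ℤ.* g ℤ.+ z
          lemma = solve-∀
  ... | _ | diff _ = ≡.trans (≡.cong (λ v → c ℤ.* g m hs ℤ.+ v) (pairing-without g n ms p e))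
                             (lemma (c ℤ.* g m hs) (coeff p n ms) (g n ms) _)
    where lemma : ∀ c d g z → c ℤ.+ (d ℤ.* g ℤ.+ z) ≡ (+ 0 ℤ.+ d) ℤ.* g ℤ.+ (c ℤ.+ z)
          lemma = solve-∀

  coeff-without-same : ∀ n ms p n′ ms′ → SameKey n ms n′ ms′ → coeff (without n ms p) n′ ms′ ≡ + 0
  coeff-without-same n ms []                   n′ ms′ s = refl
  coeff-without-same n ms ((c , (m , hs)) ∷ p) n′ ms′ s with sameKey m hs n ms in eq
  ... | true  = coeff-without-same n ms p n′ ms′ s
  ... | false = ≡.cong₂ (λ b z → (if b then c else + 0) ℤ.+ z)
    (≡.trans (≡.sym (sameKey-cong m hs m hs n ms n′ ms′ (refl , refl) s)) eq) (coeff-without-same n ms p n′ ms′ s)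

  coeff-without-diff : ∀ n ms p n′ ms′ → ¬ SameKey n ms n′ ms′ → coeff (without n ms p) n′ ms′ ≡ coeff p n′ ms′
  coeff-without-diff n ms []                   n′ ms′ ¬s = refl
  coeff-without-diff n ms ((c , (m , hs)) ∷ p) n′ ms′ ¬s with sameKey m hs n ms | sameKey-view m hs n ms
  ... | _ | diff _ = ≡.cong (λ z → (if sameKey m hs n′ ms′ then c else + 0) ℤ.+ z) (coeff-without-diff n ms p n′ ms′ ¬s)
  ... | _ | same (refl , e) with sameKey m hs n′ ms′ | sameKey-view m hs n′ ms′
  ... | _ | same (e′ , e″) = ⊥-elim (¬s (e′ , ≡.trans (≡.sym e) e″))
  ... | _ | diff _         = ≡.trans (coeff-without-diff n ms p n′ ms′ ¬s) (≡.sym (ℤP.+-identityˡ _))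

  -- Terms with the same key cancel only jointly, wherever they stand in the list: all terms with
  -- the key of the first one are removed together, and the list becomes shorter.
  pairing-zero : ∀ l g p → length p ℕ.≤ l → (∀ {m hs m′ hs′} → SameKey m hs m′ hs′ → g m hs ≡ g m′ hs′) →
    (∀ n ms → coeff p n ms ≡ + 0) → pairing g p ≡ + 0
  pairing-zero l       g []                     le         e z = refl
  pairing-zero (suc l) g p@((c , (n , ms)) ∷ p′) (ℕ.s≤s le) e z = begin
    pairing g p
      ≡⟨ pairing-without g n ms p e ⟩
    coeff p n ms ℤ.* g n ms ℤ.+ pairing g (without n ms p)
      ≡⟨ ≡.cong₂ (λ u v → u ℤ.* g n ms ℤ.+ v) (z n ms)
           (pairing-zero l g (without n ms p) shorter e vanish) ⟩
    + 0 ∎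
    where
    open ≡.≡-Reasoning
    shorter : length (without n ms p) ℕ.≤ l
    shorter with sameKey n ms n ms | sameKey-view n ms n ms
    ... | _ | same _  = ℕP.≤-trans (without-length n ms p′) le
    ... | _ | diff ¬s = ⊥-elim (¬s (refl , refl))
    vanish : ∀ n′ ms′ → coeff (without n ms p) n′ ms′ ≡ + 0
    vanish n′ ms′ with sameKey n ms n′ ms′ | sameKey-view n ms n′ ms′
    ... | _ | same s  = coeff-without-same n ms p n′ ms′ s
    ... | _ | diff ¬s = ≡.trans (coeff-without-diff n ms p n′ ms′ ¬s) (z n′ ms′)

pairing-++ : ∀ g p q → pairing g (p ++ q) ≡ pairing g p ℤ.+ pairing g q
pairing-++ g []                   q = ≡.sym (ℤP.+-identityˡ _)
pairing-++ g ((c , (n , hs)) ∷ p) q =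
  ≡.trans (≡.cong (λ z → c ℤ.* g n hs ℤ.+ z) (pairing-++ g p q)) (≡.sym (ℤP.+-assoc (c ℤ.* g n hs) (pairing g p) (pairing g q)))

pairing-neg : ∀ g p → pairing g (negP p) ≡ ℤ.- pairing g p
pairing-neg g []                   = refl
pairing-neg g ((c , (n , hs)) ∷ p) =
  ≡.trans (≡.cong (λ z → ℤ.- c ℤ.* g n hs ℤ.+ z) (pairing-neg g p)) (lemma c (g n hs) _)
  where lemma : ∀ c g z → ℤ.- c ℤ.* g ℤ.+ ℤ.- z ≡ ℤ.- (c ℤ.* g ℤ.+ z)
        lemma = solve-∀

pairing-cong : ∀ g {p q} → (∀ {m hs m′ hs′} → SameKey m hs m′ hs′ → g m hs ≡ g m′ hs′) →
               p ≈ q → pairing g p ≡ pairing g q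
pairing-cong g {p} {q} e p≈q = ℤP.i-j≡0⇒i≡j _ _ (begin
  pairing g p ℤ.- pairing g q          ≡⟨ ≡.cong (λ z → pairing g p ℤ.+ z) (pairing-neg g q) ⟨
  pairing g p ℤ.+ pairing g (negP q)   ≡⟨ pairing-++ g p (negP q) ⟨
  pairing g (p -P q)                   ≡⟨ pairing-zero _ g (p -P q) ℕP.≤-refl e
    (λ n ms → ≡.trans (coeff-++ p (negP q) n ms) (≡.trans (≡.cong₂ ℤ._+_ (p≈q n ms) (coeff-neg q n ms)) (ℤP.+-inverseʳ (coeff q n ms)))) ⟩
  + 0 ∎)
  where open ≡.≡-Reasoning

-- A record version of ≈, from which the two polynomials can be inferred.
infix 4 _≃_
record _≃_ (p q : Poly) : Set where
  constructor mk
  field at : p ≈ q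
open _≃_ public

≃-refl : ∀ {p} → p ≃ p
≃-refl = mk λ n ms → refl

≃-sym : ∀ {p q} → p ≃ q → q ≃ p
≃-sym e = mk λ n ms → ≡.sym (at e n ms)

≃-trans : ∀ {p q r} → p ≃ q → q ≃ r → p ≃ r
≃-trans e f = mk λ n ms → ≡.trans (at e n ms) (at f n ms)

≃-reflexive : ∀ {p q} → p ≡ q → p ≃ q
≃-reflexive refl = ≃-refl

≃-setoid : Setoid 0ℓ 0ℓ
≃-setoid = record { Carrier = Poly ; _≈_ = _≃_
  ; isEquivalence = record { refl = ≃-refl ; sym = ≃-sym ; trans = ≃-trans } }

module ≃-Reasoning = Relation.Binary.Reasoning.Setoid ≃-setoid

+P-cong : ∀ {p p′ q q′} → p ≃ p′ → q ≃ q′ → p +P q ≃ p′ +P q′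
+P-cong {p} {p′} {q} {q′} e f = mk λ n ms →
  ≡.trans (coeff-++ p q n ms) (≡.trans (≡.cong₂ ℤ._+_ (at e n ms) (at f n ms)) (≡.sym (coeff-++ p′ q′ n ms)))

+P-comm : ∀ p q → p +P q ≃ q +P p
+P-comm p q = mk λ n ms → ≡.trans (coeff-++ p q n ms) (≡.trans (ℤP.+-comm (coeff p n ms) _) (≡.sym (coeff-++ q p n ms)))

+P-identityʳ : ∀ p → p +P 0P ≃ p
+P-identityʳ p = ≃-reflexive (++-identityʳ p)

negP-cong : ∀ {p q} → p ≃ q → negP p ≃ negP q
negP-cong {p} {q} e = mk λ n ms →
  ≡.trans (coeff-neg p n ms) (≡.trans (≡.cong ℤ.-_ (at e n ms)) (≡.sym (coeff-neg q n ms)))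

negP-inverseʳ : ∀ p → p +P negP p ≃ 0P
negP-inverseʳ p = mk λ n ms → ≡.trans (coeff-++ p (negP p) n ms)
  (≡.trans (≡.cong (λ z → coeff p n ms ℤ.+ z) (coeff-neg p n ms)) (ℤP.+-inverseʳ (coeff p n ms)))

mono : ℤ → ℕ → List ℕ → Poly
mono c n hs = (c , (n , hs)) ∷ []

∷-cong : ∀ c {n hs n′ hs′ p p′} → SameKey n hs n′ hs′ → p ≃ p′ → (c , (n , hs)) ∷ p ≃ (c , (n′ , hs′)) ∷ p′
∷-cong c {m} {hs} {m′} {hs′} s e = mk λ n ms →
  ≡.cong₂ (λ b z → (if b then c else + 0) ℤ.+ z) (sameKey-cong m hs m′ hs′ n ms n ms s (refl , refl)) (at e n ms)

mono-key : ∀ c {n hs n′ hs′} → SameKey n hs n′ hs′ → mono c n hs ≃ mono c n′ hs′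
mono-key c s = ∷-cong c s ≃-refl

*P-∷ : ∀ x p q → (x ∷ p) *P q ≡ (x ∷ []) *P q +P p *P q
*P-∷ x p q = ≡.cong (_++ p *P q) (≡.sym (++-identityʳ _))

*P-distribʳ : ∀ r p q → (p +P q) *P r ≡ p *P r +P q *P r
*P-distribʳ r []      q = refl
*P-distribʳ r (x ∷ p) q = begin
  (x ∷ p +P q) *P r                        ≡⟨ *P-∷ x (p +P q) r ⟩
  (x ∷ []) *P r +P (p +P q) *P r           ≡⟨ ≡.cong ((x ∷ []) *P r +P_) (*P-distribʳ r p q) ⟩
  (x ∷ []) *P r +P (p *P r +P q *P r)      ≡⟨ ++-assoc ((x ∷ []) *P r) (p *P r) (q *P r) ⟨
  ((x ∷ []) *P r +P p *P r) +P q *P r      ≡⟨ ≡.cong (_+P q *P r) (*P-∷ x p r) ⟨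
  (x ∷ p) *P r +P q *P r ∎
  where open ≡.≡-Reasoning

coeff-mono-*P : ∀ c n hs q k ms → coeff (mono c n hs *P q) k ms ≡ c ℤ.* coeff (mono (+ 1) n hs *P q) k ms
coeff-mono-*P c n hs []                   k ms = ≡.sym (ℤP.*-zeroʳ c)
coeff-mono-*P c n hs ((d , (m , ks)) ∷ q) k ms with sameKey (n ℕ.+ m) (sortℕ (hs ++ ks)) k ms
... | true  = ≡.trans (≡.cong (λ z → c ℤ.* d ℤ.+ z) (coeff-mono-*P c n hs q k ms)) (lemma c d _)
  where lemma : ∀ c d z → c ℤ.* d ℤ.+ c ℤ.* z ≡ c ℤ.* (+ 1 ℤ.* d ℤ.+ z)
        lemma = solve-∀
... | false = ≡.trans (≡.cong (λ z → + 0 ℤ.+ z) (coeff-mono-*P c n hs q k ms)) (lemma c _)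
  where lemma : ∀ c z → + 0 ℤ.+ c ℤ.* z ≡ c ℤ.* (+ 0 ℤ.+ z)
        lemma = solve-∀

coeff-*P : ∀ p q k ms → coeff (p *P q) k ms ≡ pairing (λ n hs → coeff (mono (+ 1) n hs *P q) k ms) p
coeff-*P []                   q k ms = refl
coeff-*P ((c , (n , hs)) ∷ p) q k ms = begin
  coeff (((c , (n , hs)) ∷ p) *P q) k ms
    ≡⟨ ≡.cong (λ r → coeff r k ms) (*P-∷ (c , (n , hs)) p q) ⟩
  coeff (mono c n hs *P q +P p *P q) k ms
    ≡⟨ coeff-++ (mono c n hs *P q) (p *P q) k ms ⟩
  coeff (mono c n hs *P q) k ms ℤ.+ coeff (p *P q) k ms
    ≡⟨ ≡.cong₂ ℤ._+_ (coeff-mono-*P c n hs q k ms) (coeff-*P p q k ms) ⟩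
  _ ∎
  where open ≡.≡-Reasoning

mono-*P-key : ∀ c {n hs n′ hs′} q → SameKey n hs n′ hs′ → mono c n hs *P q ≃ mono c n′ hs′ *P q
mono-*P-key c []                                      s              = ≃-refl
mono-*P-key c {n} {hs} {_} {hs′} ((d , (m , ks)) ∷ q) s@(refl , e) = ∷-cong (c ℤ.* d)
  (refl , ≡.cong sortℕ (≡.trans (≡.sym (sort-++-sortˡ hs ks))
    (≡.trans (≡.cong (λ l → sortℕ (l ++ ks)) e) (sort-++-sortˡ hs′ ks))))
  (mono-*P-key c q s)

*P-congʳ : ∀ q {p p′} → p ≃ p′ → p *P q ≃ p′ *P q
*P-congʳ q {p} {p′} e = mk λ k ms → ≡.trans (coeff-*P p q k ms) (≡.trans
  (pairing-cong (λ n hs → coeff (mono (+ 1) n hs *P q) k ms) {p} {p′} (λ s → at (mono-*P-key (+ 1) q s) k ms) (at e))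
  (≡.sym (coeff-*P p′ q k ms)))

+P-interchange : ∀ a b c d → (a +P b) +P (c +P d) ≃ (a +P c) +P (b +P d)
+P-interchange a b c d = mk λ n ms → ≡.trans (expand a b c d n ms)
  (≡.trans (lemma (coeff a n ms) (coeff b n ms) (coeff c n ms) (coeff d n ms)) (≡.sym (expand a c b d n ms)))
  where
  expand : ∀ a b c d n ms → coeff ((a +P b) +P (c +P d)) n ms ≡
    (coeff a n ms ℤ.+ coeff b n ms) ℤ.+ (coeff c n ms ℤ.+ coeff d n ms)
  expand a b c d n ms = ≡.trans (coeff-++ (a ++ b) (c ++ d) n ms) (≡.cong₂ ℤ._+_ (coeff-++ a b n ms) (coeff-++ c d n ms))
  lemma : ∀ a b c d → (a ℤ.+ b) ℤ.+ (c ℤ.+ d) ≡ (a ℤ.+ c) ℤ.+ (b ℤ.+ d)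
  lemma = solve-∀

*P-zeroʳ : ∀ p → p *P 0P ≃ 0P
*P-zeroʳ []      = ≃-refl
*P-zeroʳ (x ∷ p) = *P-zeroʳ p

mono-*P-distribˡ : ∀ c n hs q r → mono c n hs *P (q +P r) ≡ mono c n hs *P q +P mono c n hs *P r
mono-*P-distribˡ c n hs []                   r = refl
mono-*P-distribˡ c n hs ((d , (m , ks)) ∷ q) r = ≡.cong (_ ∷_) (mono-*P-distribˡ c n hs q r)

*P-distribˡ : ∀ p q r → p *P (q +P r) ≃ p *P q +P p *P r
*P-distribˡ []                     q r = ≃-refl
*P-distribˡ (x@(c , (n , hs)) ∷ p) q r = begin
  (x ∷ p) *P (q +P r)                                   ≡⟨ *P-∷ x p (q +P r) ⟩
  (x ∷ []) *P (q +P r) +P p *P (q +P r)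
    ≈⟨ +P-cong (≃-reflexive (mono-*P-distribˡ c n hs q r)) (*P-distribˡ p q r) ⟩
  ((x ∷ []) *P q +P (x ∷ []) *P r) +P (p *P q +P p *P r)
    ≈⟨ +P-interchange ((x ∷ []) *P q) ((x ∷ []) *P r) (p *P q) (p *P r) ⟩
  ((x ∷ []) *P q +P p *P q) +P ((x ∷ []) *P r +P p *P r)
    ≡⟨ ≡.cong₂ _+P_ (*P-∷ x p q) (*P-∷ x p r) ⟨
  (x ∷ p) *P q +P (x ∷ p) *P r ∎
  where open ≃-Reasoning

mono-*P-comm : ∀ c n hs q → mono c n hs *P q ≃ q *P mono c n hs
mono-*P-comm c n hs []                     = ≃-refl
mono-*P-comm c n hs (y@(d , (m , ks)) ∷ q) = ≃-trans
  (≃-reflexive (≡.cong (λ z → (z , (n ℕ.+ m , sortℕ (hs ++ ks))) ∷ mono c n hs *P q) (ℤP.*-comm c d)))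
  (∷-cong (d ℤ.* c) (ℕP.+-comm n m , ≡.cong sortℕ (sort-++-comm hs ks)) (mono-*P-comm c n hs q))

*P-comm : ∀ p q → p *P q ≃ q *P p
*P-comm []                     q = ≃-sym (*P-zeroʳ q)
*P-comm (x@(c , (n , hs)) ∷ p) q = begin
  (x ∷ p) *P q               ≡⟨ *P-∷ x p q ⟩
  (x ∷ []) *P q +P p *P q    ≈⟨ +P-cong (mono-*P-comm c n hs q) (*P-comm p q) ⟩
  q *P (x ∷ []) +P q *P p    ≈⟨ *P-distribˡ q (x ∷ []) p ⟨
  q *P (x ∷ p) ∎
  where open ≃-Reasoning

*P-cong : ∀ {p p′ q q′} → p ≃ p′ → q ≃ q′ → p *P q ≃ p′ *P q′
*P-cong {p} {p′} {q} {q′} e f = begin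
  p *P q     ≈⟨ *P-congʳ q e ⟩
  p′ *P q    ≈⟨ *P-comm p′ q ⟩
  q *P p′    ≈⟨ *P-congʳ p′ f ⟩
  q′ *P p′   ≈⟨ *P-comm q′ p′ ⟩
  p′ *P q′ ∎
  where open ≃-Reasoning

private
  mono-mono-assoc : ∀ c n hs d m ks r → (mono c n hs *P mono d m ks) *P r ≃ mono c n hs *P (mono d m ks *P r)
  mono-mono-assoc c n hs d m ks []                     = ≃-refl
  mono-mono-assoc c n hs d m ks (z@(f , (l , ls)) ∷ r) = ≃-trans
    (≃-reflexive (≡.cong (λ z → (z , (n ℕ.+ m ℕ.+ l , sortℕ (sortℕ (hs ++ ks) ++ ls))) ∷ (mono c n hs *P mono d m ks) *P r)
      (ℤP.*-assoc c d f)))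
    (∷-cong (c ℤ.* (d ℤ.* f)) (ℕP.+-assoc n m l , ≡.cong sortℕ
        (≡.trans (sort-++-sortˡ (hs ++ ks) ls) (≡.trans (≡.cong sortℕ (++-assoc hs ks ls)) (≡.sym (sort-++-sortʳ hs (ks ++ ls))))))
      (mono-mono-assoc c n hs d m ks r))

  mono-assoc : ∀ c n hs q r → (mono c n hs *P q) *P r ≃ mono c n hs *P (q *P r)
  mono-assoc c n hs []                     r = ≃-refl
  mono-assoc c n hs (y@(d , (m , ks)) ∷ q) r = begin
    (mono c n hs *P (y ∷ q)) *P r
      ≡⟨ *P-∷ (c ℤ.* d , (n ℕ.+ m , sortℕ (hs ++ ks))) (mono c n hs *P q) r ⟩
    (mono c n hs *P mono d m ks) *P r +P (mono c n hs *P q) *P r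
      ≈⟨ +P-cong (mono-mono-assoc c n hs d m ks r) (mono-assoc c n hs q r) ⟩
    mono c n hs *P (mono d m ks *P r) +P mono c n hs *P (q *P r)
      ≡⟨ mono-*P-distribˡ c n hs (mono d m ks *P r) (q *P r) ⟨
    mono c n hs *P (mono d m ks *P r +P q *P r)
      ≡⟨ ≡.cong (mono c n hs *P_) (*P-∷ y q r) ⟨
    mono c n hs *P ((y ∷ q) *P r) ∎
    where open ≃-Reasoning

*P-assoc : ∀ p q r → (p *P q) *P r ≃ p *P (q *P r)
*P-assoc []                     q r = ≃-refl
*P-assoc (x@(c , (n , hs)) ∷ p) q r = begin
  ((x ∷ p) *P q) *P r                      ≡⟨ ≡.cong (_*P r) (*P-∷ x p q) ⟩
  ((x ∷ []) *P q +P p *P q) *P r           ≡⟨ *P-distribʳ r ((x ∷ []) *P q) (p *P q) ⟩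
  ((x ∷ []) *P q) *P r +P (p *P q) *P r
    ≈⟨ +P-cong (mono-assoc c n hs q r) (*P-assoc p q r) ⟩
  (x ∷ []) *P (q *P r) +P p *P (q *P r)    ≡⟨ *P-∷ x p (q *P r) ⟨
  (x ∷ p) *P (q *P r) ∎
  where open ≃-Reasoning

*P-identityˡ : ∀ p → 1P *P p ≃ p
*P-identityˡ []                     = ≃-refl
*P-identityˡ (y@(d , (m , ks)) ∷ p) = ≃-trans
  (≃-reflexive (≡.cong (λ z → (z , (m , sortℕ ks)) ∷ 1P *P p) (ℤP.*-identityˡ d)))
  (∷-cong d (refl , sort-sort ks) (*P-identityˡ p))

polyRing : CommutativeRing 0ℓ 0ℓ
polyRing = record
  { Carrier = Poly ; _≈_ = _≃_ ; _+_ = _+P_ ; _*_ = _*P_ ; -_ = negP ; 0# = 0P ; 1# = 1P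
  ; isCommutativeRing = record
    { isRing = record
      { +-isAbelianGroup = record
        { isGroup = record
          { isMonoid = record
            { isSemigroup = record
              { isMagma = record
                { isEquivalence = Setoid.isEquivalence ≃-setoid
                ; ∙-cong = +P-cong }
              ; assoc = λ p q r → ≃-reflexive (++-assoc p q r) }
            ; identity = (λ p → ≃-refl) , +P-identityʳ }
          ; inverse = (λ p → ≃-trans (+P-comm (negP p) p) (negP-inverseʳ p)) , negP-inverseʳ
          ; ⁻¹-cong = negP-cong }
        ; comm = +P-comm }
      ; *-cong = *P-cong
      ; *-assoc = *P-assoc
      ; *-identity = *P-identityˡ , (λ p → ≃-trans (*P-comm p 1P) (*P-identityˡ p))
      ; distrib = *P-distribˡ , (λ r p q → ≃-reflexive (*P-distribʳ r p q)) }
    ; *-comm = *P-comm } }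

-- The Jacobi-Trudi determinant as a product of factors 1 - R

seqℤ : ℤ → ℕ → List ℤ
seqℤ a zero    = []
seqℤ a (suc n) = a ∷ seqℤ (ℤ.suc a) n

length-seqℤ : ∀ a n → length (seqℤ a n) ≡ n
length-seqℤ a zero    = refl
length-seqℤ a (suc n) = ≡.cong suc (length-seqℤ (ℤ.suc a) n)

module RingLaws (R : CommutativeRing 0ℓ 0ℓ) where

  open CommutativeRing R public hiding (zero)
    renaming (_≈_ to _~_; refl to ~refl; sym to ~sym; trans to ~trans; reflexive to ~reflexive)
  open import Algebra.Properties.Ring ring public using (-0#≈0#; -‿distribˡ-*; -‿distribʳ-*; -‿+-comm)
  open Algebra.Properties.CommutativeSemigroup +-commutativeSemigroup public
    using () renaming (interchange to +-interchange)
  module ≈R-Reasoning = Relation.Binary.Reasoning.Setoid setoid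

  *-swap : ∀ a b c → a * (b * c) ~ b * (a * c)
  *-swap a b c = ~trans (~sym (*-assoc a b c)) (~trans (*-congʳ (*-comm a b)) (*-assoc b a c))

module Determinants (R : CommutativeRing 0ℓ 0ℓ) (h : ℤ → CommutativeRing.Carrier R) where

  open RingLaws R public

  -- The case t = 1, with multiplication by h_m as operators: `U.Fr 1#` is a product of factors 1 -
  -- R applied to h_γ.
  module U where
    open Rows +-abelianGroup (λ x → x) (λ e → e) (λ _ _ → ~refl) public
    h-linear : ∀ m → Linear (h m *_)
    h-linear m = record { additive = record { cong = *-congˡ ; ⊕-hom = distribˡ (h m) } ; t-hom = λ _ → ~refl }
    open Ops (λ m → h m *_) h-linear public

  scale-linear : ∀ x → U.Linear (x *_)
  scale-linear x = record { additive = record { cong = *-congˡ ; ⊕-hom = distribˡ x } ; t-hom = λ _ → ~refl }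

  Lap : (ℤ → List ℤ → Carrier) → List ℤ → Carrier
  Lap Ψ []       = 0#
  Lap Ψ (c ∷ cs) = Ψ c cs - Lap (λ c′ cs′ → Ψ c′ (c ∷ cs′)) cs

  -- Columns are arbitrary integers rather than positions, so that they can be lowered like rows;
  -- `o` is the number of the first row.
  det : List ℤ → ℤ → List ℤ → Carrier
  det []      o cs = 1#
  det (g ∷ γ) o cs = Lap (λ c cs′ → h (g ℤ.+ c ℤ.- o) * det γ (ℤ.suc o) cs′) cs

  Lap-cong-on : ∀ {Ψ Φ} cs → (∀ c cs′ → suc (length cs′) ≡ length cs → Ψ c cs′ ~ Φ c cs′) → Lap Ψ cs ~ Lap Φ cs
  Lap-cong-on []       e = ~refl
  Lap-cong-on (c ∷ cs) e = +-cong (e c cs refl)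
    (-‿cong (Lap-cong-on cs λ c′ cs′ l → e c′ (c ∷ cs′) (≡.cong suc l)))

  Lap-minus : ∀ Ψ Φ cs → Lap (λ c cs → Ψ c cs - Φ c cs) cs ~ Lap Ψ cs - Lap Φ cs
  Lap-minus Ψ Φ []       = ~sym (-‿inverseʳ 0#)
  Lap-minus Ψ Φ (c ∷ cs) = ~trans (+-congˡ (-‿cong (Lap-minus _ _ cs))) (U.⊖-medial _ _ _ _)

  Lap-linear : ∀ {φ} → U.Linear φ → ∀ Ψ cs → φ (Lap Ψ cs) ~ Lap (λ c cs → φ (Ψ c cs)) cs
  Lap-linear L Ψ []       = U.Linear.𝟘-hom L
  Lap-linear L Ψ (c ∷ cs) = ~trans (U.Linear-⊖ L _ _) (+-congˡ (-‿cong (Lap-linear L _ cs)))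

  Rw-Lap : ∀ n (Ψ : ℤ → List ℤ → ℤ → List ℤ → Carrier) m γ cs →
    U.Rw n (λ i γ → Lap (Ψ i γ) cs) m γ ~ Lap (λ c cs → U.Rw n (λ i γ → Ψ i γ c cs) m γ) cs
  Rw-Lap n Ψ m γ []       = U.Rw-𝟘 n m γ
  Rw-Lap n Ψ m γ (c ∷ cs) = ~trans (U.Rw-⊖ n _ _ m γ) (+-congˡ (-‿cong (Rw-Lap n _ m γ cs)))

  -- Expanding along column `c` takes `c` out of the list, so its factor 1 - R is written out as two
  -- terms, while the other factors act on the remaining columns.
  Rw-columns : ∀ N (Ψ : ℤ → ℤ → List ℤ → Carrier) m cs → length cs ≡ suc N →
    U.Rw (suc N) (λ i cs → Lap (Ψ i) cs) m cs ~
    Lap (λ c cs → U.Rw N (λ i → Ψ i c) m cs - U.Rw N (λ i → Ψ i (ℤ.pred c)) (ℤ.suc m) cs) cs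
  Rw-columns zero    Ψ m (c ∷ []) e = ~trans (U.⊖-medial _ _ _ _) (+-congˡ (-‿cong (-‿inverseʳ 0#)))
  Rw-columns (suc N) Ψ m (c ∷ cs) e = begin
    _ ≈⟨ +-cong (U.Rw-⊖ (suc N) _ _ m cs) (-‿cong (U.Rw-⊖ (suc N) _ _ (ℤ.suc m) cs)) ⟩
    _ ≈⟨ U.⊖-medial _ _ _ _ ⟩
    _ ≈⟨ +-congˡ (-‿cong (+-cong (Rw-columns N (λ i c′ cs → Ψ i c′ (c ∷ cs)) m cs e′)
                                 (-‿cong (Rw-columns N (λ i c′ cs → Ψ i c′ (ℤ.pred c ∷ cs)) (ℤ.suc m) cs e′)))) ⟩
    _ ≈⟨ +-congˡ (-‿cong (Lap-minus _ _ cs)) ⟨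
    _ ≈⟨ +-congˡ (-‿cong (Lap-cong-on cs λ c′ cs′ _ → U.⊖-medial _ _ _ _)) ⟩
    _ ∎
    where open ≈R-Reasoning
          e′ = ℕP.suc-injective e

  -- A matrix entry depends on `g` and `c` only through `g + c`, so lowering a row has the effect of
  -- lowering the column chosen for it. Taken over all rows and all columns, the products agree.
  rows-columns : ∀ (x : ℤ → Carrier) γ o m cs → length cs ≡ length γ →
    U.Rw (length γ) (λ i γ → x i * det γ o cs) m γ ~ U.Rw (length γ) (λ i cs → x i * det γ o cs) m cs
  rows-columns x []      o m []       e = ~refl
  rows-columns x (g ∷ γ) o m cs       e = begin
    U.Rw n (λ i γ → x i * det (g ∷ γ) o cs) m γ - U.Rw n (λ i γ → x i * det (ℤ.pred g ∷ γ) o cs) (ℤ.suc m) γ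
      ≈⟨ +-cong (expand g m) (-‿cong (expand (ℤ.pred g) (ℤ.suc m))) ⟩
    Lap (λ c cs → h (g ℤ.+ c ℤ.- o) * S m cs) cs - Lap (λ c cs → h (ℤ.pred g ℤ.+ c ℤ.- o) * S (ℤ.suc m) cs) cs
      ≈⟨ Lap-minus _ _ cs ⟨
    Lap (λ c cs → h (g ℤ.+ c ℤ.- o) * S m cs - h (ℤ.pred g ℤ.+ c ℤ.- o) * S (ℤ.suc m) cs) cs
      ≈⟨ Lap-cong-on cs (λ c cs′ _ → +-cong (U.Rw-linear (scale-linear _) n _ m cs′)
           (-‿cong (~trans (*-congʳ (~reflexive (≡.cong h (move g c o)))) (U.Rw-linear (scale-linear _) n _ (ℤ.suc m) cs′)))) ⟩
    Lap (λ c cs → U.Rw n (λ i cs → h (g ℤ.+ c ℤ.- o) * (x i * det γ (ℤ.suc o) cs)) m cs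
                - U.Rw n (λ i cs → h (g ℤ.+ ℤ.pred c ℤ.- o) * (x i * det γ (ℤ.suc o) cs)) (ℤ.suc m) cs) cs
      ≈⟨ Rw-columns n (λ i c cs → h (g ℤ.+ c ℤ.- o) * (x i * det γ (ℤ.suc o) cs)) m cs e ⟨
    U.Rw (suc n) (λ i cs → Lap (λ c cs → h (g ℤ.+ c ℤ.- o) * (x i * det γ (ℤ.suc o) cs)) cs) m cs
      ≈⟨ U.Rw-cong (suc n) m cs (λ i cs → ~trans (Lap-cong-on cs λ c cs′ _ → *-swap _ _ _) (~sym (Lap-linear (scale-linear (x i)) _ cs))) ⟩
    U.Rw (suc n) (λ i cs → x i * det (g ∷ γ) o cs) m cs ∎
    where
    open ≈R-Reasoning
    n = length γ
    S : ℤ → List ℤ → Carrier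
    S m cs = U.Rw n (λ i cs → x i * det γ (ℤ.suc o) cs) m cs
    move : ∀ g c o → ℤ.pred g ℤ.+ c ℤ.- o ≡ g ℤ.+ ℤ.pred c ℤ.- o
    move = lemma
      where lemma : ∀ g c o → -[1+ 0 ] ℤ.+ g ℤ.+ c ℤ.- o ≡ g ℤ.+ (-[1+ 0 ] ℤ.+ c) ℤ.- o
            lemma = ℤSolver.solve-∀
    expand : ∀ g m → U.Rw n (λ i γ → x i * det (g ∷ γ) o cs) m γ ~ Lap (λ c cs → h (g ℤ.+ c ℤ.- o) * S m cs) cs
    expand g m = begin
      U.Rw n (λ i γ → x i * det (g ∷ γ) o cs) m γ
        ≈⟨ U.Rw-cong n m γ (λ i γ → ~trans (Lap-linear (scale-linear (x i)) _ cs) (Lap-cong-on cs λ c cs′ _ → *-swap _ _ _)) ⟩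
      U.Rw n (λ i γ → Lap (λ c cs → h (g ℤ.+ c ℤ.- o) * (x i * det γ (ℤ.suc o) cs)) cs) m γ
        ≈⟨ Rw-Lap n _ m γ cs ⟩
      Lap (λ c cs → U.Rw n (λ i γ → h (g ℤ.+ c ℤ.- o) * (x i * det γ (ℤ.suc o) cs)) m γ) cs
        ≈⟨ Lap-cong-on cs (λ c cs′ l → ~trans (~sym (U.Rw-linear (scale-linear _) n _ m γ))
             (*-congˡ (rows-columns x γ (ℤ.suc o) m cs′ (ℕP.suc-injective (≡.trans l e))))) ⟩
      Lap (λ c cs → h (g ℤ.+ c ℤ.- o) * S m cs) cs ∎

  Vanishing : (List ℤ → Carrier) → ℕ → Set
  Vanishing X N = ∀ p c q → length (p ++ c ∷ c ∷ q) ≡ N → X (p ++ c ∷ c ∷ q) ~ 0#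

  Lap-𝟘 : ∀ cs → Lap (λ _ _ → 0#) cs ~ 0#
  Lap-𝟘 []       = ~refl
  Lap-𝟘 (c ∷ cs) = ~trans (+-congˡ (-‿cong (Lap-𝟘 cs))) (-‿inverseʳ 0#)

  Lap-vanishing : ∀ {N} Ψ → (∀ c → Vanishing (Ψ c) N) → Vanishing (Lap Ψ) (suc N)
  Lap-vanishing Ψ v []      c q e = begin
    Ψ c (c ∷ q) - (Ψ c (c ∷ q) - L) ≈⟨ +-congˡ (-‿cong (+-congˡ (-‿cong L≈0))) ⟩
    Ψ c (c ∷ q) - (Ψ c (c ∷ q) - 0#) ≈⟨ +-congˡ (-‿cong (~trans (+-congˡ -0#≈0#) (+-identityʳ _))) ⟩
    Ψ c (c ∷ q) - Ψ c (c ∷ q)        ≈⟨ -‿inverseʳ _ ⟩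
    0# ∎
    where
    open ≈R-Reasoning
    L = Lap (λ c′ cs′ → Ψ c′ (c ∷ c ∷ cs′)) q
    L≈0 : L ~ 0#
    L≈0 = ~trans (Lap-cong-on q λ c′ cs′ l → v c′ [] c cs′ (≡.trans (≡.cong suc l) (ℕP.suc-injective e))) (Lap-𝟘 q)
  Lap-vanishing {zero}  Ψ v (x ∷ [])    c q ()
  Lap-vanishing {zero}  Ψ v (x ∷ y ∷ p) c q ()
  Lap-vanishing {suc N} Ψ v (x ∷ p) c q e = begin
    Ψ x (p ++ c ∷ c ∷ q) - Lap (λ c′ cs′ → Ψ c′ (x ∷ cs′)) (p ++ c ∷ c ∷ q)
      ≈⟨ +-cong (v x p c q (ℕP.suc-injective e)) (-‿cong (Lap-vanishing {N} _
           (λ c′ p c q e → v c′ (x ∷ p) c q (≡.cong suc e)) p c q (ℕP.suc-injective e))) ⟩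
    0# - 0# ≈⟨ -‿inverseʳ 0# ⟩
    0# ∎
    where open ≈R-Reasoning

  det-vanishing : ∀ γ o → Vanishing (det γ o) (length γ)
  det-vanishing []      o []      c q ()
  det-vanishing []      o (x ∷ p) c q ()
  det-vanishing (g ∷ γ) o = Lap-vanishing _ λ c p c′ q e →
    ~trans (*-congˡ (det-vanishing γ (ℤ.suc o) p c′ q e)) (zeroʳ _)

  -- Lowering the column next to an unlowered one repeats that column and gives 0. Starting from the
  -- fixed `b`, no column can therefore be lowered.
  first-fixed : ∀ n (X : ℤ → List ℤ → Carrier) b m → (∀ i → Vanishing (X i) (suc n)) →
    U.Rw n (λ i cs → X i (b ∷ cs)) m (seqℤ (ℤ.suc b) n) ~ X m (b ∷ seqℤ (ℤ.suc b) n)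
  first-fixed zero    X b m v = ~refl
  first-fixed (suc n) X b m v = begin
    U.Rw n (λ i cs → X i (b ∷ ℤ.suc b ∷ cs)) m cs - U.Rw n (λ i cs → X i (b ∷ ℤ.pred (ℤ.suc b) ∷ cs)) (ℤ.suc m) cs
      ≈⟨ +-cong (first-fixed n (λ i cs → X i (b ∷ cs)) (ℤ.suc b) m λ i p c q e → v i (b ∷ p) c q (≡.cong suc e))
                (-‿cong (~trans (U.Rw-cong-on n (ℤ.suc m) cs λ i {cs′} l →
                   ~trans (~reflexive (≡.cong (λ z → X i (b ∷ z ∷ cs′)) (ℤP.pred-suc b)))
                         (v i [] b cs′ (≡.cong (λ l → suc (suc l)) (≡.trans (Lw-length l) (length-seqℤ _ n)))))
                   (U.Rw-𝟘 n _ cs))) ⟩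
    X m (b ∷ ℤ.suc b ∷ cs) - 0#
      ≈⟨ ~trans (+-congˡ -0#≈0#) (+-identityʳ _) ⟩
    X m (b ∷ ℤ.suc b ∷ cs) ∎
    where open ≈R-Reasoning
          cs = seqℤ (ℤ.suc (ℤ.suc b)) n

  -- The surviving terms lower an initial run of columns: with the first `i` of `a + 1, …, a + n`
  -- lowered, exactly `a + i` is missing from `a, …, a + n`. With the sign (-1)^i this is a Laplace
  -- expansion.
  consecutive-columns : ∀ n (X : ℤ → List ℤ → Carrier) a m → (∀ i → Vanishing (X i) n) →
    U.Rw n X m (seqℤ (ℤ.suc a) n) ~ Lap (λ c cs → X (m ℤ.+ (c ℤ.- a)) cs) (seqℤ a (suc n))
  consecutive-columns zero    X a m v = ~sym (~trans (+-congˡ -0#≈0#) (~trans (+-identityʳ _)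
    (~reflexive (≡.cong (λ z → X z []) (lemma m a)))))
    where lemma : ∀ m a → m ℤ.+ (a ℤ.- a) ≡ m
          lemma = ℤSolver.solve-∀
  consecutive-columns (suc n) X a m v = +-cong
    (~trans (first-fixed n X (ℤ.suc a) m v) (~reflexive (≡.cong (λ z → X z (seqℤ (ℤ.suc a) (suc n))) (≡.sym (lemma₁ m a)))))
    (-‿cong (~trans
      (U.Rw-cong n (ℤ.suc m) _ λ i cs → ~reflexive (≡.cong (λ z → X i (z ∷ cs)) (ℤP.pred-suc a)))
      (~trans (consecutive-columns n (λ i cs → X i (a ∷ cs)) (ℤ.suc a) (ℤ.suc m) λ i p c q e → v i (a ∷ p) c q (≡.cong suc e))
        (Lap-cong-on (seqℤ (ℤ.suc a) (suc n)) λ c cs _ → ~reflexive (≡.cong (λ z → X z (a ∷ cs)) (lemma₂ m c a))))))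
    where
    lemma₁ : ∀ m a → m ℤ.+ (a ℤ.- a) ≡ m
    lemma₁ = ℤSolver.solve-∀
    lemma₂ : ∀ m c a → (+ 1 ℤ.+ m) ℤ.+ (c ℤ.- (+ 1 ℤ.+ a)) ≡ m ℤ.+ (c ℤ.- a)
    lemma₂ = ℤSolver.solve-∀

  -- The factors of the first row, moved from the rows of the smaller determinant to its columns,
  -- collapse to the expansion along that first row.
  jacobi-trudi : ∀ n γ o → length γ ≡ n → U.Fr 1# (stair n) γ ~ det γ o (seqℤ o n)
  jacobi-trudi zero    []      o e    = ~refl
  jacobi-trudi (suc n) (m ∷ γ) o refl = begin
    U.Rw n (λ i γ → h i * U.Fr 1# (stair n) γ) m γ
      ≈⟨ U.Rw-cong-on n m γ (λ i l → *-congˡ (jacobi-trudi n _ (ℤ.suc o) (Lw-length l))) ⟩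
    U.Rw n (λ i γ → h i * det γ (ℤ.suc o) cs) m γ
      ≈⟨ rows-columns h γ (ℤ.suc o) m cs (length-seqℤ _ n) ⟩
    U.Rw n (λ i cs → h i * det γ (ℤ.suc o) cs) m cs
      ≈⟨ consecutive-columns n (λ i cs → h i * det γ (ℤ.suc o) cs) o m (λ i p c q e → ~trans (*-congˡ (det-vanishing γ (ℤ.suc o) p c q e)) (zeroʳ _)) ⟩
    Lap (λ c cs → h (m ℤ.+ (c ℤ.- o)) * det γ (ℤ.suc o) cs) (seqℤ o (suc n))
      ≈⟨ Lap-cong-on (seqℤ o (suc n)) (λ c cs′ _ → *-congʳ {det γ (ℤ.suc o) cs′} (~reflexive (≡.cong h (≡.sym (ℤP.+-assoc m c _))))) ⟩
    det (m ∷ γ) o (seqℤ o (suc n)) ∎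
    where open ≈R-Reasoning
          cs = seqℤ (ℤ.suc o) n

  -- Consequences of the commutation rule between B_m and h_a

  module Vertex
    (h-negative : ∀ n → h -[1+ n ] ~ 0#)
    (τ : Carrier) (B : ℤ → Carrier → Carrier)
    (B-cong : ∀ m {x y} → x ~ y → B m x ~ B m y)
    (B-+ : ∀ m x y → B m (x + y) ~ B m x + B m y)
    (B-τ : ∀ m x → B m (τ * x) ~ τ * B m x)
    (B-one : ∀ m → B m 1# ~ h m)
    (B-h : ∀ m a x → B m (h a * x) - τ * B (ℤ.suc m) (h (ℤ.pred a) * x) ~
                     h a * B m x - h (ℤ.pred a) * B (ℤ.suc m) x)
    where

    module V where
      open Rows +-abelianGroup (τ *_) *-congˡ (distribˡ τ) public
      B-linear : ∀ m → Linear (B m)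
      B-linear m = record { additive = record { cong = B-cong m ; ⊕-hom = B-+ m } ; t-hom = B-τ m }
      open Ops B B-linear public

    B-minus : ∀ m x y → B m (x - y) ~ B m x - B m y
    B-minus m x y = ~trans (B-+ m x (- y)) (+-congˡ (V.Linear.⊝-hom (V.B-linear m) y))

    V-scale-linear : ∀ x → V.Linear (x *_)
    V-scale-linear x = record { additive = record { cong = *-congˡ ; ⊕-hom = distribˡ x } ; t-hom = λ y → *-swap x τ y }

    minus-⊖ : ∀ p q r s → (p - q) V.⊖ (r - s) ~ (p V.⊖ r) - (q V.⊖ s)
    minus-⊖ p q r s = ~trans (V.⊖-⊕ p (- q) r (- s)) (+-congˡ (~sym (V.⊖-⊝ q s)))

    -- The commutation of h c past a family t of operators indexed by two integers, near one index.
    record Exchange (c : ℤ) (x : Carrier) (t₀₀ t₁₀ t₀₁ t₁₁ : Carrier → Carrier) : Set where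
      constructor exchange
      field law :
              (t₀₀ (h c * x) V.⊖ t₁₀ (h (ℤ.pred c) * x)) V.⊖ (t₀₁ (h (ℤ.pred c) * x) V.⊖ t₁₁ (h (ℤ.pred (ℤ.pred c)) * x)) ~
              (h c * t₀₀ x - h (ℤ.pred c) * t₁₀ x) - (h (ℤ.pred c) * t₀₁ x - h (ℤ.pred (ℤ.pred c)) * t₁₁ x)
    open Exchange

    Exchange-B : ∀ c x a b → Exchange c x (λ y → B a (B b y)) (λ y → B (ℤ.suc a) (B b y))
      (λ y → B a (B (ℤ.suc b) y)) (λ y → B (ℤ.suc a) (B (ℤ.suc b) y))
    Exchange-B c x a b = exchange (begin
      _ ≈⟨ V.⊖-medial _ _ _ _ ⟩
      (B a (B b (h c * x)) V.⊖ B a (B (ℤ.suc b) (h c₁ * x))) V.⊖ (B a₁ (B b (h c₁ * x)) V.⊖ B a₁ (B (ℤ.suc b) (h c₂ * x)))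
        ≈⟨ V.⊖-cong (inner a c) (inner a₁ c₁) ⟩
      (B a (h c * y) - B a (h c₁ * z)) V.⊖ (B a₁ (h c₁ * y) - B a₁ (h c₂ * z))
        ≈⟨ minus-⊖ _ _ _ _ ⟩
      (B a (h c * y) V.⊖ B a₁ (h c₁ * y)) - (B a (h c₁ * z) V.⊖ B a₁ (h c₂ * z))
        ≈⟨ U.⊖-cong (B-h a c y) (B-h a c₁ z) ⟩
      (h c * B a y - h c₁ * B a₁ y) - (h c₁ * B a z - h c₂ * B a₁ z) ∎)
      where
      open ≈R-Reasoning
      a₁ = ℤ.suc a
      c₁ = ℤ.pred c
      c₂ = ℤ.pred c₁
      y = B b x
      z = B (ℤ.suc b) x
      inner : ∀ a c → B a (B b (h c * x)) V.⊖ B a (B (ℤ.suc b) (h (ℤ.pred c) * x)) ~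
        B a (h c * y) - B a (h (ℤ.pred c) * z)
      inner a c = ~trans (~sym (V.Linear-⊖ (V.B-linear a) _ _))
        (~trans (B-cong a (B-h b c x)) (B-minus a _ _))

    Exchange-swap : ∀ {c x t₀₀ t₁₀ t₀₁ t₁₁} → Exchange c x t₀₀ t₁₀ t₀₁ t₁₁ → Exchange c x t₀₀ t₀₁ t₁₀ t₁₁
    Exchange-swap e = exchange (~trans (V.⊖-medial _ _ _ _) (~trans (law e) (U.⊖-medial _ _ _ _)))

    Exchange-⊖ : ∀ {c x t₀₀ t₁₀ t₀₁ t₁₁ u₀₀ u₁₀ u₀₁ u₁₁} →
      Exchange c x t₀₀ t₁₀ t₀₁ t₁₁ → Exchange c x u₀₀ u₁₀ u₀₁ u₁₁ →
      Exchange c x (λ y → t₀₀ y V.⊖ u₀₀ y) (λ y → t₁₀ y V.⊖ u₁₀ y) (λ y → t₀₁ y V.⊖ u₀₁ y) (λ y → t₁₁ y V.⊖ u₁₁ y)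
    Exchange-⊖ e e′ = exchange (~trans (V.⊖-cong (V.⊖-medial _ _ _ _) (V.⊖-medial _ _ _ _))
      (~trans (V.⊖-medial _ _ _ _) (~trans (V.⊖-cong (law e) (law e′))
        (~trans (minus-⊖ _ _ _ _) (U.⊖-cong (collect _ _ _ _ _ _) (collect _ _ _ _ _ _))))))
      where
      collect : ∀ a b p q p′ q′ → (a * p - b * q) V.⊖ (a * p′ - b * q′) ~ a * (p V.⊖ p′) - b * (q V.⊖ q′)
      collect a b p q p′ q′ = ~trans (minus-⊖ _ _ _ _)
        (U.⊖-cong (~sym (V.Linear-⊖ (V-scale-linear a) p p′)) (~sym (V.Linear-⊖ (V-scale-linear b) q q′)))

    Exchange-+ : ∀ {c x t₀₀ t₁₀ t₀₁ t₁₁ u₀₀ u₁₀ u₀₁ u₁₁} →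
      Exchange c x t₀₀ t₁₀ t₀₁ t₁₁ → Exchange c x u₀₀ u₁₀ u₀₁ u₁₁ →
      Exchange c x (λ y → t₀₀ y + u₀₀ y) (λ y → t₁₀ y + u₁₀ y) (λ y → t₀₁ y + u₀₁ y) (λ y → t₁₁ y + u₁₁ y)
    Exchange-+ e e′ = exchange (~trans (V.⊖-cong (V.⊖-⊕ _ _ _ _) (V.⊖-⊕ _ _ _ _))
      (~trans (V.⊖-⊕ _ _ _ _) (~trans (+-cong (law e) (law e′))
        (~trans (~sym (U.⊖-⊕ _ _ _ _)) (U.⊖-cong (collect _ _ _ _ _ _) (collect _ _ _ _ _ _))))))
      where
      collect : ∀ a b p q p′ q′ → (a * p - b * q) + (a * p′ - b * q′) ~ a * (p + p′) - b * (q + q′)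
      collect a b p q p′ q′ = ~trans (~sym (U.⊖-⊕ _ _ _ _)) (U.⊖-cong (~sym (distribˡ a p p′)) (~sym (distribˡ b q q′)))

    quadratic : ℤ → ℤ → Carrier → Carrier
    quadratic a b x =
      (B a (B b x) V.⊖ B (ℤ.suc a) (B (ℤ.pred b) x)) + (B (ℤ.pred b) (B (ℤ.suc a) x) V.⊖ B b (B a x))

    Exchange-quadratic : ∀ c x a b → Exchange c x (quadratic a b) (quadratic (ℤ.suc a) b)
      (quadratic a (ℤ.suc b)) (quadratic (ℤ.suc a) (ℤ.suc b))
    Exchange-quadratic c x a b = Exchange-+
      (Exchange-⊖ (Exchange-B c x a b)
        (≡.subst (λ z → Exchange c x (λ y → B (ℤ.suc a) (B (ℤ.pred b) y)) (λ y → B (ℤ.suc (ℤ.suc a)) (B (ℤ.pred b) y))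
          (λ y → B (ℤ.suc a) (B z y)) (λ y → B (ℤ.suc (ℤ.suc a)) (B z y))) suc-pred-comm (Exchange-B c x (ℤ.suc a) (ℤ.pred b))))
      (Exchange-⊖
        (≡.subst (λ z → Exchange c x (λ y → B (ℤ.pred b) (B (ℤ.suc a) y)) (λ y → B (ℤ.pred b) (B (ℤ.suc (ℤ.suc a)) y))
          (λ y → B z (B (ℤ.suc a) y)) (λ y → B z (B (ℤ.suc (ℤ.suc a)) y))) suc-pred-comm
          (Exchange-swap (Exchange-B c x (ℤ.pred b) (ℤ.suc a))))
        (Exchange-swap (Exchange-B c x b a)))
      where
      suc-pred-comm : ℤ.suc (ℤ.pred b) ≡ ℤ.pred (ℤ.suc b)
      suc-pred-comm = ≡.trans (ℤP.suc-pred b) (≡.sym (ℤP.pred-suc b))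

    Quadratic : Carrier → Set
    Quadratic x = ∀ a b → quadratic a b x ~ 0#

    quadratic-cong : ∀ a b {x y} → x ~ y → quadratic a b x ~ quadratic a b y
    quadratic-cong a b e = +-cong
      (V.⊖-cong (B-cong _ (B-cong _ e)) (B-cong _ (B-cong _ e))) (V.⊖-cong (B-cong _ (B-cong _ e)) (B-cong _ (B-cong _ e)))

    Quadratic-zero : Quadratic 0#
    Quadratic-zero a b = ~trans (+-cong (V.⊖-cong (zz _ _) (zz _ _)) (V.⊖-cong (zz _ _) (zz _ _)))
      (~trans (+-cong V.⊖-𝟘 V.⊖-𝟘) (+-identityˡ 0#))
      where
      z : ∀ m → B m 0# ~ 0#
      z m = ~trans (B-cong m (~sym (-‿inverseʳ 0#))) (~trans (B-minus m 0# 0#) (-‿inverseʳ _))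
      zz : ∀ m n → B m (B n 0#) ~ 0#
      zz m n = ~trans (B-cong m (z n)) (z m)

    -- Since B_b 1 = h_b, the rule `B-h` turns each half into a 2 by 2 determinant of h's, and the
    -- halves cancel.
    Quadratic-one : Quadratic 1#
    Quadratic-one a b = begin
      (B a (B b 1#) V.⊖ B (ℤ.suc a) (B (ℤ.pred b) 1#)) + (B (ℤ.pred b) (B (ℤ.suc a) 1#) V.⊖ B b (B a 1#))
        ≈⟨ +-cong (first a b) (~trans
             (V.⊖-cong ~refl (~reflexive (≡.cong₂ (λ u v → B u (B v 1#)) (≡.sym (ℤP.suc-pred b)) (≡.sym (ℤP.pred-suc a)))))
             (first (ℤ.pred b) (ℤ.suc a))) ⟩
      (h b * h a - h (ℤ.pred b) * h (ℤ.suc a)) + (h (ℤ.suc a) * h (ℤ.pred b) - h (ℤ.pred (ℤ.suc a)) * h (ℤ.suc (ℤ.pred b)))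
        ≈⟨ +-congˡ (+-congˡ (-‿cong (~reflexive (≡.cong₂ (λ u v → h u * h v) (ℤP.pred-suc a) (ℤP.suc-pred b))))) ⟩
      (h b * h a - h (ℤ.pred b) * h (ℤ.suc a)) + (h (ℤ.suc a) * h (ℤ.pred b) - h a * h b)
        ≈⟨ lemma (h a) (h b) (h (ℤ.suc a)) (h (ℤ.pred b)) ⟩
      0# ∎
      where
      open ≈R-Reasoning
      B-one′ : ∀ m b → B m (B b 1#) ~ B m (h b * 1#)
      B-one′ m b = B-cong m (~trans (B-one b) (~sym (*-identityʳ _)))
      first : ∀ a b → B a (B b 1#) V.⊖ B (ℤ.suc a) (B (ℤ.pred b) 1#) ~ h b * h a - h (ℤ.pred b) * h (ℤ.suc a)
      first a b = ~trans (V.⊖-cong (B-one′ a b) (B-one′ (ℤ.suc a) (ℤ.pred b)))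
        (~trans (B-h a b 1#) (U.⊖-cong (*-congˡ (B-one a)) (*-congˡ (B-one (ℤ.suc a)))))
      lemma : ∀ p q r s → (q * p - s * r) + (r * s - p * q) ~ 0#
      lemma p q r s = ~trans (+-congˡ (U.⊖-cong (*-comm r s) (*-comm p q))) (~trans (~sym (U.⊖-⊕ _ _ _ _))
        (~trans (+-congˡ (-‿cong (+-comm _ _))) (-‿inverseʳ _)))

    -- By `Exchange-quadratic` the relation at `h c * x` follows from those at `h (c - 1) * x`,
    -- `h (c - 2) * x` and `x`. Two consecutive values are carried along, and h vanishes at negative
    -- indices, which starts the induction.
    Quadratic-h : ∀ {x} → Quadratic x → ∀ n → Quadratic (h (+ n) * x)
    Quadratic-h {x} q n = proj₁ (both n)
      where
      low : ∀ n → Quadratic (h -[1+ n ] * x)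
      low n a b = ~trans (quadratic-cong a b (~trans (*-congʳ (h-negative n)) (zeroˡ x))) (Quadratic-zero a b)
      step : ∀ c → Quadratic (h (ℤ.pred c) * x) → Quadratic (h (ℤ.pred (ℤ.pred c)) * x) → Quadratic (h c * x)
      step c q₁ q₂ a b = begin
        q₀                       ≈⟨ ~sym (minus-zero q₀) ⟩
        q₀ V.⊖ 0#                ≈⟨ ~sym (minus-zero _) ⟩
        (q₀ V.⊖ 0#) V.⊖ 0#       ≈⟨ V.⊖-cong ~refl (~sym V.⊖-𝟘) ⟩
        (q₀ V.⊖ 0#) V.⊖ (0# V.⊖ 0#)
          ≈⟨ V.⊖-cong (V.⊖-cong ~refl (~sym (q₁ (ℤ.suc a) b)))
                      (V.⊖-cong (~sym (q₁ a (ℤ.suc b))) (~sym (q₂ (ℤ.suc a) (ℤ.suc b)))) ⟩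
        _ ≈⟨ law (Exchange-quadratic c x a b) ⟩
        _ ≈⟨ U.⊖-cong (U.⊖-cong (*-congˡ (q a b)) (*-congˡ (q (ℤ.suc a) b)))
                      (U.⊖-cong (*-congˡ (q a (ℤ.suc b))) (*-congˡ (q (ℤ.suc a) (ℤ.suc b)))) ⟩
        (h c * 0# - h (ℤ.pred c) * 0#) - (h (ℤ.pred c) * 0# - h (ℤ.pred (ℤ.pred c)) * 0#)
          ≈⟨ lemma (h c) (h (ℤ.pred c)) (h (ℤ.pred (ℤ.pred c))) ⟩
        0# ∎
        where
        open ≈R-Reasoning
        q₀ = quadratic a b (h c * x)
        minus-zero : ∀ y → y V.⊖ 0# ~ y
        minus-zero y = ~trans (+-congˡ (~trans (-‿cong (zeroʳ τ)) -0#≈0#)) (+-identityʳ y)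
        lemma : ∀ a b c → (a * 0# - b * 0#) - (b * 0# - c * 0#) ~ 0#
        lemma a b c = ~trans (U.⊖-cong (U.⊖-cong (zeroʳ a) (zeroʳ b)) (U.⊖-cong (zeroʳ b) (zeroʳ c)))
          (~trans (U.⊖-cong U.⊖-𝟘 U.⊖-𝟘) U.⊖-𝟘)
      both : ∀ n → Quadratic (h (+ n) * x) × Quadratic (h (ℤ.pred (+ n)) * x)
      both zero          = step (+ 0) (low 0) (low 1) , low 0
      both (suc zero)    = step (+ 1) (proj₁ (both 0)) (low 0) , proj₁ (both 0)
      both (suc (suc n)) = step (+ suc (suc n)) (proj₁ (both (suc n))) (proj₁ (both n)) , proj₁ (both (suc n))

    h-product : List ℤ → Carrier
    h-product = foldr (λ a x → h a * x) 1#

    -- Each passage of a factor h through B by `B-h` trades 1 - t R inside for 1 - R outside; this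
    -- is where t disappears.
    Rw-h-product : ∀ γ m → V.Rw (length γ) (λ i γ → B i (h-product γ)) m γ ~
                           U.Rw (length γ) (λ i γ → h i * h-product γ) m γ
    Rw-h-product []      m = ~trans (B-one m) (~sym (*-identityʳ _))
    Rw-h-product (g ∷ γ) m = begin
      V.Rw n (λ i γ → B i (h g * h-product γ)) m γ V.⊖ V.Rw n (λ i γ → B i (h g′ * h-product γ)) (ℤ.suc m) γ
        ≈⟨ V.⊖-cong ~refl (V.Rw-suc n _ m γ) ⟩
      _ ≈⟨ V.Rw-⊖ n _ _ m γ ⟨
      V.Rw n (λ i γ → B i (h g * h-product γ) V.⊖ B (ℤ.suc i) (h g′ * h-product γ)) m γ
        ≈⟨ V.Rw-cong n m γ (λ i γ → ~trans (B-h i g (h-product γ)) (+-congˡ (-‿distribˡ-* _ _))) ⟩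
      V.Rw n (λ i γ → h g * B i (h-product γ) + - h g′ * B (ℤ.suc i) (h-product γ)) m γ
        ≈⟨ V.Rw-⊕ n _ _ m γ ⟩
      _ ≈⟨ +-cong (~sym (V.Rw-linear (V-scale-linear (h g)) n _ m γ))
                  (~trans (~sym (V.Rw-linear (V-scale-linear (- h g′)) n _ m γ)) (*-congˡ (~sym (V.Rw-suc n _ m γ)))) ⟩
      h g * V.Rw n (λ i γ → B i (h-product γ)) m γ + - h g′ * V.Rw n (λ i γ → B i (h-product γ)) (ℤ.suc m) γ
        ≈⟨ +-cong (*-congˡ (Rw-h-product γ m)) (~trans (*-congˡ (Rw-h-product γ (ℤ.suc m))) (~sym (-‿distribˡ-* _ _))) ⟩
      h g * U.Rw n (λ i γ → h i * h-product γ) m γ - h g′ * U.Rw n (λ i γ → h i * h-product γ) (ℤ.suc m) γ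
        ≈⟨ +-cong (push g m) (-‿cong (push g′ (ℤ.suc m))) ⟩
      _ ∎
      where
      open ≈R-Reasoning
      n = length γ
      g′ = ℤ.pred g
      push : ∀ g m → h g * U.Rw n (λ i γ → h i * h-product γ) m γ ~ U.Rw n (λ i γ → h i * (h g * h-product γ)) m γ
      push g m = ~trans (U.Rw-linear (scale-linear (h g)) n _ m γ) (U.Rw-cong n m γ λ i γ → *-swap (h g) (h i) _)

    Fr-foldr : ∀ f γ → V.Fr f (replicate (length γ) 0) γ ≡ foldr B f γ
    Fr-foldr f []      = refl
    Fr-foldr f (m ∷ γ) = ≡.cong (B m) (Fr-foldr f γ)

    Fr-h-product : ∀ γ → U.Fr 1# (replicate (length γ) 0) γ ≡ h-product γ
    Fr-h-product []      = refl
    Fr-h-product (m ∷ γ) = ≡.cong (h m *_) (Fr-h-product γ)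

    neg-linear : V.Linear (-_)
    neg-linear = record
      { additive = record { cong = -‿cong ; ⊕-hom = λ x y → ~sym (-‿+-comm x y) }
      ; t-hom    = λ x → -‿distribʳ-* τ x }

    V-Rw-pairOps : ∀ ps n X m γ → V.Rw n (λ i → U.pairOps ps (X i)) m γ ~ U.pairOps ps (V.Rw n X m) γ
    V-Rw-pairOps []             n X m γ = ~refl
    V-Rw-pairOps ((i , j) ∷ ps) n X m γ = ~trans (V-Rw-pairOps ps n (λ l → U.pairOp (i , j) (X l)) m γ)
      (U.pairOps-cong-on ps γ λ γ′ _ → ~trans (V.Rw-⊕ n X _ m γ′)
        (+-congˡ (~trans (~sym (V.Rw-linear neg-linear n _ m γ′)) (-‿cong (~sym (V.Rw-shiftZ i j (+ 1) n X m γ′))))))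

    U-B-linear : ∀ m → U.Linear (B m)
    U-B-linear m = record { additive = record { cong = B-cong m ; ⊕-hom = B-+ m } ; t-hom = λ _ → ~refl }

    -- Both sides are obtained from h-product by the operators 1 − R over all pairs of rows.
    Fr-stair : ∀ n γ → length γ ≡ n → V.Fr 1# (stair n) γ ~ U.Fr 1# (stair n) γ
    Fr-stair zero    []      e    = ~refl
    Fr-stair (suc n) (m ∷ γ) refl = begin
      V.Rw n (λ i γ → B i (V.Fr 1# (stair n) γ)) m γ
        ≈⟨ V.Rw-cong-on n m γ (λ i l → B-cong i (~trans (Fr-stair n _ (Lw-length l)) (~sym (differences _ (Lw-length l))))) ⟩
      V.Rw n (λ i γ → B i (U.pairOps ps h-product γ)) m γ
        ≈⟨ V.Rw-cong n m γ (λ i γ′ → U.pairOps-linear (U-B-linear i) ps h-product γ′) ⟩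
      V.Rw n (λ i → U.pairOps ps (λ γ → B i (h-product γ))) m γ
        ≈⟨ V-Rw-pairOps ps n (λ i γ → B i (h-product γ)) m γ ⟩
      U.pairOps ps (V.Rw n (λ i γ → B i (h-product γ)) m) γ
        ≈⟨ U.pairOps-cong-on ps γ (λ γ′ l → at-length γ′ l) ⟩
      U.pairOps ps (U.Rw n (λ i γ → h i * h-product γ) m) γ
        ≈⟨ U.Rw-pairOps ps n (λ i γ → h i * h-product γ) m γ ⟨
      U.Rw n (λ i → U.pairOps ps (λ γ → h i * h-product γ)) m γ
        ≈⟨ U.Rw-cong-on n m γ (λ i {γ′} l → ~trans (~sym (U.pairOps-linear (scale-linear (h i)) ps h-product γ′))
             (*-congˡ (differences γ′ (Lw-length l)))) ⟩
      U.Rw n (λ i γ → h i * U.Fr 1# (stair n) γ) m γ ∎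
      where
      open ≈R-Reasoning
      ps = rootPairs (replicate n 0)
      differences : ∀ γ′ → length γ′ ≡ n → U.pairOps ps h-product γ′ ~ U.Fr 1# (stair n) γ′
      differences γ′ l = ~trans
        (U.pairOps-cong-on ps γ′ λ γ″ l′ → ~reflexive (≡.trans (≡.sym (Fr-h-product γ″))
          (≡.cong (λ l → U.Fr 1# (replicate l 0) γ″) (≡.trans l′ l))))
        (~trans (U.pairOps-roots 1# (replicate n 0) γ′ (≡.trans l (≡.sym (length-replicate n))))
          (~reflexive (≡.cong (λ l → U.Fr 1# (stair l) γ′) (length-replicate n))))
      at-length : ∀ γ′ → length γ′ ≡ n → V.Rw n (λ i γ → B i (h-product γ)) m γ′ ~ U.Rw n (λ i γ → h i * h-product γ) m γ′
      at-length γ′ l = ≡.subst (λ n → V.Rw n (λ i γ → B i (h-product γ)) m γ′ ~ U.Rw n (λ i γ → h i * h-product γ) m γ′) l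
        (Rw-h-product γ′ m)

    signed-step : ∀ s p x y → s * p * x + (- s) * (τ * p) * y ~ s * p * (x V.⊖ y)
    signed-step s p x y = ~trans (+-congˡ negate) (~sym (distribˡ (s * p) x (- (τ * y))))
      where
      negate : (- s) * (τ * p) * y ~ s * p * - (τ * y)
      negate = begin
        (- s) * (τ * p) * y    ≈⟨ *-congʳ (-‿distribˡ-* s (τ * p)) ⟨
        - (s * (τ * p)) * y    ≈⟨ -‿distribˡ-* (s * (τ * p)) y ⟨
        - (s * (τ * p) * y)    ≈⟨ -‿cong (*-congʳ (*-swap s τ p)) ⟩
        - (τ * (s * p) * y)    ≈⟨ -‿cong (~trans (*-assoc τ (s * p) y) (*-swap τ (s * p) y)) ⟩
        - (s * p * (τ * y))    ≈⟨ -‿distribʳ-* (s * p) (τ * y) ⟩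
        s * p * - (τ * y) ∎
        where open ≈R-Reasoning

    pairOps-zeros : ∀ f α → V.pairOps (rootPairs (replicate (length α) 0)) (foldr B f) α ~ V.Fr f (stair (length α)) α
    pairOps-zeros f α = begin
      V.pairOps (rootPairs zeros) (foldr B f) α
        ≈⟨ V.pairOps-cong-on (rootPairs zeros) α (λ γ l → ~reflexive (≡.trans (≡.sym (Fr-foldr f γ))
             (≡.cong (λ l → V.Fr f (replicate l 0) γ) l))) ⟩
      V.pairOps (rootPairs zeros) (V.Fr f zeros) α
        ≈⟨ V.pairOps-roots f zeros α (≡.sym (length-replicate (length α))) ⟩
      V.Fr f (stair (length zeros)) α
        ≡⟨ ≡.cong (λ l → V.Fr f (stair l) α) (length-replicate (length α)) ⟩
      V.Fr f (stair (length α)) α ∎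
      where open ≈R-Reasoning
            zeros = replicate (length α) 0

-- Bernstein operators as truncated double sums

before : {A : Set} → A → (ℕ → A) → ℕ → A
before z f zero    = z
before z f (suc n) = f n

module Bernstein (R : CommutativeRing 0ℓ 0ℓ) (h : ℤ → CommutativeRing.Carrier R) where

  open RingLaws R

  sumTo : ℕ → (ℕ → Carrier) → Carrier
  sumTo zero    f = 0#
  sumTo (suc n) f = f 0 + sumTo n (f ∘ suc)

  sumTo-cong : ∀ n {f g} → (∀ i → f i ~ g i) → sumTo n f ~ sumTo n g
  sumTo-cong zero    e = ~refl
  sumTo-cong (suc n) e = +-cong (e 0) (sumTo-cong n (e ∘ suc))

  sumTo-0# : ∀ n {f} → (∀ i → f i ~ 0#) → sumTo n f ~ 0#
  sumTo-0# zero    e = ~refl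
  sumTo-0# (suc n) e = ~trans (+-cong (e 0) (sumTo-0# n (e ∘ suc))) (+-identityˡ 0#)

  sumTo-+ : ∀ n f g → sumTo n (λ i → f i + g i) ~ sumTo n f + sumTo n g
  sumTo-+ zero    f g = ~sym (+-identityˡ 0#)
  sumTo-+ (suc n) f g = ~trans (+-congˡ (sumTo-+ n (f ∘ suc) (g ∘ suc))) (+-interchange _ _ _ _)

  sumTo-* : ∀ n x f → sumTo n (λ i → x * f i) ~ x * sumTo n f
  sumTo-* zero    x f = ~sym (zeroʳ x)
  sumTo-* (suc n) x f = ~trans (+-congˡ (sumTo-* n x (f ∘ suc))) (~sym (distribˡ x _ _))

  sumTo-extend : ∀ {m n} f → m ℕ.≤ n → (∀ i → m ℕ.≤ i → f i ~ 0#) → sumTo n f ~ sumTo m f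
  sumTo-extend {n = n} f z≤n       v = sumTo-0# n (λ i → v i z≤n)
  sumTo-extend         f (s≤s m≤n) v = +-congˡ (sumTo-extend (f ∘ suc) m≤n λ i l → v (suc i) (s≤s l))

  module Operators
    (τ : Carrier)
    (σ : ℕ → Carrier) (σ-zero : σ 0 ~ 1#) (σ-suc : ∀ i → σ (suc i) ~ - σ i)
    (τ^ : ℕ → Carrier) (τ^-zero : τ^ 0 ~ 1#) (τ^-suc : ∀ j → τ^ (suc j) ~ τ * τ^ j)
    (E H : ℕ → Carrier → Carrier)
    (E-cong : ∀ i {x y} → x ~ y → E i x ~ E i y) (E-+ : ∀ i x y → E i (x + y) ~ E i x + E i y)
    (H-cong : ∀ i {x y} → x ~ y → H i x ~ H i y) (H-+ : ∀ i x y → H i (x + y) ~ H i x + H i y)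
    (E-h : ∀ i a x → E i (h a * x) ~ h a * E i x + h (ℤ.pred a) * before 0# (λ i → E i x) i)
    (H-h : ∀ j a x → H j (h a * x) ~ h a * H j x + before 0# (λ j → H j (h (ℤ.pred a) * x)) j)
    (deg : Carrier → ℕ)
    (E-deg : ∀ i j x → deg x ℕ.< i → E i (H j x) ~ 0#)
    (H-deg : ∀ j x → deg x ℕ.< j → H j x ~ 0#)
    where

    weight : ℤ → ℕ → ℕ → Carrier
    weight m i j = σ i * τ^ j * h (m ℤ.+ + i ℤ.+ + j)

    sum₂ : ℕ → ℕ → ℤ → (ℕ → ℕ → Carrier) → Carrier
    sum₂ I J m Φ = sumTo I λ i → sumTo J λ j → weight m i j * Φ i j

    sum₂-cong : ∀ I J m {Φ Ψ} → (∀ i j → Φ i j ~ Ψ i j) → sum₂ I J m Φ ~ sum₂ I J m Ψ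
    sum₂-cong I J m e = sumTo-cong I λ i → sumTo-cong J λ j → *-congˡ (e i j)

    sum₂-+ : ∀ I J m Φ Ψ → sum₂ I J m (λ i j → Φ i j + Ψ i j) ~ sum₂ I J m Φ + sum₂ I J m Ψ
    sum₂-+ I J m Φ Ψ = ~trans (sumTo-cong I λ i → ~trans (sumTo-cong J λ j → distribˡ _ _ _) (sumTo-+ J _ _)) (sumTo-+ I _ _)

    sum₂-* : ∀ I J m x Φ → sum₂ I J m (λ i j → x * Φ i j) ~ x * sum₂ I J m Φ
    sum₂-* I J m x Φ = ~trans (sumTo-cong I λ i → ~trans (sumTo-cong J λ j → *-swap _ _ _) (sumTo-* J x _)) (sumTo-* I x _)

    sum₂-extend : ∀ {I I′ J J′} m Φ → I ℕ.≤ I′ → J ℕ.≤ J′ →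
      (∀ i j → I ℕ.≤ i → Φ i j ~ 0#) → (∀ i j → J ℕ.≤ j → Φ i j ~ 0#) → sum₂ I′ J′ m Φ ~ sum₂ I J m Φ
    sum₂-extend {I} {I′} {J} {J′} m Φ I≤ J≤ vᵢ vⱼ = ~trans
      (sumTo-cong I′ λ i → sumTo-extend _ J≤ λ j l → ~trans (*-congˡ (vⱼ i j l)) (zeroʳ _))
      (sumTo-extend _ I≤ λ i l → sumTo-0# J λ j → ~trans (*-congˡ (vᵢ i j l)) (zeroʳ _))

    sum₂-shift-j : ∀ I J m Φ → sum₂ I (suc J) m (λ i → before 0# (Φ i)) ~ τ * sum₂ I J (ℤ.suc m) Φ
    sum₂-shift-j I J m Φ = ~trans
      (sumTo-cong I λ i → ~trans (+-cong (zeroʳ _) (~trans (sumTo-cong J λ j → ~trans (*-congʳ (weight-j i j)) (*-assoc _ _ _))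
        (sumTo-* J τ _))) (+-identityˡ _))
      (sumTo-* I τ _)
      where
      weight-j : ∀ i j → weight m i (suc j) ~ τ * weight (ℤ.suc m) i j
      weight-j i j = ~trans (*-cong (~trans (*-congˡ (τ^-suc j)) (*-swap _ _ _)) (~reflexive (≡.cong h index))) (*-assoc _ _ _)
        where
        index : m ℤ.+ + i ℤ.+ + suc j ≡ ℤ.suc m ℤ.+ + i ℤ.+ + j
        index = ≡.trans (≡.sym (suc-+ (m ℤ.+ + i) j)) (≡.cong (ℤ._+ + j) (≡.sym (ℤP.+-assoc (+ 1) m (+ i))))

    sum₂-shift-i : ∀ I J m Φ → sum₂ (suc I) J m (λ i j → before 0# (λ i → Φ i j) i) ~ - sum₂ I J (ℤ.suc m) Φ
    sum₂-shift-i I J m Φ = begin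
      _ ≈⟨ +-congʳ (sumTo-0# J λ j → zeroʳ _) ⟩
      _ ≈⟨ +-identityˡ _ ⟩
      sumTo I (λ i → sumTo J λ j → weight m (suc i) j * Φ i j)
        ≈⟨ sumTo-cong I (λ i → ~trans (sumTo-cong J λ j → ~trans (*-congʳ (weight-i i j)) (*-assoc _ _ _)) (sumTo-* J (- 1#) _)) ⟩
      sumTo I (λ i → - 1# * sumTo J λ j → weight (ℤ.suc m) i j * Φ i j)
        ≈⟨ sumTo-* I (- 1#) _ ⟩
      - 1# * sum₂ I J (ℤ.suc m) Φ
        ≈⟨ -1*x≈-x _ ⟩
      - sum₂ I J (ℤ.suc m) Φ ∎
      where
      open ≈R-Reasoning
      open import Algebra.Properties.Ring ring using (-1*x≈-x)
      weight-i : ∀ i j → weight m (suc i) j ~ - 1# * weight (ℤ.suc m) i j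
      weight-i i j = ~trans (*-cong (~trans (*-congʳ (~trans (σ-suc i) (~sym (-1*x≈-x _)))) (*-assoc _ _ _))
          (~reflexive (≡.cong (λ z → h (z ℤ.+ + j)) (≡.sym (suc-+ m i)))))
        (*-assoc _ _ _)

    Φ : Carrier → ℕ → ℕ → Carrier
    Φ x i j = E i (H j x)

    E-0# : ∀ i → E i 0# ~ 0#
    E-0# i = identityʳ-unique _ _ (~trans (~sym (E-+ i 0# 0#)) (E-cong i (+-identityʳ 0#)))
      where open import Algebra.Properties.Group +-group using (identityʳ-unique)

    Φ-cong : ∀ {x y} → x ~ y → ∀ i j → Φ x i j ~ Φ y i j
    Φ-cong e i j = E-cong i (H-cong j e)

    B : ℤ → Carrier → Carrier
    B m x = sum₂ (suc (deg x)) (suc (deg x)) m (Φ x)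

    -- `deg` may depend on the representative, so equal arguments, or a sum and its summands, can be
    -- truncated differently; a common larger bound makes them comparable.
    B-large : ∀ {I J} m x → deg x ℕ.< I → deg x ℕ.< J → B m x ~ sum₂ I J m (Φ x)
    B-large m x p q = ~sym (sum₂-extend m (Φ x) p q
      (λ i j l → E-deg i j x l) (λ i j l → ~trans (E-cong i (H-deg j x l)) (E-0# i)))

    private
      <⊔ˡ : ∀ a b → a ℕ.< suc (a ℕ.⊔ b)
      <⊔ˡ a b = s≤s (ℕP.m≤m⊔n a b)

      <⊔ʳ : ∀ a b → b ℕ.< suc (a ℕ.⊔ b)
      <⊔ʳ a b = s≤s (ℕP.m≤n⊔m a b)

    B-cong : ∀ m {x y} → x ~ y → B m x ~ B m y
    B-cong m {x} {y} e = ~trans (B-large m x l l) (~trans (sum₂-cong D D m (Φ-cong e)) (~sym (B-large m y r r)))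
      where D = suc (deg x ℕ.⊔ deg y)
            l = <⊔ˡ (deg x) (deg y)
            r = <⊔ʳ (deg x) (deg y)

    B-+ : ∀ m x y → B m (x + y) ~ B m x + B m y
    B-+ m x y = begin
      B m (x + y)                 ≈⟨ B-large m (x + y) l l ⟩
      sum₂ D D m (Φ (x + y))      ≈⟨ sum₂-cong D D m (λ i j → ~trans (E-cong i (H-+ j x y)) (E-+ i _ _)) ⟩
      _                           ≈⟨ sum₂-+ D D m (Φ x) (Φ y) ⟩
      sum₂ D D m (Φ x) + sum₂ D D m (Φ y)
        ≈⟨ +-cong (B-large m x x< x<) (B-large m y y< y<) ⟨
      B m x + B m y ∎
      where
      open ≈R-Reasoning
      d = deg x ℕ.⊔ deg y
      D = suc (deg (x + y) ℕ.⊔ d)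
      l = <⊔ˡ (deg (x + y)) d
      x< = ℕP.≤-trans (<⊔ˡ (deg x) (deg y)) (s≤s (ℕP.m≤n⊔m (deg (x + y)) d))
      y< = ℕP.≤-trans (<⊔ʳ (deg x) (deg y)) (s≤s (ℕP.m≤n⊔m (deg (x + y)) d))

    B-scalar : ∀ κ → (∀ i x → E i (κ * x) ~ κ * E i x) → (∀ j x → H j (κ * x) ~ κ * H j x) →
      ∀ m x → B m (κ * x) ~ κ * B m x
    B-scalar κ E-κ H-κ m x = begin
      B m (κ * x)               ≈⟨ B-large m (κ * x) l l ⟩
      sum₂ D D m (Φ (κ * x))    ≈⟨ sum₂-cong D D m (λ i j → ~trans (E-cong i (H-κ j x)) (E-κ i _)) ⟩
      _                         ≈⟨ sum₂-* D D m κ (Φ x) ⟩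
      κ * sum₂ D D m (Φ x)      ≈⟨ *-congˡ (B-large m x r r) ⟨
      κ * B m x ∎
      where open ≈R-Reasoning
            D = suc (deg (κ * x) ℕ.⊔ deg x)
            l = <⊔ˡ (deg (κ * x)) (deg x)
            r = <⊔ʳ (deg (κ * x)) (deg x)

    B-one : deg 1# ≡ 0 → E 0 (H 0 1#) ~ 1# → ∀ m → B m 1# ~ h m
    B-one d e m = begin
      B m 1#                             ≡⟨ ≡.cong (λ d → sum₂ (suc d) (suc d) m (Φ 1#)) d ⟩
      weight m 0 0 * Φ 1# 0 0 + 0# + 0#  ≈⟨ ~trans (+-identityʳ _) (+-identityʳ _) ⟩
      weight m 0 0 * Φ 1# 0 0            ≈⟨ *-cong (*-cong (*-cong σ-zero τ^-zero) (~reflexive (≡.cong h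
        (≡.trans (ℤP.+-identityʳ _) (ℤP.+-identityʳ m))))) e ⟩
      1# * 1# * h m * 1#                 ≈⟨ ~trans (*-identityʳ _) (~trans (*-congʳ (*-identityˡ 1#)) (*-identityˡ _)) ⟩
      h m ∎
      where open ≈R-Reasoning

    -- The adjoints commute past multiplication by h a up to lowering one index each; the two shifts
    -- become the two correction terms.
    B-h : ∀ m a x → B m (h a * x) - τ * B (ℤ.suc m) (h (ℤ.pred a) * x) ~
                    h a * B m x - h (ℤ.pred a) * B (ℤ.suc m) x
    B-h m a x = begin
      B m (h a * x) - τ * B m₁ y
        ≈⟨ +-congʳ (~trans (B-large m (h a * x) u< u<) split) ⟩
      ((h a * B m x + h a₁ * - B m₁ x) + τ * B m₁ y) - τ * B m₁ y
        ≈⟨ ~trans (+-assoc _ _ _) (~trans (+-congˡ (-‿inverseʳ _)) (+-identityʳ _)) ⟩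
      h a * B m x + h a₁ * - B m₁ x
        ≈⟨ +-congˡ (~sym (-‿distribʳ-* (h a₁) _)) ⟩
      h a * B m x - h a₁ * B m₁ x ∎
      where
      open ≈R-Reasoning
      a₁ = ℤ.pred a
      m₁ = ℤ.suc m
      y = h a₁ * x
      dx = deg x
      dy = deg y
      du = deg (h a * x)
      -- One bound for the three arguments; the sums run to `suc D` because a shifted sum has one
      -- term fewer.
      D = suc (du ℕ.⊔ (dx ℕ.⊔ dy))
      u< : du ℕ.< suc D
      u< = ℕP.≤-trans (<⊔ˡ du (dx ℕ.⊔ dy)) (ℕP.n≤1+n D)
      x< : dx ℕ.< D
      x< = ℕP.≤-trans (<⊔ˡ dx dy) (s≤s (ℕP.m≤n⊔m du _))
      y< : dy ℕ.< D
      y< = ℕP.≤-trans (<⊔ʳ dx dy) (s≤s (ℕP.m≤n⊔m du _))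
      Φᵢ Φⱼ : ℕ → ℕ → Carrier
      Φᵢ i j = before 0# (λ i → Φ x i j) i
      Φⱼ i = before 0# (Φ y i)
      E-before : ∀ i j → E i (before 0# (λ j → H j y) j) ~ before 0# (λ j → E i (H j y)) j
      E-before i zero    = E-0# i
      E-before i (suc j) = ~refl
      split : sum₂ (suc D) (suc D) m (Φ (h a * x)) ~ (h a * B m x + h a₁ * - B m₁ x) + τ * B m₁ y
      split = begin
        sum₂ (suc D) (suc D) m (Φ (h a * x))
          ≈⟨ sum₂-cong (suc D) (suc D) m (λ i j → ~trans (E-cong i (H-h j a x)) (~trans (E-+ i _ _)
               (+-cong (E-h i a (H j x)) (E-before i j)))) ⟩
        sum₂ (suc D) (suc D) m (λ i j → (h a * Φ x i j + h a₁ * Φᵢ i j) + Φⱼ i j)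
          ≈⟨ ~trans (sum₂-+ (suc D) (suc D) m (λ i j → h a * Φ x i j + h a₁ * Φᵢ i j) Φⱼ)
                    (+-congʳ (sum₂-+ (suc D) (suc D) m (λ i j → h a * Φ x i j) (λ i j → h a₁ * Φᵢ i j))) ⟩
        _ ≈⟨ +-cong (+-cong (sum₂-* (suc D) (suc D) m (h a) (Φ x)) (sum₂-* (suc D) (suc D) m (h a₁) Φᵢ))
                    (sum₂-shift-j (suc D) D m (Φ y)) ⟩
        _ ≈⟨ +-cong (+-cong (*-congˡ (~sym (B-large m x (ℕP.m≤n⇒m≤1+n x<) (ℕP.m≤n⇒m≤1+n x<))))
                            (*-congˡ (~trans (sum₂-shift-i D (suc D) m (Φ x)) (-‿cong (~sym (B-large m₁ x x< (ℕP.m≤n⇒m≤1+n x<)))))))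
                    (*-congˡ (~sym (B-large m₁ y (ℕP.m≤n⇒m≤1+n y<) y<))) ⟩
        (h a * B m x + h a₁ * - B m₁ x) + τ * B m₁ y ∎

-- The Hall adjoints on Λ

module Λ = CommutativeRing polyRing

open Bernstein polyRing hZ using (sumTo; sumTo-cong; sumTo-0#)

const : ℤ → ℕ → Poly
const c n = mono c n []

hmono : List ℕ → Poly
hmono hs = mono (+ 1) 0 hs

record ΛLinear (φ : Poly → Poly) : Set where
  field
    cong   : ∀ {p q} → p ≃ q → φ p ≃ φ q
    +-hom  : ∀ p q → φ (p +P q) ≃ φ p +P φ q
    scalar : ∀ c n p → φ (const c n *P p) ≃ const c n *P φ p

  0-hom : φ 0P ≃ 0P
  0-hom = Λ.trans (scalar (+ 0) 0 []) (≃-trans (const-0 (φ 0P)) ≃-refl)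
    where
    const-0 : ∀ p → const (+ 0) 0 *P p ≃ 0P
    const-0 p = mk λ n ms → ≡.trans (coeff-mono-*P (+ 0) 0 [] p n ms) refl

mono-hmono : ∀ c n hs → mono c n hs ≃ const c n *P hmono hs
mono-hmono c n hs = ≃-trans (≃-reflexive (≡.cong₂ (λ c n → mono c n hs) (≡.sym (ℤP.*-identityʳ c)) (≡.sym (ℕP.+-identityʳ n))))
  (mono-key (c ℤ.* + 1) (refl , ≡.sym (sort-sort hs)))

ΛLinear-ext : ∀ {φ ψ} → ΛLinear φ → ΛLinear ψ → (∀ hs → φ (hmono hs) ≃ ψ (hmono hs)) → ∀ p → φ p ≃ ψ p
ΛLinear-ext {φ} {ψ} L M e []                   = ≃-trans (ΛLinear.0-hom L) (≃-sym (ΛLinear.0-hom M))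
ΛLinear-ext {φ} {ψ} L M e ((c , (n , hs)) ∷ p) = begin
  φ (mono c n hs +P p)                      ≈⟨ M₁.+-hom (mono c n hs) p ⟩
  φ (mono c n hs) +P φ p                    ≈⟨ +P-cong (≃-trans (M₁.cong (mono-hmono c n hs)) (M₁.scalar c n (hmono hs))) (ΛLinear-ext L M e p) ⟩
  const c n *P φ (hmono hs) +P ψ p          ≈⟨ +P-cong (*P-cong (≃-refl {const c n}) (e hs)) ≃-refl ⟩
  const c n *P ψ (hmono hs) +P ψ p
    ≈⟨ +P-cong (≃-trans (M₂.cong (mono-hmono c n hs)) (M₂.scalar c n (hmono hs))) (≃-refl {ψ p}) ⟨
  ψ (mono c n hs) +P ψ p                    ≈⟨ M₂.+-hom (mono c n hs) p ⟨
  ψ (mono c n hs +P p) ∎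
  where open ≃-Reasoning
        module M₁ = ΛLinear L
        module M₂ = ΛLinear M

*P-swap : ∀ a b c → a *P (b *P c) ≃ b *P (a *P c)
*P-swap a b c = ≃-trans (≃-sym (*P-assoc a b c)) (≃-trans (*P-cong (*P-comm a b) (≃-refl {c})) (*P-assoc b a c))

*P-ΛLinear : ∀ x → ΛLinear (x *P_)
*P-ΛLinear x = record { cong = *P-cong (≃-refl {x}) ; +-hom = *P-distribˡ x ; scalar = λ c n p → *P-swap x (const c n) p }

∘-ΛLinear : ∀ {φ ψ} → ΛLinear φ → ΛLinear ψ → ΛLinear (φ ∘ ψ)
∘-ΛLinear L M = record
  { cong = λ e → ΛLinear.cong L (ΛLinear.cong M e)
  ; +-hom = λ p q → ≃-trans (ΛLinear.cong L (ΛLinear.+-hom M p q)) (ΛLinear.+-hom L _ _)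
  ; scalar = λ c n p → ≃-trans (ΛLinear.cong L (ΛLinear.scalar M c n p)) (ΛLinear.scalar L c n _) }

+-ΛLinear : ∀ {φ ψ} → ΛLinear φ → ΛLinear ψ → ΛLinear (λ p → φ p +P ψ p)
+-ΛLinear {φ} {ψ} L M = record
  { cong = λ e → +P-cong (ΛLinear.cong L e) (ΛLinear.cong M e)
  ; +-hom = λ p q → ≃-trans (+P-cong (ΛLinear.+-hom L p q) (ΛLinear.+-hom M p q)) (+P-interchange (φ p) (φ q) (ψ p) (ψ q))
  ; scalar = λ c n p → ≃-trans (+P-cong (ΛLinear.scalar L c n p) (ΛLinear.scalar M c n p)) (≃-sym (*P-distribˡ (const c n) (φ p) (ψ p))) }

0-ΛLinear : ΛLinear (λ _ → 0P)
0-ΛLinear = record { cong = λ _ → ≃-refl ; +-hom = λ _ _ → ≃-refl ; scalar = λ _ _ _ → ≃-refl }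

scaleZ-const : ∀ c p → scaleZ c p ≃ const c 0 *P p
scaleZ-const c []                   = ≃-refl
scaleZ-const c ((d , (m , ks)) ∷ p) = ∷-cong (c ℤ.* d) (refl , ≡.sym (sort-sort ks)) (scaleZ-const c p)

powP-const : ∀ n → powP tP n ≡ const (+ 1) n
powP-const zero    = refl
powP-const (suc n) = ≡.cong (tP *P_) (powP-const n)

liftMon-∷ : ∀ F c n hs p → liftMon F ((c , (n , hs)) ∷ p) ≃ const c n *P F hs +P liftMon F p
liftMon-∷ F c n hs p = +P-cong (begin
  scaleZ c (powP tP n *P F hs)            ≈⟨ scaleZ-const c (powP tP n *P F hs) ⟩
  const c 0 *P (powP tP n *P F hs)        ≡⟨ ≡.cong (λ z → const c 0 *P (z *P F hs)) (powP-const n) ⟩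
  const c 0 *P (const (+ 1) n *P F hs)    ≈⟨ *P-assoc (const c 0) (const (+ 1) n) (F hs) ⟨
  const (c ℤ.* + 1) n *P F hs             ≡⟨ ≡.cong (λ z → const z n *P F hs) (ℤP.*-identityʳ c) ⟩
  const c n *P F hs ∎) (≃-refl {liftMon F p})
  where open ≃-Reasoning

liftMon-hmono : ∀ F hs → liftMon F (hmono hs) ≃ F hs
liftMon-hmono F hs = ≃-trans (liftMon-∷ F (+ 1) 0 hs []) (≃-trans (+P-identityʳ _) (*P-identityˡ (F hs)))

coeff-liftMon : ∀ F p k ms → coeff (liftMon F p) k ms ≡ pairing (λ n hs → coeff (const (+ 1) n *P F hs) k ms) p
coeff-liftMon F []                   k ms = refl
coeff-liftMon F ((c , (n , hs)) ∷ p) k ms = begin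
  coeff (liftMon F ((c , (n , hs)) ∷ p)) k ms             ≡⟨ at (liftMon-∷ F c n hs p) k ms ⟩
  coeff (const c n *P F hs +P liftMon F p) k ms           ≡⟨ coeff-++ (const c n *P F hs) (liftMon F p) k ms ⟩
  coeff (const c n *P F hs) k ms ℤ.+ coeff (liftMon F p) k ms
    ≡⟨ ≡.cong₂ ℤ._+_ (coeff-mono-*P c n [] (F hs) k ms) (coeff-liftMon F p k ms) ⟩
  _ ∎
  where open ≡.≡-Reasoning

-- Monomials are multisets, so for the linear extension to respect equality `F` must not see the
-- order of the factors.
liftMon-ΛLinear : ∀ F → (∀ hs → F hs ≃ F (sortℕ hs)) → ΛLinear (liftMon F)
liftMon-ΛLinear F F-sort = record { cong = cong ; +-hom = +-hom ; scalar = scalar }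
  where
  F-key : ∀ {n hs n′ hs′} → SameKey n hs n′ hs′ → const (+ 1) n *P F hs ≃ const (+ 1) n′ *P F hs′
  F-key {n} {hs} {_} {hs′} (refl , e) = *P-cong (≃-refl {const (+ 1) n})
    (≃-trans (F-sort hs) (≃-trans (≃-reflexive (≡.cong F e)) (≃-sym (F-sort hs′))))
  cong : ∀ {p q} → p ≃ q → liftMon F p ≃ liftMon F q
  cong {p} {q} e = mk λ k ms → ≡.trans (coeff-liftMon F p k ms) (≡.trans
    (pairing-cong (λ n hs → coeff (const (+ 1) n *P F hs) k ms) {p} {q} (λ s → at (F-key s) k ms) (at e))
    (≡.sym (coeff-liftMon F q k ms)))
  +-hom : ∀ p q → liftMon F (p +P q) ≃ liftMon F p +P liftMon F q
  +-hom []                   q = ≃-refl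
  +-hom ((c , (n , hs)) ∷ p) q = begin
    liftMon F ((c , (n , hs)) ∷ (p +P q))                       ≈⟨ liftMon-∷ F c n hs (p +P q) ⟩
    const c n *P F hs +P liftMon F (p +P q)                     ≈⟨ +P-cong (≃-refl {const c n *P F hs}) (+-hom p q) ⟩
    const c n *P F hs +P (liftMon F p +P liftMon F q)           ≡⟨ ++-assoc (const c n *P F hs) _ _ ⟨
    (const c n *P F hs +P liftMon F p) +P liftMon F q           ≈⟨ +P-cong (liftMon-∷ F c n hs p) (≃-refl {liftMon F q}) ⟨
    liftMon F ((c , (n , hs)) ∷ p) +P liftMon F q ∎
    where open ≃-Reasoning
  scalar : ∀ c n p → liftMon F (const c n *P p) ≃ const c n *P liftMon F p
  scalar c n []                   = ≃-refl
  scalar c n ((d , (m , ks)) ∷ p) = begin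
    liftMon F ((c ℤ.* d , (n ℕ.+ m , sortℕ ks)) ∷ (const c n *P p))
      ≈⟨ liftMon-∷ F (c ℤ.* d) (n ℕ.+ m) (sortℕ ks) (const c n *P p) ⟩
    const (c ℤ.* d) (n ℕ.+ m) *P F (sortℕ ks) +P liftMon F (const c n *P p)
      ≈⟨ +P-cong (≃-trans (*P-cong (≃-refl {const c n *P const d m}) (≃-sym (F-sort ks))) (*P-assoc (const c n) (const d m) (F ks))) (scalar c n p) ⟩
    const c n *P (const d m *P F ks) +P const c n *P liftMon F p
      ≈⟨ *P-distribˡ (const c n) (const d m *P F ks) (liftMon F p) ⟨
    const c n *P (const d m *P F ks +P liftMon F p)
      ≈⟨ *P-cong (≃-refl {const c n}) (liftMon-∷ F d m ks p) ⟨
    const c n *P liftMon F ((d , (m , ks)) ∷ p) ∎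
    where open ≃-Reasoning

sumP-++ : ∀ ps qs → sumP (ps ++ qs) ≡ sumP ps +P sumP qs
sumP-++ []       qs = refl
sumP-++ (p ∷ ps) qs = ≡.trans (≡.cong (p +P_) (sumP-++ ps qs)) (≡.sym (++-assoc p (sumP ps) (sumP qs)))

sumP-applyUpTo : ∀ (f : ℕ → Poly) g n → sumP (map f (applyUpTo g n)) ≡ sumTo n (f ∘ g)
sumP-applyUpTo f g zero    = refl
sumP-applyUpTo f g (suc n) = ≡.cong (f (g 0) +P_) (sumP-applyUpTo f (g ∘ suc) n)

-- Insertion sort consists of exchanges of neighbours behind a common prefix. The index `j` varies
-- because taking off the prefix changes it.
sort-invariant : ∀ {J : Set} (F : J → List ℕ → Poly) →
  (∀ j x {xs ys} → (∀ j → F j xs ≃ F j ys) → F j (x ∷ xs) ≃ F j (x ∷ ys)) →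
  (∀ j x y xs → F j (x ∷ y ∷ xs) ≃ F j (y ∷ x ∷ xs)) → ∀ hs j → F j hs ≃ F j (sortℕ hs)
sort-invariant F extend exchange []       j = ≃-refl
sort-invariant F extend exchange (x ∷ hs) j = ≃-trans (extend j x (sort-invariant F extend exchange hs)) (insert (sortℕ hs) j)
  where
  insert : ∀ ys j → F j (x ∷ ys) ≃ F j (insertℕ x ys)
  insert []       j = ≃-refl
  insert (y ∷ ys) j with x ≤ᵇ y
  ... | true  = ≃-refl
  ... | false = ≃-trans (exchange j x y ys) (extend j y (insert ys))

hperpMon-unfold : ∀ j a as → hperpMon j (a ∷ as) ≡ sumTo (suc j) (λ c → hZ (+ a ℤ.- + c) *P hperpMon (j ℕ.∸ c) as)
hperpMon-unfold zero    a as = sumP-applyUpTo (λ c → hZ (+ a ℤ.- + c) *P hperpMon (0 ℕ.∸ c) as) (λ c → c) 1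
hperpMon-unfold (suc j) a as = sumP-applyUpTo (λ c → hZ (+ a ℤ.- + c) *P hperpMon (suc j ℕ.∸ c) as) (λ c → c) (suc (suc j))

hperpMon-cons : ∀ j a {xs ys} → (∀ j → hperpMon j xs ≃ hperpMon j ys) → hperpMon j (a ∷ xs) ≃ hperpMon j (a ∷ ys)
hperpMon-cons j a {xs} {ys} e = ≃-trans (≃-reflexive (hperpMon-unfold j a xs)) (≃-trans
  (sumTo-cong (suc j) λ c → *P-cong (≃-refl {hZ (+ a ℤ.- + c)}) (e (j ℕ.∸ c)))
  (≃-reflexive (≡.sym (hperpMon-unfold j a ys))))

-- An index 0 stands for the factor h_0 = 1, to which only `c = 0` contributes.
hperpMon-zero : ∀ j as → hperpMon j (0 ∷ as) ≃ hperpMon j as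
hperpMon-zero j as = ≃-trans (≃-reflexive (hperpMon-unfold j 0 as)) (≃-trans
  (+P-cong (*P-identityˡ (hperpMon j as)) (sumTo-0# j {λ c → hZ (+ 0 ℤ.- + suc c) *P hperpMon (j ℕ.∸ suc c) as} (λ c → ≃-refl)))
  (+P-identityʳ (hperpMon j as)))

-- The term `c = 0` is split off; in the others `a` and `c` drop together and the index of h is
-- unchanged. In this two-term form the coproduct rule extends to operators in `hperp-h`.
hperpMon-suc : ∀ j a as → hperpMon j (suc a ∷ as) ≃
  hZ (+ suc a) *P hperpMon j as +P before 0P (λ j → hperpMon j (a ∷ as)) j
hperpMon-suc zero    a as = ≃-trans (≃-reflexive (hperpMon-unfold 0 (suc a) as))
  (≃-reflexive (≡.cong (λ z → hZ z *P hperpMon 0 as +P 0P) (ℤP.+-identityʳ (+ suc a))))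
hperpMon-suc (suc j) a as = ≃-trans (≃-reflexive (hperpMon-unfold (suc j) (suc a) as)) (+P-cong
  (≃-reflexive (≡.cong (λ z → hZ z *P hperpMon (suc j) as) (ℤP.+-identityʳ (+ suc a))))
  (≃-trans (sumTo-cong (suc j) λ c → ≃-reflexive (≡.cong (λ z → hZ z *P hperpMon (j ℕ.∸ c) as) (lemma (+ a) (+ c))))
    (≃-reflexive (≡.sym (hperpMon-unfold j a as)))))
  where lemma : ∀ a c → (+ 1 ℤ.+ a) ℤ.- (+ 1 ℤ.+ c) ≡ a ℤ.- c
        lemma = solve-∀

symmetric-expansion : ∀ p q r s u v → p *P (q *P r +P u) +P (q *P s +P v) ≃ q *P (p *P r +P s) +P (p *P u +P v)
symmetric-expansion p q r s u v = begin
  p *P (q *P r +P u) +P (q *P s +P v)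
    ≈⟨ +P-cong (*P-distribˡ p (q *P r) u) (≃-refl {q *P s +P v}) ⟩
  (p *P (q *P r) +P p *P u) +P (q *P s +P v)
    ≈⟨ +P-interchange (p *P (q *P r)) (p *P u) (q *P s) v ⟩
  (p *P (q *P r) +P q *P s) +P (p *P u +P v)
    ≈⟨ +P-cong (+P-cong (*P-swap p q r) (≃-refl {q *P s})) (≃-refl {p *P u +P v}) ⟩
  (q *P (p *P r) +P q *P s) +P (p *P u +P v)
    ≈⟨ +P-cong (*P-distribˡ q (p *P r) s) (≃-refl {p *P u +P v}) ⟨
  q *P (p *P r +P s) +P (p *P u +P v) ∎
  where open ≃-Reasoning

-- After both heads are expanded, what is not visibly symmetric is the same exchange with smaller
-- parts, for which the recursion is called.
hperpMon-swap : ∀ j a b as → hperpMon j (a ∷ b ∷ as) ≃ hperpMon j (b ∷ a ∷ as)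
hperpMon-swap j zero    b       as = ≃-trans (hperpMon-zero j (b ∷ as)) (hperpMon-cons j b λ j → ≃-sym (hperpMon-zero j as))
hperpMon-swap j (suc a) zero    as = ≃-trans (hperpMon-cons j (suc a) λ j → hperpMon-zero j as) (≃-sym (hperpMon-zero j (suc a ∷ as)))
hperpMon-swap j (suc a) (suc b) as = begin
  H j (suc a ∷ suc b ∷ as)
    ≈⟨ hperpMon-suc j a (suc b ∷ as) ⟩
  ha *P H j (suc b ∷ as) +P before 0P (λ j → H j (a ∷ suc b ∷ as)) j
    ≈⟨ +P-cong (*P-cong (≃-refl {ha}) (hperpMon-suc j b as)) (tail j) ⟩
  ha *P (hb *P H j as +P before 0P (λ j → H j (b ∷ as)) j)
    +P (hb *P before 0P (λ j → H j (a ∷ as)) j +P before 0P (before 0P (λ j → H j (b ∷ a ∷ as))) j)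
    ≈⟨ symmetric-expansion ha hb (H j as) (before 0P (λ j → H j (a ∷ as)) j) (before 0P (λ j → H j (b ∷ as)) j) _ ⟩
  hb *P (ha *P H j as +P before 0P (λ j → H j (a ∷ as)) j)
    +P (ha *P before 0P (λ j → H j (b ∷ as)) j +P before 0P (before 0P (λ j → H j (b ∷ a ∷ as))) j)
    ≈⟨ +P-cong (*P-cong (≃-refl {hb}) (hperpMon-suc j a as)) (tail′ j) ⟨
  hb *P H j (suc a ∷ as) +P before 0P (λ j → H j (b ∷ suc a ∷ as)) j
    ≈⟨ hperpMon-suc j b (suc a ∷ as) ⟨
  H j (suc b ∷ suc a ∷ as) ∎
  where
  open ≃-Reasoning
  H = hperpMon
  ha = hZ (+ suc a)
  hb = hZ (+ suc b)
  tail : ∀ j → before 0P (λ j → H j (a ∷ suc b ∷ as)) j ≃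
    hb *P before 0P (λ j → H j (a ∷ as)) j +P before 0P (before 0P (λ j → H j (b ∷ a ∷ as))) j
  tail zero    = ≃-sym (≃-trans (+P-identityʳ _) (*P-zeroʳ hb))
  tail (suc j) = ≃-trans (hperpMon-swap j a (suc b) as) (hperpMon-suc j b (a ∷ as))
  tail′ : ∀ j → before 0P (λ j → H j (b ∷ suc a ∷ as)) j ≃
    ha *P before 0P (λ j → H j (b ∷ as)) j +P before 0P (before 0P (λ j → H j (b ∷ a ∷ as))) j
  tail′ zero          = ≃-sym (≃-trans (+P-identityʳ _) (*P-zeroʳ ha))
  tail′ (suc zero)    = ≃-trans (hperpMon-swap 0 b (suc a) as) (hperpMon-suc 0 a (b ∷ as))
  tail′ (suc (suc j)) = ≃-trans (hperpMon-swap (suc j) b (suc a) as) (≃-trans (hperpMon-suc (suc j) a (b ∷ as))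
    (+P-cong (≃-refl {ha *P H (suc j) (b ∷ as)}) (hperpMon-swap j a b as)))

hperp-ΛLinear : ∀ j → ΛLinear (hperp j)
hperp-ΛLinear j = liftMon-ΛLinear (hperpMon j) (λ hs → sort-invariant hperpMon (λ j x → hperpMon-cons j x) hperpMon-swap hs j)

eperpMon-unfold : ∀ i a as → eperpMon i (a ∷ as) ≃
  hZ (+ a) *P eperpMon i as +P hZ (ℤ.pred (+ a)) *P before 0P (λ i → eperpMon i as) i
eperpMon-unfold zero    a as = ≃-sym (≃-trans (+P-cong (≃-refl {hZ (+ a) *P eperpMon 0 as}) (*P-zeroʳ (hZ (ℤ.pred (+ a))))) (+P-identityʳ _))
eperpMon-unfold (suc i) a as = +P-cong (≃-refl {hZ (+ a) *P eperpMon (suc i) as})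
  (≃-reflexive (≡.cong (λ z → hZ z *P eperpMon i as) (ℤP.+-comm (+ a) -[1+ 0 ])))

eperpMon-cons : ∀ i a {xs ys} → (∀ i → eperpMon i xs ≃ eperpMon i ys) → eperpMon i (a ∷ xs) ≃ eperpMon i (a ∷ ys)
eperpMon-cons zero    a e = *P-cong (≃-refl {hZ (+ a)}) (e 0)
eperpMon-cons (suc i) a e = +P-cong (*P-cong (≃-refl {hZ (+ a)}) (e (suc i))) (*P-cong (≃-refl {hZ (+ a ℤ.- + 1)}) (e i))

eperpMon-swap : ∀ i a b as → eperpMon i (a ∷ b ∷ as) ≃ eperpMon i (b ∷ a ∷ as)
eperpMon-swap i a b as = begin
  eperpMon i (a ∷ b ∷ as)
    ≈⟨ expand i a b ⟩
  h₁ *P (h₂ *P E₀ +P l₂ *P E₁) +P (h₂ *P (l₁ *P E₁) +P l₁ *P (l₂ *P E₂))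
    ≈⟨ symmetric-expansion h₁ h₂ E₀ (l₁ *P E₁) (l₂ *P E₁) (l₁ *P (l₂ *P E₂)) ⟩
  h₂ *P (h₁ *P E₀ +P l₁ *P E₁) +P (h₁ *P (l₂ *P E₁) +P l₁ *P (l₂ *P E₂))
    ≈⟨ +P-cong (≃-refl {h₂ *P (h₁ *P E₀ +P l₁ *P E₁)}) (+P-cong (≃-refl {h₁ *P (l₂ *P E₁)}) (*P-swap l₁ l₂ E₂)) ⟩
  h₂ *P (h₁ *P E₀ +P l₁ *P E₁) +P (h₁ *P (l₂ *P E₁) +P l₂ *P (l₁ *P E₂))
    ≈⟨ expand i b a ⟨
  eperpMon i (b ∷ a ∷ as) ∎
  where
  open ≃-Reasoning
  h₁ = hZ (+ a)
  h₂ = hZ (+ b)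
  l₁ = hZ (ℤ.pred (+ a))
  l₂ = hZ (ℤ.pred (+ b))
  E₀ = eperpMon i as
  E₁ = before 0P (λ i → eperpMon i as) i
  E₂ = before 0P (before 0P (λ i → eperpMon i as)) i
  expand : ∀ i a b → eperpMon i (a ∷ b ∷ as) ≃
    hZ (+ a) *P (hZ (+ b) *P eperpMon i as +P hZ (ℤ.pred (+ b)) *P before 0P (λ i → eperpMon i as) i)
    +P (hZ (+ b) *P (hZ (ℤ.pred (+ a)) *P before 0P (λ i → eperpMon i as) i)
        +P hZ (ℤ.pred (+ a)) *P (hZ (ℤ.pred (+ b)) *P before 0P (before 0P (λ i → eperpMon i as)) i))
  expand i a b = ≃-trans (eperpMon-unfold i a (b ∷ as)) (+P-cong (*P-cong (≃-refl {hZ (+ a)}) (eperpMon-unfold i b as)) (lowered i))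
    where
    la = hZ (ℤ.pred (+ a))
    lb = hZ (ℤ.pred (+ b))
    lowered : ∀ i → la *P before 0P (λ i → eperpMon i (b ∷ as)) i ≃
      hZ (+ b) *P (la *P before 0P (λ i → eperpMon i as) i) +P la *P (lb *P before 0P (before 0P (λ i → eperpMon i as)) i)
    lowered zero    = ≃-trans (*P-zeroʳ la) (≃-sym (≃-trans
      (+P-cong (≃-trans (*P-cong (≃-refl {hZ (+ b)}) (*P-zeroʳ la)) (*P-zeroʳ (hZ (+ b)))) (≃-trans (*P-cong (≃-refl {la}) (*P-zeroʳ lb)) (*P-zeroʳ la)))
      ≃-refl))
    lowered (suc i) = ≃-trans (*P-cong (≃-refl {la}) (eperpMon-unfold i b as)) (≃-trans
      (*P-distribˡ la (hZ (+ b) *P eperpMon i as) (lb *P before 0P (λ i → eperpMon i as) i))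
      (+P-cong (*P-swap la (hZ (+ b)) (eperpMon i as)) (≃-refl {la *P (lb *P before 0P (λ i → eperpMon i as) i)})))

eperp-ΛLinear : ∀ i → ΛLinear (eperp i)
eperp-ΛLinear i = liftMon-ΛLinear (eperpMon i) (λ hs → sort-invariant eperpMon (λ i x → eperpMon-cons i x) eperpMon-swap hs i)

before-ΛLinear : ∀ (φ : ℕ → Poly → Poly) → (∀ i → ΛLinear (φ i)) → ∀ i → ΛLinear (λ p → before 0P (λ i → φ i p) i)
before-ΛLinear φ L zero    = 0-ΛLinear
before-ΛLinear φ L (suc i) = L i

hZ-hmono : ∀ a hs → hZ (+ suc a) *P hmono hs ≃ hmono (suc a ∷ hs)
hZ-hmono a hs = mono-key (+ 1) (refl , sort-sort (suc a ∷ hs))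

hperp-hZ-hmono : ∀ j a hs → hperp j (hZ (+ a) *P hmono hs) ≃ hperpMon j (a ∷ hs)
hperp-hZ-hmono j zero    hs = ≃-trans (ΛLinear.cong (hperp-ΛLinear j) (*P-identityˡ (hmono hs)))
  (≃-trans (liftMon-hmono (hperpMon j) hs) (≃-sym (hperpMon-zero j hs)))
hperp-hZ-hmono j (suc a) hs = ≃-trans (ΛLinear.cong (hperp-ΛLinear j) (hZ-hmono a hs)) (liftMon-hmono (hperpMon j) (suc a ∷ hs))

hperp-h : ∀ j a p → hperp j (hZ a *P p) ≃ hZ a *P hperp j p +P before 0P (λ j → hperp j (hZ (ℤ.pred a) *P p)) j
hperp-h j a = ΛLinear-ext
  (∘-ΛLinear (hperp-ΛLinear j) (*P-ΛLinear (hZ a)))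
  (+-ΛLinear (∘-ΛLinear (*P-ΛLinear (hZ a)) (hperp-ΛLinear j))
    (before-ΛLinear (λ j p → hperp j (hZ (ℤ.pred a) *P p)) (λ j → ∘-ΛLinear (hperp-ΛLinear j) (*P-ΛLinear (hZ (ℤ.pred a)))) j))
  (on-hmono j a)
  where
  on-hmono : ∀ j a hs → hperp j (hZ a *P hmono hs) ≃
    hZ a *P hperp j (hmono hs) +P before 0P (λ j → hperp j (hZ (ℤ.pred a) *P hmono hs)) j
  on-hmono zero    -[1+ n ]  hs = ≃-refl
  on-hmono (suc j) -[1+ n ]  hs = ≃-refl
  on-hmono j       (+ zero)  hs = ≃-trans (ΛLinear.cong (hperp-ΛLinear j) (*P-identityˡ (hmono hs)))
    (≃-sym (≃-trans (+P-cong (*P-identityˡ (hperp j (hmono hs))) (vanish j)) (+P-identityʳ _)))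
    where
    vanish : ∀ j → before 0P (λ j → hperp j (hZ -[1+ 0 ] *P hmono hs)) j ≃ 0P
    vanish zero    = ≃-refl
    vanish (suc j) = ≃-refl
  on-hmono j       (+ suc a) hs = ≃-trans (hperp-hZ-hmono j (suc a) hs) (≃-trans (hperpMon-suc j a hs)
    (+P-cong (*P-cong (≃-refl {hZ (+ suc a)}) (≃-sym (liftMon-hmono (hperpMon j) hs))) (lowered j)))
    where
    lowered : ∀ j → before 0P (λ j → hperpMon j (a ∷ hs)) j ≃ before 0P (λ j → hperp j (hZ (+ a) *P hmono hs)) j
    lowered zero    = ≃-refl
    lowered (suc j) = ≃-sym (hperp-hZ-hmono j a hs)

eperp-h : ∀ i a p → eperp i (hZ a *P p) ≃ hZ a *P eperp i p +P hZ (ℤ.pred a) *P before 0P (λ i → eperp i p) i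
eperp-h i a = ΛLinear-ext
  (∘-ΛLinear (eperp-ΛLinear i) (*P-ΛLinear (hZ a)))
  (+-ΛLinear (∘-ΛLinear (*P-ΛLinear (hZ a)) (eperp-ΛLinear i))
    (∘-ΛLinear (*P-ΛLinear (hZ (ℤ.pred a))) (before-ΛLinear eperp eperp-ΛLinear i)))
  (on-hmono i a)
  where
  on-hmono : ∀ i a hs → eperp i (hZ a *P hmono hs) ≃
    hZ a *P eperp i (hmono hs) +P hZ (ℤ.pred a) *P before 0P (λ i → eperp i (hmono hs)) i
  on-hmono i -[1+ n ]  hs = ≃-refl
  on-hmono i (+ zero)  hs = ≃-trans (ΛLinear.cong (eperp-ΛLinear i) (*P-identityˡ (hmono hs)))
    (≃-sym (≃-trans (+P-identityʳ (1P *P eperp i (hmono hs))) (*P-identityˡ (eperp i (hmono hs)))))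
  on-hmono i (+ suc a) hs = ≃-trans (ΛLinear.cong (eperp-ΛLinear i) (hZ-hmono a hs)) (≃-trans (liftMon-hmono (eperpMon i) (suc a ∷ hs))
    (≃-trans (eperpMon-unfold i (suc a) hs) (+P-cong (*P-cong (≃-refl {hZ (+ suc a)}) (≃-sym (liftMon-hmono (eperpMon i) hs)))
      (*P-cong (≃-refl {hZ (+ a)}) (lowered i)))))
    where
    lowered : ∀ i → before 0P (λ i → eperpMon i hs) i ≃ before 0P (λ i → eperp i (hmono hs)) i
    lowered zero    = ≃-refl
    lowered (suc i) = ≃-sym (liftMon-hmono (eperpMon i) hs)

sumℕ : List ℕ → ℕ
sumℕ = foldr ℕ._+_ 0

hperpMon-vanish : ∀ hs j → sumℕ hs ℕ.< j → hperpMon j hs ≃ 0P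
hperpMon-vanish []           (suc j) lt = ≃-refl
hperpMon-vanish (zero ∷ hs)  j       lt = ≃-trans (hperpMon-zero j hs) (hperpMon-vanish hs j lt)
hperpMon-vanish (suc a ∷ hs) (suc j) lt = ≃-trans (hperpMon-suc (suc j) a hs) (+P-cong
  (≃-trans (*P-cong (≃-refl {hZ (+ suc a)}) (hperpMon-vanish hs (suc j) (ℕP.≤-<-trans (ℕP.m≤n+m _ (suc a)) lt))) (*P-zeroʳ (hZ (+ suc a))))
  (hperpMon-vanish (a ∷ hs) j (ℕP.≤-pred lt)))

-- Instead of bounding the degree of the list `hperpMon j hs`, the recursion follows `hperpMon-suc`,
-- which drops the head or lowers it, and lets e_i^⊥ act on the result by `eperp-h`.
eperp-hperpMon-vanish : ∀ hs i j → sumℕ hs ℕ.< i → eperp i (hperpMon j hs) ≃ 0P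
eperp-hperpMon-vanish []           (suc i) zero    lt = liftMon-hmono (eperpMon (suc i)) []
eperp-hperpMon-vanish []           (suc i) (suc j) lt = ≃-refl
eperp-hperpMon-vanish (zero ∷ hs)  i       j       lt =
  ≃-trans (ΛLinear.cong (eperp-ΛLinear i) (hperpMon-zero j hs)) (eperp-hperpMon-vanish hs i j lt)
eperp-hperpMon-vanish (suc a ∷ hs) (suc i) j       lt = begin
  eperp (suc i) (hperpMon j (suc a ∷ hs))
    ≈⟨ ΛLinear.cong L (hperpMon-suc j a hs) ⟩
  eperp (suc i) (hZ (+ suc a) *P hperpMon j hs +P before 0P (λ j → hperpMon j (a ∷ hs)) j)
    ≈⟨ ΛLinear.+-hom L (hZ (+ suc a) *P hperpMon j hs) _ ⟩
  eperp (suc i) (hZ (+ suc a) *P hperpMon j hs) +P eperp (suc i) (before 0P (λ j → hperpMon j (a ∷ hs)) j)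
    ≈⟨ +P-cong (eperp-h (suc i) (+ suc a) (hperpMon j hs)) (second j) ⟩
  (hZ (+ suc a) *P eperp (suc i) (hperpMon j hs) +P hZ (+ a) *P eperp i (hperpMon j hs)) +P 0P
    ≈⟨ +P-cong (+P-cong (first (+ suc a) (suc i) (ℕP.≤-<-trans (ℕP.m≤n+m _ (suc a)) lt))
                        (first (+ a) i (ℕP.≤-<-trans (ℕP.m≤n+m _ a) (ℕP.≤-pred lt)))) (≃-refl {0P}) ⟩
  0P ∎
  where
  open ≃-Reasoning
  L = eperp-ΛLinear (suc i)
  first : ∀ b i → sumℕ hs ℕ.< i → hZ b *P eperp i (hperpMon j hs) ≃ 0P
  first b i lt = ≃-trans (*P-cong (≃-refl {hZ b}) (eperp-hperpMon-vanish hs i j lt)) (*P-zeroʳ (hZ b))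
  second : ∀ j → eperp (suc i) (before 0P (λ j → hperpMon j (a ∷ hs)) j) ≃ 0P
  second zero    = ≃-refl
  second (suc j) = eperp-hperpMon-vanish (a ∷ hs) (suc i) j (ℕP.≤-trans (s≤s (ℕP.n≤1+n _)) lt)

hperp-deg : ∀ j p → degP p ℕ.< j → hperp j p ≃ 0P
hperp-deg j []                   lt = ≃-refl
hperp-deg j ((c , (n , hs)) ∷ p) lt = ≃-trans (liftMon-∷ (hperpMon j) c n hs p) (+P-cong
  (≃-trans (*P-cong (≃-refl {const c n}) (hperpMon-vanish hs j (ℕP.≤-<-trans (ℕP.m≤m⊔n (sumℕ hs) _) lt))) (*P-zeroʳ (const c n)))
  (hperp-deg j p (ℕP.≤-<-trans (ℕP.m≤n⊔m (sumℕ hs) _) lt)))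

eperp-hperp-deg : ∀ i j p → degP p ℕ.< i → eperp i (hperp j p) ≃ 0P
eperp-hperp-deg i j []                   lt = ≃-refl
eperp-hperp-deg i j ((c , (n , hs)) ∷ p) lt = begin
  eperp i (hperp j ((c , (n , hs)) ∷ p))
    ≈⟨ ΛLinear.cong L (liftMon-∷ (hperpMon j) c n hs p) ⟩
  eperp i (const c n *P hperpMon j hs +P hperp j p)
    ≈⟨ ΛLinear.+-hom L (const c n *P hperpMon j hs) (hperp j p) ⟩
  eperp i (const c n *P hperpMon j hs) +P eperp i (hperp j p)
    ≈⟨ +P-cong (≃-trans (ΛLinear.scalar L c n (hperpMon j hs)) (≃-trans
         (*P-cong (≃-refl {const c n}) (eperp-hperpMon-vanish hs i j (ℕP.≤-<-trans (ℕP.m≤m⊔n (sumℕ hs) _) lt))) (*P-zeroʳ (const c n))))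
       (eperp-hperp-deg i j p (ℕP.≤-<-trans (ℕP.m≤n⊔m (sumℕ hs) _) lt)) ⟩
  0P ∎
  where open ≃-Reasoning
        L = eperp-ΛLinear i

-- The operators B_m on Λ and their quadratic relation

module BO = Bernstein.Operators polyRing hZ tP signP ≃-refl (λ _ → ≃-refl) (powP tP) ≃-refl (λ _ → ≃-refl)
  eperp hperp
  (λ i → ΛLinear.cong (eperp-ΛLinear i)) (λ i → ΛLinear.+-hom (eperp-ΛLinear i))
  (λ j → ΛLinear.cong (hperp-ΛLinear j)) (λ j → ΛLinear.+-hom (hperp-ΛLinear j))
  eperp-h hperp-h degP eperp-hperp-deg hperp-deg

sumP-concatMap : ∀ (f : ℕ → List Poly) g n → sumP (concatMap f (applyUpTo g n)) ≡ sumTo n (λ i → sumP (f (g i)))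
sumP-concatMap f g zero    = refl
sumP-concatMap f g (suc n) = ≡.trans (sumP-++ (f (g 0)) _) (≡.cong (sumP (f (g 0)) +P_) (sumP-concatMap f (g ∘ suc) n))

Bop≃ : ∀ m f → Bop m f ≃ BO.B m f
Bop≃ m f = ≃-trans (≃-reflexive (sumP-concatMap (λ i → map (term i) (range D)) (λ i → i) (suc D)))
  (sumTo-cong (suc D) λ i → ≃-reflexive (sumP-applyUpTo (term i) (λ j → j) (suc D)))
  where
  D = degP f
  term : ℕ → ℕ → Poly
  term i j = signP i *P powP tP j *P hZ (m ℤ.+ + i ℤ.+ + j) *P eperp i (hperp j f)

Bop-cong : ∀ m {f g} → f ≃ g → Bop m f ≃ Bop m g
Bop-cong m {f} {g} e = ≃-trans (Bop≃ m f) (≃-trans (BO.B-cong m e) (≃-sym (Bop≃ m g)))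

Bop-+ : ∀ m f g → Bop m (f +P g) ≃ Bop m f +P Bop m g
Bop-+ m f g = ≃-trans (Bop≃ m (f +P g)) (≃-trans (BO.B-+ m f g) (≃-sym (+P-cong (Bop≃ m f) (Bop≃ m g))))

Bop-scalar : ∀ m c n f → Bop m (const c n *P f) ≃ const c n *P Bop m f
Bop-scalar m c n f = ≃-trans (Bop≃ m (const c n *P f)) (≃-trans
  (BO.B-scalar (const c n) (λ i p → ΛLinear.scalar (eperp-ΛLinear i) c n p) (λ j p → ΛLinear.scalar (hperp-ΛLinear j) c n p) m f)
  (*P-cong (≃-refl {const c n}) (≃-sym (Bop≃ m f))))

Bop-ΛLinear : ∀ m → ΛLinear (Bop m)
Bop-ΛLinear m = record { cong = Bop-cong m ; +-hom = Bop-+ m ; scalar = Bop-scalar m }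

Bop-one : ∀ m → Bop m 1P ≃ hZ m
Bop-one m = ≃-trans (Bop≃ m 1P) (BO.B-one refl (≃-refl {1P}) m)

Bop-h : ∀ m a f → Bop m (hZ a *P f) -P tP *P Bop (ℤ.suc m) (hZ (ℤ.pred a) *P f) ≃
                  hZ a *P Bop m f -P hZ (ℤ.pred a) *P Bop (ℤ.suc m) f
Bop-h m a f = ≃-trans
  (+P-cong (Bop≃ m (hZ a *P f)) (negP-cong (*P-cong (≃-refl {tP}) (Bop≃ (ℤ.suc m) (hZ (ℤ.pred a) *P f)))))
  (≃-trans (BO.B-h m a f) (≃-sym
    (+P-cong (*P-cong (≃-refl {hZ a}) (Bop≃ m f)) (negP-cong (*P-cong (≃-refl {hZ (ℤ.pred a)}) (Bop≃ (ℤ.suc m) f))))))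

hZ-negative : ∀ n → hZ -[1+ n ] ≃ 0P
hZ-negative n = ≃-refl

open Determinants polyRing hZ public using (module U; module Vertex; det; Lap; jacobi-trudi)
open Vertex hZ-negative tP Bop Bop-cong Bop-+ (λ m → Bop-scalar m (+ 1) 1) Bop-one Bop-h public
  using (module V; quadratic; quadratic-cong; Quadratic; Quadratic-one; Quadratic-h; Fr-stair; signed-step; pairOps-zeros)

neg-ΛLinear : ∀ {φ} → ΛLinear φ → ΛLinear (λ p → negP (φ p))
neg-ΛLinear {φ} L = record
  { cong = λ e → negP-cong (ΛLinear.cong L e)
  ; +-hom = λ p q → ≃-trans (negP-cong (ΛLinear.+-hom L p q)) (≃-reflexive (map-++ _ (φ p) (φ q)))
  ; scalar = λ c n p → ≃-trans (negP-cong (ΛLinear.scalar L c n p)) (-‿distribʳ-* (const c n) (φ p)) }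
  where open import Algebra.Properties.Ring Λ.ring using (-‿distribʳ-*)

quadratic-ΛLinear : ∀ a b → ΛLinear (quadratic a b)
quadratic-ΛLinear a b = +-ΛLinear (BB a b ⊖ BB (ℤ.suc a) (ℤ.pred b)) (BB (ℤ.pred b) (ℤ.suc a) ⊖ BB b a)
  where
  BB : ∀ a b → ΛLinear (λ f → Bop a (Bop b f))
  BB a b = ∘-ΛLinear (Bop-ΛLinear a) (Bop-ΛLinear b)
  _⊖_ : ∀ {φ ψ} → ΛLinear φ → ΛLinear ψ → ΛLinear (λ f → φ f V.⊖ ψ f)
  L ⊖ M = +-ΛLinear L (neg-ΛLinear (∘-ΛLinear (*P-ΛLinear tP) M))

-- hmono (0 ∷ hs) differs from hmono hs as a Poly, but no operator sees the difference.
Bop-hmono-zero : ∀ m hs → Bop m (hmono (0 ∷ hs)) ≃ Bop m (hmono hs)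
Bop-hmono-zero m hs = ≃-trans (Bop≃ m (hmono (0 ∷ hs))) (≃-trans
  (BO.sum₂-cong D D m λ i j → ΛLinear.cong (eperp-ΛLinear i) (≃-trans (liftMon-hmono (hperpMon j) (0 ∷ hs))
    (≃-trans (hperpMon-zero j hs) (≃-sym (liftMon-hmono (hperpMon j) hs)))))
  (≃-sym (Bop≃ m (hmono hs))))
  where D = suc (degP (hmono hs))

-- Products of h's are built from 1 one factor at a time, and `Quadratic-h` takes each step.
Quadratic-hmono : ∀ hs → Quadratic (hmono hs)
Quadratic-hmono []           = Quadratic-one
Quadratic-hmono (zero ∷ hs)  a b = ≃-trans (+P-cong (V.⊖-cong (drop-zero a b) (drop-zero (ℤ.suc a) (ℤ.pred b)))
    (V.⊖-cong (drop-zero (ℤ.pred b) (ℤ.suc a)) (drop-zero b a)))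
  (Quadratic-hmono hs a b)
  where
  drop-zero : ∀ a b → Bop a (Bop b (hmono (0 ∷ hs))) ≃ Bop a (Bop b (hmono hs))
  drop-zero a b = Bop-cong a (Bop-hmono-zero b hs)
Quadratic-hmono (suc d ∷ hs) a b = ≃-trans (quadratic-cong a b {hmono (suc d ∷ hs)} {hZ (+ suc d) *P hmono hs} (≃-sym (hZ-hmono d hs)))
  (Quadratic-h {hmono hs} (Quadratic-hmono hs) (suc d) a b)

Bop-quadratic : ∀ f → Quadratic f
Bop-quadratic f a b = ΛLinear-ext (quadratic-ΛLinear a b) 0-ΛLinear (λ hs → Quadratic-hmono hs a b) f

-- Schur functions, B_α and root ideals in row form

private
  indices : ℕ → List ℕ → List (ℕ × ℕ)
  indices i []       = []
  indices i (x ∷ xs) = (i , x) ∷ indices (suc i) xs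

  -- Identifies the unnamed local function of `indexed` by its two equations; the later definitions
  -- with local functions are treated in the same way.
  indices-unique : ∀ (g : ℕ → List ℕ → List (ℕ × ℕ)) → (∀ i → g i [] ≡ []) →
    (∀ i x xs → g i (x ∷ xs) ≡ (i , x) ∷ g (suc i) xs) → ∀ i xs → g i xs ≡ indices i xs
  indices-unique g e f i []       = e i
  indices-unique g e f i (x ∷ xs) = ≡.trans (f i x xs) (≡.cong ((i , x) ∷_) (indices-unique g e f (suc i) xs))

  indexed-∷ : ∀ x (xs : ⊤ → List ℕ) u → indexed (x ∷ xs u) ≡ indices 0 (x ∷ xs u)
  indexed-∷ x xs u with List._∷_ x (xs u)
  ... | w with xs u | 1 | indices-unique _ (λ _ → refl) (λ _ _ _ → refl)
  ... | v | i | unique = ≡.cong (_ ∷_) (unique i v)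

  indexed-indices : ∀ xs → indexed xs ≡ indices 0 xs
  indexed-indices []       = refl
  indexed-indices (x ∷ xs) = indexed-∷ x (λ _ → xs) tt

  laplace : (ℕ → List ℕ → Poly) → List ℕ → Poly
  laplace X []       = 0P
  laplace X (c ∷ cs) = X c cs -P laplace (λ c′ cs′ → X c′ (c ∷ cs′)) cs

  laplace-cong-on : ∀ cs {X Y} → (∀ c cs′ → suc (length cs′) ≡ length cs → X c cs′ ≃ Y c cs′) → laplace X cs ≃ laplace Y cs
  laplace-cong-on []       e = ≃-refl
  laplace-cong-on (c ∷ cs) e = +P-cong (e c cs refl) (negP-cong (laplace-cong-on cs λ c′ cs′ l → e c′ (c ∷ cs′) (≡.cong suc l)))

  negP-+P : ∀ p q → negP (p +P q) ≡ negP p +P negP q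
  negP-+P p q = map-++ _ p q

  laplace-neg : ∀ X cs → laplace (λ c cs → negP (X c cs)) cs ≃ negP (laplace X cs)
  laplace-neg X []       = ≃-refl
  laplace-neg X (c ∷ cs) = ≃-trans (+P-cong (≃-refl {negP (X c cs)}) (negP-cong (laplace-neg (λ c′ cs′ → X c′ (c ∷ cs′)) cs)))
    (≃-reflexive (≡.sym (negP-+P (X c cs) (negP (laplace (λ c′ cs′ → X c′ (c ∷ cs′)) cs)))))

  -- `laplace` carries its signs implicitly, one negation for each column passed, which is what
  -- `signP` of the position accumulates; `i₀` is the offset of the positions.
  signed-sum : ∀ cs i₀ (F : ℕ × ℕ → Poly) (X : ℕ → List ℕ → Poly) →
    (∀ i c → F (i₀ ℕ.+ i , c) ≃ signP i *P X c (removeAt cs i)) → sumP (map F (indices i₀ cs)) ≃ laplace X cs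
  signed-sum []       i₀ F X e = ≃-refl
  signed-sum (c ∷ cs) i₀ F X e = +P-cong
    (≃-trans (≃-reflexive (≡.cong (λ i → F (i , c)) (≡.sym (ℕP.+-identityʳ i₀)))) (≃-trans (e 0 c) (*P-identityˡ (X c cs))))
    (≃-trans (signed-sum cs (suc i₀) F (λ c′ cs′ → negP (X c′ (c ∷ cs′))) λ i c′ →
        ≃-trans (≃-reflexive (≡.cong (λ i → F (i , c′)) (≡.sym (ℕP.+-suc i₀ i))))
        (≃-trans (e (suc i) c′) (neg-move (signP i) (X c′ (c ∷ removeAt cs i)))))
      (laplace-neg (λ c′ cs′ → X c′ (c ∷ cs′)) cs))
    where
    open import Algebra.Properties.Ring Λ.ring using (-‿distribˡ-*; -‿distribʳ-*)
    neg-move : ∀ p q → negP p *P q ≃ p *P negP q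
    neg-move p q = ≃-trans (≃-sym (-‿distribˡ-* p q)) (-‿distribʳ-* p q)

  signed-sum-indexed : ∀ cs (F : ℕ × ℕ → Poly) (X : ℕ → List ℕ → Poly) →
    (∀ i c → F (i , c) ≃ signP i *P X c (removeAt cs i)) → sumP (map F (indexed cs)) ≃ laplace X cs
  signed-sum-indexed cs F X e =
    ≃-trans (≃-reflexive (≡.cong (λ is → sumP (map F is)) (indexed-indices cs))) (signed-sum cs 0 F X e)

  laplace-Lap : ∀ (Ψ : ℤ → List ℤ → Poly) cs → laplace (λ c cs → Ψ (+ c) (toZ cs)) cs ≡ Lap Ψ (toZ cs)
  laplace-Lap Ψ []       = refl
  laplace-Lap Ψ (c ∷ cs) = ≡.cong (λ z → Ψ (+ c) (toZ cs) -P z) (laplace-Lap (λ c′ cs′ → Ψ c′ (+ c ∷ cs′)) cs)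

  -- `detAux` looks its rows up in the fixed list `γ₀`, while `det` consumes the list; `look` keeps
  -- the two aligned as `row` advances.
  detAux-det : ∀ (γ₀ : List ℤ) γ row cs → (∀ p → lookupZ γ₀ (row ℕ.+ p) ≡ lookupZ γ (suc p)) →
    detAux (λ i j → hZ (lookupZ γ₀ i ℤ.+ + j ℤ.- + i)) (length γ) row cs ≃ det γ (+ row) (toZ cs)
  detAux-det γ₀ []      row cs look = ≃-refl
  detAux-det γ₀ (g ∷ γ) row cs look = ≃-trans
    (signed-sum-indexed cs _ X λ i c → *P-assoc (signP i) (M row c) (detAux M (length γ) (suc row) (removeAt cs i)))
      (≃-trans (laplace-cong-on cs λ c cs′ _ → *P-cong
          (≃-reflexive (≡.cong (λ z → hZ (z ℤ.+ + c ℤ.- + row)) (≡.trans (≡.cong (lookupZ γ₀) (≡.sym (ℕP.+-identityʳ row))) (look 0))))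
          (detAux-det γ₀ γ (suc row) cs′ λ p → ≡.trans (≡.cong (lookupZ γ₀) (≡.sym (ℕP.+-suc row p))) (look (suc p))))
        (≃-reflexive (laplace-Lap (λ c cs → hZ (g ℤ.+ c ℤ.- + row) *P det γ (+ suc row) cs) cs)))
    where
    M : ℕ → ℕ → Poly
    M i j = hZ (lookupZ γ₀ i ℤ.+ + j ℤ.- + i)
    X : ℕ → List ℕ → Poly
    X c cs = M row c *P detAux M (length γ) (suc row) cs

  columns : ∀ a n → toZ (applyUpTo (a ℕ.+_) n) ≡ seqℤ (+ a) n
  columns a zero    = refl
  columns a (suc n) = ≡.cong₂ _∷_ (≡.cong +_ (ℕP.+-identityʳ a))
    (≡.trans (≡.cong toZ (applyUpTo-cong (λ i → ℕP.+-suc a i) n)) (columns (suc a) n))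
    where
    applyUpTo-cong : ∀ {f g : ℕ → ℕ} → (∀ i → f i ≡ g i) → ∀ n → applyUpTo f n ≡ applyUpTo g n
    applyUpTo-cong e zero    = refl
    applyUpTo-cong e (suc n) = ≡.cong₂ _∷_ (e 0) (applyUpTo-cong (e ∘ suc) n)

-- s_γ = B_γ 1, although t occurs only on the right: both sides equal the product of the 1 - R
-- applied to h_γ.
schur-Fr : ∀ γ → schur γ ≃ V.Fr 1P (stair (length γ)) γ
schur-Fr γ = ≃-trans (detAux-det γ γ 1 (applyUpTo suc (length γ)) (λ p → refl))
  (≃-trans (≃-reflexive (≡.cong (det γ (+ 1)) (columns 1 (length γ))))
  (≃-trans (≃-sym (jacobi-trudi (length γ) γ (+ 1) refl)) (≃-sym (Fr-stair (length γ) γ refl))))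

rowFrom-map : ∀ n r → rowFrom n r ≡ map (1 ,_) (applyUpTo (λ c → suc (suc (n ℕ.+ c))) r)
rowFrom-map n zero    = refl
rowFrom-map n (suc r) = ≡.cong₂ _∷_ (≡.cong (λ c → 1 , suc (suc c)) (≡.sym (ℕP.+-identityʳ n)))
  (≡.trans (rowFrom-map (suc n) r) (≡.cong (map (1 ,_)) (go n r suc refl)))
  where
  go : ∀ n r (f : ℕ → ℕ) → f ≡ suc → applyUpTo (λ c → suc (suc (suc n ℕ.+ c))) r ≡ applyUpTo (λ c → suc (suc (n ℕ.+ f c))) r
  go n r .suc refl = cong-applyUpTo (λ c → ≡.cong (λ z → suc (suc z)) (≡.sym (ℕP.+-suc n c))) r
    where
    cong-applyUpTo : ∀ {f g : ℕ → ℕ} → (∀ i → f i ≡ g i) → ∀ n → applyUpTo f n ≡ applyUpTo g n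
    cong-applyUpTo e zero    = refl
    cong-applyUpTo e (suc n) = ≡.cong₂ _∷_ (e 0) (cong-applyUpTo (e ∘ suc) n)

posPairs-rootPairs : ∀ ℓ → posPairs ℓ ≡ rootPairs (replicate ℓ 0)
posPairs-rootPairs zero    = refl
posPairs-rootPairs (suc ℓ) = ≡.cong₂ _++_
  (≡.sym (≡.trans (≡.cong (rowFrom 0) (length-replicate ℓ)) (rowFrom-map 0 ℓ)))
  (≡.trans (later ℓ (applyUpTo suc ℓ)) (≡.cong bump (posPairs-rootPairs ℓ)))
  where
  map-applyUpTo : ∀ (f : ℕ → ℕ) n → applyUpTo (suc ∘ f) n ≡ map suc (applyUpTo f n)
  map-applyUpTo f zero    = refl
  map-applyUpTo f (suc n) = ≡.cong (suc (f 0) ∷_) (map-applyUpTo (f ∘ suc) n)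
  drop-suc : ∀ i (xs : List ℕ) j → map (suc j ,_) (drop i (map suc xs)) ≡ bump (map (j ,_) (drop i xs))
  drop-suc zero    []       j = refl
  drop-suc zero    (x ∷ xs) j = ≡.cong (_ ∷_) (drop-suc zero xs j)
  drop-suc (suc i) []       j = refl
  drop-suc (suc i) (x ∷ xs) j = drop-suc i xs j
  rows : ∀ xs is → concatMap (λ i → map (i ,_) (drop i (1 ∷ map suc xs))) (map suc is) ≡
                   bump (concatMap (λ i → map (i ,_) (drop i xs)) is)
  rows xs []       = refl
  rows xs (i ∷ is) = ≡.trans (≡.cong₂ _++_ (drop-suc i xs i) (rows xs is)) (≡.sym (map-++ _ (map (i ,_) (drop i xs)) _))
  later : ∀ ℓ _ → concatMap (λ i → map (i ,_) (drop i (applyUpTo suc (suc ℓ)))) (applyUpTo (suc ∘ suc) ℓ) ≡ bump (posPairs ℓ)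
  later ℓ _ = ≡.trans (≡.cong₂ (λ xs is → concatMap (λ i → map (i ,_) (drop i (1 ∷ xs))) is) (map-applyUpTo suc ℓ) (map-applyUpTo suc ℓ))
    (rows (applyUpTo suc ℓ) (applyUpTo suc ℓ))

private
  sum-pairs : ∀ {Q : Set} (F F′ F″ : Q → Poly) qs → (∀ q → F q +P F′ q ≃ F″ q) → sumP (map F qs) +P sumP (map F′ qs) ≃ sumP (map F″ qs)
  sum-pairs F F′ F″ []       e = ≃-refl
  sum-pairs F F′ F″ (q ∷ qs) e = ≃-trans (+P-interchange (F q) (sumP (map F qs)) (F′ q) (sumP (map F′ qs)))
    (+P-cong (e q) (sum-pairs F F′ F″ qs e))

  -- A product of factors 1 - t R expands over subsets of the pairs. `g` stands for the anonymous
  -- shift in the definition of `Bvec`.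
  subset-sum : ∀ (g : ℕ × ℕ → List ℤ → List ℤ) → (∀ i j γ → g (i , j) γ ≡ shiftZ i j (+ 1) γ) → ∀ ps X α →
    sumP (map (λ S → signP (length S) *P powP tP (length S) *P X (foldr g α S)) (subsets ps)) ≃ V.pairOps ps X α
  subset-sum g e []             X α = ≃-trans (+P-identityʳ _) (≃-trans (*P-cong (*P-identityˡ 1P) (≃-refl {X α})) (*P-identityˡ (X α)))
  subset-sum g e ((i , j) ∷ ps) X α = begin
    sumP (map F (subsets ps ++ map ((i , j) ∷_) (subsets ps)))
      ≡⟨ ≡.trans (≡.cong sumP (map-++ F (subsets ps) _)) (sumP-++ (map F (subsets ps)) _) ⟩
    sumP (map F (subsets ps)) +P sumP (map F (map ((i , j) ∷_) (subsets ps)))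
      ≡⟨ ≡.cong (λ z → sumP (map F (subsets ps)) +P sumP z) (≡.sym (map-∘ (subsets ps))) ⟩
    sumP (map F (subsets ps)) +P sumP (map (λ S → F ((i , j) ∷ S)) (subsets ps))
      ≈⟨ sum-pairs F (λ S → F ((i , j) ∷ S)) F″ (subsets ps) combine ⟩
    sumP (map F″ (subsets ps))
      ≈⟨ subset-sum g e ps (V.pairOp (i , j) X) α ⟩
    V.pairOps ps (V.pairOp (i , j) X) α ∎
    where
    open ≃-Reasoning
    F F″ : List (ℕ × ℕ) → Poly
    F S = signP (length S) *P powP tP (length S) *P X (foldr g α S)
    F″ S = signP (length S) *P powP tP (length S) *P V.pairOp (i , j) X (foldr g α S)
    combine : ∀ S → F S +P F ((i , j) ∷ S) ≃ F″ S
    combine S = ≃-trans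
      (≃-reflexive (≡.cong (λ z → F S +P negP (signP (length S)) *P (tP *P powP tP (length S)) *P X z) (e i j (foldr g α S))))
      (signed-step (signP (length S)) (powP tP (length S)) (X (foldr g α S)) (X (shiftZ i j (+ 1) (foldr g α S))))

Bvec-pairOps : ∀ α f → Bvec α f ≃ V.pairOps (posPairs (length α)) (foldr Bop f) α
Bvec-pairOps α f = subset-sum _ (λ _ _ _ → refl) (posPairs (length α)) (foldr Bop f) α

Bvec-Fr : ∀ α f → Bvec α f ≃ V.Fr f (stair (length α)) α
Bvec-Fr α f = ≃-trans (Bvec-pairOps α f) (≃-trans
  (≃-reflexive (≡.cong (λ ps → V.pairOps ps (foldr Bop f) α) (posPairs-rootPairs (length α))))
  (pairOps-zeros f α))

private
  filterRoots : ℕ → List ℕ → List (ℕ × ℕ) → List (ℕ × ℕ)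
  filterRoots k μ []             = []
  filterRoots k μ ((i , j) ∷ ps) =
    if (suc ((k ℕ.∸ lookupℕ μ i) ℕ.+ i)) ≤ᵇ j then (i , j) ∷ filterRoots k μ ps else filterRoots k μ ps

  filterRoots-unique : ∀ k μ (g : List (ℕ × ℕ) → List (ℕ × ℕ)) → g [] ≡ [] →
    (∀ i j ps → g ((i , j) ∷ ps) ≡ (if (suc ((k ℕ.∸ lookupℕ μ i) ℕ.+ i)) ≤ᵇ j then (i , j) ∷ g ps else g ps)) →
    ∀ ps → g ps ≡ filterRoots k μ ps
  filterRoots-unique k μ g e f []             = e
  filterRoots-unique k μ g e f ((i , j) ∷ ps) = ≡.trans (f i j ps)
    (≡.cong (λ z → if (suc ((k ℕ.∸ lookupℕ μ i) ℕ.+ i)) ≤ᵇ j then (i , j) ∷ z else z) (filterRoots-unique k μ g e f ps))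

  kRootIdeal-filter : ∀ k μ → kRootIdeal k μ ≡ filterRoots k μ (posPairs (length μ))
  kRootIdeal-filter k μ with posPairs (length μ) | filterRoots-unique k μ _ refl (λ _ _ _ → refl)
  ... | ps | unique = unique ps

  filterRoots-++ : ∀ k μ ps qs → filterRoots k μ (ps ++ qs) ≡ filterRoots k μ ps ++ filterRoots k μ qs
  filterRoots-++ k μ []             qs = refl
  filterRoots-++ k μ ((i , j) ∷ ps) qs with (suc ((k ℕ.∸ lookupℕ μ i) ℕ.+ i)) ≤ᵇ j
  ... | true  = ≡.cong ((i , j) ∷_) (filterRoots-++ k μ ps qs)
  ... | false = filterRoots-++ k μ ps qs

  -- The condition k - μ_i + i < j is unaffected when both indices move by one.
  filterRoots-bump : ∀ k x μ ps → All PositivePair ps → filterRoots k (x ∷ μ) (bump ps) ≡ bump (filterRoots k μ ps)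
  filterRoots-bump k x μ []                 []            = refl
  filterRoots-bump k x μ ((suc i , j) ∷ ps) ((_ , _) ∷ P)
    rewrite ℕP.+-suc (k ℕ.∸ lookupℕ μ (suc i)) (suc i)
    with (suc ((k ℕ.∸ lookupℕ μ (suc i)) ℕ.+ suc i)) ≤ᵇ j
  ... | true  = ≡.cong (_ ∷_) (filterRoots-bump k x μ ps P)
  ... | false = filterRoots-bump k x μ ps P

  -- In row 1 a root has column at least `k ∸ x + 2`, and columns start at 2, so just the first
  -- `k ∸ x` of them are non-roots.
  filterRoots-row : ∀ k x μ n r → n ≤ k ℕ.∸ x →
    filterRoots k (x ∷ μ) (rowFrom n r) ≡ rowFrom (k ℕ.∸ x) (n ℕ.+ r ℕ.∸ (k ℕ.∸ x))
  filterRoots-row k x μ n zero    p = ≡.cong (rowFrom (k ℕ.∸ x)) (≡.sym (ℕP.m≤n⇒m∸n≡0 (ℕP.≤-trans (ℕP.≤-reflexive (ℕP.+-identityʳ n)) p)))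
  filterRoots-row k x μ n (suc r) p with ℕP.m≤n⇒m<n∨m≡n p
  ... | inj₁ lt rewrite ≤ᵇ-false {suc (k ℕ.∸ x ℕ.+ 1)} {suc (suc n)}
          (s≤s (ℕP.≤-trans (s≤s lt) (ℕP.≤-reflexive (ℕP.+-comm 1 (k ℕ.∸ x))))) =
    ≡.trans (filterRoots-row k x μ (suc n) r lt) (≡.cong (λ z → rowFrom (k ℕ.∸ x) (z ℕ.∸ (k ℕ.∸ x))) (≡.sym (ℕP.+-suc n r)))
  ... | inj₂ refl = ≡.trans (all n (suc r) ℕP.≤-refl) (≡.cong (rowFrom n) (≡.sym (ℕP.m+n∸m≡n n (suc r))))
    where
    all : ∀ m r → k ℕ.∸ x ≤ m → filterRoots k (x ∷ μ) (rowFrom m r) ≡ rowFrom m r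
    all m zero    p = refl
    all m (suc r) p rewrite ≤ᵇ-true {suc (k ℕ.∸ x ℕ.+ 1)} {suc (suc m)}
        (s≤s (ℕP.≤-trans (ℕP.≤-reflexive (ℕP.+-comm (k ℕ.∸ x) 1)) (s≤s p))) =
      ≡.cong ((1 , suc (suc m)) ∷_) (all (suc m) r (ℕP.m≤n⇒m≤1+n p))

kRootIdeal-rootPairs : ∀ k μ → kRootIdeal k μ ≡ rootPairs (map (k ℕ.∸_) μ)
kRootIdeal-rootPairs k μ = ≡.trans (kRootIdeal-filter k μ)
  (≡.trans (≡.cong (filterRoots k μ) (posPairs-rootPairs (length μ))) (go μ))
  where
  go : ∀ μ → filterRoots k μ (rootPairs (replicate (length μ) 0)) ≡ rootPairs (map (k ℕ.∸_) μ)
  go []      = refl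
  go (x ∷ μ) = ≡.trans (filterRoots-++ k (x ∷ μ) (rowFrom 0 (length (replicate (length μ) 0))) _) (≡.cong₂ _++_
    (≡.trans (≡.cong (λ r → filterRoots k (x ∷ μ) (rowFrom 0 r)) (length-replicate (length μ)))
      (≡.trans (filterRoots-row k x μ 0 (length μ) z≤n)
        (≡.cong (λ r → rowFrom (k ℕ.∸ x) (r ℕ.∸ (k ℕ.∸ x))) (≡.sym (length-map (k ℕ.∸_) μ)))))
    (≡.trans (filterRoots-bump k x μ (rootPairs (replicate (length μ) 0)) (rootPairs-positive (replicate (length μ) 0)))
      (≡.cong bump (go μ))))

-- k-split polynomials in row form

module S = Straightening Λ.+-abelianGroup (tP *P_) (λ {x} {y} → Λ.*-congˡ {tP} {x} {y}) (Λ.distribˡ tP) Bop V.B-linear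

open S.Vacuum 1P (Bop-one (+ 0)) (λ n → Bop-one -[1+ n ]) using (Fr-zeros)

private
  splitProduct : List (List ℕ) → Poly
  splitProduct []            = 1P
  splitProduct (b ∷ [])      = schur (toZ b)
  splitProduct (b ∷ b′ ∷ bs) = Bvec (toZ b) (splitProduct (b′ ∷ bs))

  splitProduct-unique : ∀ (g : List (List ℕ) → Poly) → g [] ≡ 1P → (∀ b → g (b ∷ []) ≡ schur (toZ b)) →
    (∀ b b′ bs → g (b ∷ b′ ∷ bs) ≡ Bvec (toZ b) (g (b′ ∷ bs))) → ∀ bs → g bs ≡ splitProduct bs
  splitProduct-unique g e₀ e₁ e₂ []            = e₀
  splitProduct-unique g e₀ e₁ e₂ (b ∷ [])      = e₁ b
  splitProduct-unique g e₀ e₁ e₂ (b ∷ b′ ∷ bs) =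
    ≡.trans (e₂ b b′ bs) (≡.cong (Bvec (toZ b)) (splitProduct-unique g e₀ e₁ e₂ (b′ ∷ bs)))

  Gk-splitProduct : ∀ k lam → Gk k lam ≡ splitProduct (kSplit k lam)
  Gk-splitProduct k lam with kSplit k lam | splitProduct-unique _ refl (λ _ → refl) (λ _ _ _ → refl)
  ... | bs | unique = unique bs

  kSplitAux-[] : ∀ k f → kSplitAux k f [] ≡ []
  kSplitAux-[] k zero    = refl
  kSplitAux-[] k (suc f) = refl

  kSplitAux-fuel : ∀ k f g lam → length lam ≤ f → length lam ≤ g → kSplitAux k f lam ≡ kSplitAux k g lam
  kSplitAux-fuel k f       g       []        p       q       = ≡.trans (kSplitAux-[] k f) (≡.sym (kSplitAux-[] k g))
  kSplitAux-fuel k (suc f) (suc g) (a ∷ lam) (s≤s p) (s≤s q) =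
    ≡.cong (_ ∷_) (kSplitAux-fuel k f g (drop (k ℕ.∸ a) lam) (shorter p) (shorter q))
    where
    shorter : ∀ {f} → length lam ≤ f → length (drop (k ℕ.∸ a) lam) ≤ f
    shorter p = ℕP.≤-trans (ℕP.≤-reflexive (length-drop (k ℕ.∸ a) lam)) (ℕP.≤-trans (ℕP.m∸n≤m (length lam) (k ℕ.∸ a)) p)

  take-++-length : ∀ {n} (ν : List ℕ) σ → length ν ≡ n → take n (ν ++ σ) ≡ ν
  take-++-length []      σ refl = refl
  take-++-length (x ∷ ν) σ refl = ≡.cong (x ∷_) (take-++-length ν σ refl)

  drop-++-length : ∀ {n} (ν : List ℕ) σ → length ν ≡ n → drop n (ν ++ σ) ≡ σ
  drop-++-length []      σ refl = refl
  drop-++-length (x ∷ ν) σ refl = drop-++-length ν σ refl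

-- Disposes of the zeros that pad the last block of a k-split.
schur-zeros : ∀ ν z → schur (toZ (ν ++ replicate z 0)) ≃ V.Fr 1P (stair (length ν)) (toZ ν)
schur-zeros ν z = begin
  schur (toZ (ν ++ replicate z 0))
    ≈⟨ schur-Fr (toZ (ν ++ replicate z 0)) ⟩
  V.Fr 1P (stair (length (toZ (ν ++ replicate z 0)))) (toZ (ν ++ replicate z 0))
    ≡⟨ ≡.cong₂ (λ l γ → V.Fr 1P (stair l) γ) len (≡.trans (map-++ +_ ν (replicate z 0)) (≡.cong (toZ ν ++_) (zeros z))) ⟩
  V.Fr 1P (stair (z ℕ.+ length ν)) (toZ ν ++ replicate z (+ 0))
    ≈⟨ Fr-zeros (length ν) z (toZ ν) (length-map +_ ν) ⟩
  V.Fr 1P (stair (length ν)) (toZ ν) ∎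
  where
  open ≃-Reasoning
  zeros : ∀ z → toZ (replicate z 0) ≡ replicate z (+ 0)
  zeros zero    = refl
  zeros (suc z) = ≡.cong (+ 0 ∷_) (zeros z)
  len : length (toZ (ν ++ replicate z 0)) ≡ z ℕ.+ length ν
  len = ≡.trans (length-map +_ (ν ++ replicate z 0)) (≡.trans (length-++ ν)
    (≡.trans (ℕP.+-comm (length ν) _) (≡.cong (ℕ._+ length ν) (length-replicate z))))

Gk-block : ∀ k x ν → All (1 ≤_) (x ∷ ν) → length ν ≤ k ℕ.∸ x →
  Gk k (x ∷ ν) ≃ V.Fr 1P (stair (suc (length ν))) (toZ (x ∷ ν))
Gk-block k x ν _ p = ≃-trans (≃-reflexive (≡.trans (Gk-splitProduct k (x ∷ ν)) (≡.cong splitProduct split)))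
  (schur-zeros (x ∷ ν) z)
  where
  z = suc (k ℕ.∸ x) ℕ.∸ length (take (suc (k ℕ.∸ x)) (x ∷ ν))
  split : kSplit k (x ∷ ν) ≡ ((x ∷ ν) ++ replicate z 0) ∷ []
  split = ≡.cong₂ _∷_
    (≡.cong (λ l → (x ∷ l) ++ replicate z 0) (take-all (k ℕ.∸ x) ν p))
    (≡.trans (≡.cong (kSplitAux k (length ν)) (drop-all (k ℕ.∸ x) ν p)) (kSplitAux-[] k (length ν)))

Gk-++ : ∀ k x ν y lam → All (1 ≤_) (x ∷ ν ++ y ∷ lam) → length ν ≡ k ℕ.∸ x →
  Gk k (x ∷ ν ++ y ∷ lam) ≃ V.Fr (Gk k (y ∷ lam)) (stair (suc (length ν))) (toZ (x ∷ ν))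
Gk-++ k x ν y lam _ e = begin
  Gk k (x ∷ ν ++ y ∷ lam)
    ≡⟨ ≡.trans (Gk-splitProduct k (x ∷ ν ++ y ∷ lam)) (≡.cong splitProduct split) ⟩
  Bvec (toZ (x ∷ ν)) (splitProduct (kSplit k (y ∷ lam)))
    ≡⟨ ≡.cong (Bvec (toZ (x ∷ ν))) (Gk-splitProduct k (y ∷ lam)) ⟨
  Bvec (toZ (x ∷ ν)) (Gk k (y ∷ lam))
    ≈⟨ Bvec-Fr (toZ (x ∷ ν)) (Gk k (y ∷ lam)) ⟩
  V.Fr (Gk k (y ∷ lam)) (stair (length (toZ (x ∷ ν)))) (toZ (x ∷ ν))
    ≡⟨ ≡.cong (λ l → V.Fr (Gk k (y ∷ lam)) (stair (suc l)) (toZ (x ∷ ν))) (length-map +_ ν) ⟩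
  V.Fr (Gk k (y ∷ lam)) (stair (suc (length ν))) (toZ (x ∷ ν)) ∎
  where
  open ≃-Reasoning
  first : take (k ℕ.∸ x) (ν ++ y ∷ lam) ≡ ν
  first = take-++-length ν (y ∷ lam) e
  split : kSplit k (x ∷ ν ++ y ∷ lam) ≡ (x ∷ ν) ∷ kSplit k (y ∷ lam)
  split = ≡.cong₂ _∷_
    (≡.trans (≡.cong₂ (λ l z → (x ∷ l) ++ replicate z 0) first
        (≡.trans (≡.cong (λ l → k ℕ.∸ x ℕ.∸ length l) first) (≡.trans (≡.cong (k ℕ.∸ x ℕ.∸_) e) (ℕP.n∸n≡0 (k ℕ.∸ x)))))
      (++-identityʳ (x ∷ ν)))
    (≡.trans (≡.cong (kSplitAux k (length (ν ++ y ∷ lam))) (drop-++-length ν (y ∷ lam) e))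
      (kSplitAux-fuel k (length (ν ++ y ∷ lam)) (suc (length lam)) (y ∷ lam)
        (ℕP.≤-trans (ℕP.m≤n+m _ (length ν)) (ℕP.≤-reflexive (≡.sym (length-++ ν)))) ℕP.≤-refl))

poly-torsion-free : ∀ p → p +P p ≃ 0P → p ≃ 0P
poly-torsion-free p e = mk λ n ms → double (coeff p n ms) (≡.trans (≡.sym (coeff-++ p p n ms)) (at e n ms))
  where
  double : ∀ i → i ℤ.+ i ≡ + 0 → i ≡ + 0
  double (+ zero)  _ = refl

module Th (k : ℕ) = S.Alt.Theory (λ a b f → Bop-quadratic f a b) poly-torsion-free
  1P (Bop-one (+ 0)) (λ n → Bop-one -[1+ n ]) k (Gk k) ≃-refl (Gk-block k) (Gk-++ k)

-- Spans with explicit coefficients, and the recursion for Ã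

private
  coefficients : ℕ → List ℤ → Poly
  coefficients n []       = []
  coefficients n (c ∷ cs) = (c , (n , [])) ∷ coefficients (suc n) cs

  coefficients-unique : ∀ (g : ℕ → List ℤ → Poly) → (∀ n → g n [] ≡ []) →
    (∀ n c cs → g n (c ∷ cs) ≡ (c , (n , [])) ∷ g (suc n) cs) → ∀ n cs → g n cs ≡ coefficients n cs
  coefficients-unique g e f n []       = e n
  coefficients-unique g e f n (c ∷ cs) = ≡.trans (f n c cs) (≡.cong ((c , (n , [])) ∷_) (coefficients-unique g e f (suc n) cs))

  fromZt-∷ : ∀ c (cs : ⊤ → List ℤ) u → fromZt (c ∷ cs u) ≡ coefficients 0 (c ∷ cs u)
  fromZt-∷ c cs u with List._∷_ c (cs u)
  ... | w with cs u | 1 | coefficients-unique _ (λ _ → refl) (λ _ _ _ → refl)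
  ... | v | n | unique = ≡.cong (_ ∷_) (unique n v)

  fromZt-coefficients : ∀ cs → fromZt cs ≡ coefficients 0 cs
  fromZt-coefficients []       = refl
  fromZt-coefficients (c ∷ cs) = fromZt-∷ c (λ _ → cs) tt

  fromZt-neg : ∀ cs → fromZt (map (λ z → ℤ.- z) cs) ≡ negP (fromZt cs)
  fromZt-neg cs = ≡.trans (fromZt-coefficients (map (λ z → ℤ.- z) cs)) (≡.trans (go 0 cs) (≡.cong negP (≡.sym (fromZt-coefficients cs))))
    where
    go : ∀ n cs → coefficients n (map (λ z → ℤ.- z) cs) ≡ negP (coefficients n cs)
    go n []       = refl
    go n (c ∷ cs) = ≡.cong (_ ∷_) (go (suc n) cs)

  fromZt-t : ∀ cs → fromZt (+ 0 ∷ cs) ≃ tP *P fromZt cs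
  fromZt-t cs = ≃-trans (≃-reflexive (fromZt-coefficients (+ 0 ∷ cs))) (≃-trans zero-head
    (≃-trans (go 0 cs) (≃-reflexive (≡.cong (tP *P_) (≡.sym (fromZt-coefficients cs))))))
    where
    zero-head : (+ 0 , (0 , [])) ∷ coefficients 1 cs ≃ coefficients 1 cs
    zero-head = mk λ n ms → zero-coeff (sameKey 0 [] n ms) (coeff (coefficients 1 cs) n ms)
      where
      zero-coeff : ∀ (b : Bool) z → (if b then + 0 else + 0) ℤ.+ z ≡ z
      zero-coeff true  z = ℤP.+-identityˡ z
      zero-coeff false z = ℤP.+-identityˡ z
    go : ∀ n cs → coefficients (suc n) cs ≃ tP *P coefficients n cs
    go n []       = ≃-refl
    go n (c ∷ cs) = ≃-trans (≃-reflexive (≡.cong (λ z → (z , (suc n , [])) ∷ coefficients (suc (suc n)) cs) (≡.sym (ℤP.*-identityˡ c))))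
      (∷-cong (+ 1 ℤ.* c) (refl , refl) (go (suc n) cs))

module _ (k : ℕ) where

  combination : List (ZtPoly × List ℕ) → Poly
  combination []             = 0P
  combination ((c , l) ∷ ls) = fromZt c *P Gk k l +P combination ls

  combination-++ : ∀ L M → combination (L ++ M) ≡ combination L +P combination M
  combination-++ []            M = refl
  combination-++ ((c , l) ∷ L) M = ≡.trans (≡.cong (fromZt c *P Gk k l +P_) (combination-++ L M))
    (≡.sym (++-assoc (fromZt c *P Gk k l) (combination L) (combination M)))

  mapCoefficients : (ZtPoly → ZtPoly) → List (ZtPoly × List ℕ) → List (ZtPoly × List ℕ)
  mapCoefficients f = map λ cl → f (proj₁ cl) , proj₂ cl

  combination-neg : ∀ L → combination (mapCoefficients (map (λ z → ℤ.- z)) L) ≃ negP (combination L)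
  combination-neg []            = ≃-refl
  combination-neg ((c , l) ∷ L) = ≃-trans
    (+P-cong (≃-trans (≃-reflexive (≡.cong (_*P Gk k l) (fromZt-neg c))) (≃-sym (-‿distribˡ-* (fromZt c) (Gk k l)))) (combination-neg L))
    (≃-reflexive (≡.sym (map-++ _ (fromZt c *P Gk k l) (combination L))))
    where open import Algebra.Properties.Ring Λ.ring using (-‿distribˡ-*)

  combination-t : ∀ L → combination (mapCoefficients (+ 0 ∷_) L) ≃ tP *P combination L
  combination-t []            = ≃-sym (*P-zeroʳ tP)
  combination-t ((c , l) ∷ L) = ≃-trans
    (+P-cong (≃-trans (*P-cong (fromZt-t c) (≃-refl {Gk k l})) (*P-assoc tP (fromZt c) (Gk k l))) (combination-t L))
    (≃-sym (*P-distribˡ tP (fromZt c *P Gk k l) (combination L)))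

  Dec⇒IsParK : ∀ {lam} → Dec k lam → All (1 ≤_) lam → IsParK k lam
  Dec⇒IsParK D pos = linked D , bounded D pos
    where
    linked : ∀ {d lam} → Dec d lam → Linked (λ a b → b ≤ a) lam
    linked []              = []
    linked (p ∷ [])        = [-]
    linked (p ∷ D@(q ∷ _)) = q ∷ linked D
    bounded : ∀ {lam} → Dec k lam → All (1 ≤_) lam → All (λ a → 1 ≤ a × a ≤ k) lam
    bounded []      []        = []
    bounded (p ∷ D) (q ∷ pos) = (q , p) ∷ bounded (Dec-mono p D) pos

  IsParK⇒Dec : ∀ lam → IsParK k lam → Dec k lam
  IsParK⇒Dec []      _                     = []
  IsParK⇒Dec (x ∷ l) (L , ((_ , p) ∷ _)) = p ∷ tail l L
    where
    tail : ∀ {x} l → Linked (λ a b → b ≤ a) (x ∷ l) → Dec x l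
    tail []      _       = []
    tail (y ∷ l) (q ∷ L) = q ∷ tail l L

  Combination : (List ℕ → Set) → Poly → Set
  Combination P f = Σ (List (ZtPoly × List ℕ)) λ L → All (λ cl → IsParK k (proj₂ cl) × P (proj₂ cl)) L × f ≃ combination L

  -- The closure rules act on coefficient lists: negation entrywise, and multiplication by t by
  -- putting a 0 in front.
  GSpan⇒Combination : ∀ {Q P : List ℕ → Set} → (∀ {lam} → Q lam → P lam) → ∀ {f} → Th.GSpan k Q f → Combination P f
  GSpan⇒Combination h (V.gen (Th.ggen lam D pos q v)) =
    ((+ 1 ∷ []) , lam) ∷ [] , (Dec⇒IsParK D pos , h q) ∷ [] ,
    ≃-trans v (≃-sym (≃-trans (+P-identityʳ (1P *P Gk k lam)) (*P-identityˡ (Gk k lam))))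
  GSpan⇒Combination h V.zer        = [] , [] , ≃-refl
  GSpan⇒Combination h (V.add a b)  with GSpan⇒Combination h a | GSpan⇒Combination h b
  ... | L , A , e | M , A′ , e′ = L ++ M , AllP.++⁺ A A′ , ≃-trans (+P-cong e e′) (≃-reflexive (≡.sym (combination-++ L M)))
  GSpan⇒Combination h (V.neg a)    with GSpan⇒Combination h a
  ... | L , A , e = mapCoefficients (map (λ z → ℤ.- z)) L , AllP.map⁺ A , ≃-trans (negP-cong e) (≃-sym (combination-neg L))
  GSpan⇒Combination h (V.tmul a)   with GSpan⇒Combination h a
  ... | L , A , e = mapCoefficients (+ 0 ∷_) L , AllP.map⁺ A , ≃-trans (*P-cong (≃-refl {tP}) e) (≃-sym (combination-t L))
  GSpan⇒Combination h (V.resp e a) with GSpan⇒Combination h a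
  ... | L , A , e′ = L , A , ≃-trans (≃-sym e) e′

  Combination⇒InSpanG : ∀ {P f} → Combination P f → InSpanG k P f
  Combination⇒InSpanG (L , A , e) = L , A , at (≃-trans e (≃-reflexive (sum-combination _ (λ _ _ → refl) L)))
    where
    sum-combination : ∀ (g : ZtPoly × List ℕ → Poly) → (∀ c l → fromZt c *P Gk k l ≡ g (c , l)) → ∀ L → combination L ≡ sumP (map g L)
    sum-combination g e []            = refl
    sum-combination g e ((c , l) ∷ L) = ≡.cong₂ _+P_ (e c l) (sum-combination g e L)

  GSpan⇒InSpanG : ∀ {Q P : List ℕ → Set} → (∀ {lam} → Q lam → P lam) → ∀ {f} → Th.GSpan k Q f → InSpanG k P f
  GSpan⇒InSpanG h a = Combination⇒InSpanG (GSpan⇒Combination h a)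

  s-ATilde : ∀ μ → Dec k μ → ATilde k μ (Th.s k μ)
  s-ATilde []      D           = atNil
  s-ATilde (m ∷ μ) (m≤k ∷ D) = atCons (s-ATilde μ (Dec-mono m≤k D))
    ( GSpan⇒InSpanG head-≤ (Th.s-in-G k (suc (length (m ∷ μ))) (m ∷ μ) ℕP.≤-refl (ℕP.≤-refl ∷ D) m≤k)
    , GSpan⇒InSpanG (λ q → q) (Th.prepend-row-in-G k μ (m≤k ∷ D)))
    where
    head-≤ : ∀ {lam} → Dec m lam → headℕ lam ≤ m
    head-≤ []      = z≤n
    head-≤ (p ∷ _) = p

-- Coefficients of the Catalan series

shiftZ-zero : ∀ i j γ → shiftZ i j (+ 0) γ ≡ γ
shiftZ-zero i j γ = ≡.trans (shiftZ-mapIdx i j (+ 0) γ) (fixed 1 γ)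
  where
  fixed : ∀ p γ → mapIdx (shiftEntry i j (+ 0)) p γ ≡ γ
  fixed p []      = refl
  fixed p (x ∷ γ) = ≡.cong₂ _∷_ (entry (p ≡ᵇ i) (p ≡ᵇ j)) (fixed (suc p) γ)
    where
    entry : ∀ b c → (if b then x ℤ.+ + 0 else if c then x ℤ.- + 0 else x) ≡ x
    entry true  _     = ℤP.+-identityʳ x
    entry false true  = ℤP.+-identityʳ x
    entry false false = refl

shiftZ-+1 : ∀ i j a γ → shiftZ i j (+ a) (shiftZ i j (+ 1) γ) ≡ shiftZ i j (+ suc a) γ
shiftZ-+1 i j a γ = ≡.trans (≡.cong (shiftZ i j (+ a)) (shiftZ-mapIdx i j (+ 1) γ))
  (≡.trans (shiftZ-mapIdx i j (+ a) _) (≡.trans (twice 1 γ) (≡.sym (shiftZ-mapIdx i j (+ suc a) γ))))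
  where
  twice : ∀ p γ → mapIdx (shiftEntry i j (+ a)) p (mapIdx (shiftEntry i j (+ 1)) p γ) ≡ mapIdx (shiftEntry i j (+ suc a)) p γ
  twice p []      = refl
  twice p (x ∷ γ) = ≡.cong₂ _∷_ entry (twice (suc p) γ)
    where
    entry : shiftEntry i j (+ a) p (shiftEntry i j (+ 1) p x) ≡ shiftEntry i j (+ suc a) p x
    entry with p ≡ᵇ i | p ≡ᵇ j
    ... | true  | _     = ℤP.+-assoc x (+ 1) (+ a)
    ... | false | true  = ≡.trans (ℤP.+-assoc x -[1+ 0 ] (ℤ.- + a))
      (≡.cong (λ z → x ℤ.+ z) (≡.sym (ℤP.neg-distrib-+ (+ 1) (+ a))))
    ... | false | false = refl

applyM-shiftZ : ∀ Ψ es i j a γ → applyM Ψ es (shiftZ i j a γ) ≡ shiftZ i j a (applyM Ψ es γ)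
applyM-shiftZ []              es       i j a γ = refl
applyM-shiftZ (p ∷ Ψ)         []       i j a γ = refl
applyM-shiftZ ((i′ , j′) ∷ Ψ) (e ∷ es) i j a γ = ≡.trans (≡.cong (shiftZ i′ j′ (+ e)) (applyM-shiftZ Ψ es i j a γ))
  (shiftZ-comm i′ j′ (+ e) i j a (applyM Ψ es γ))

sumOver : {X : Set} → (X → ℤ) → List X → ℤ
sumOver f = foldr (λ x z → f x ℤ.+ z) (+ 0)

module _ {X : Set} where

  sumOver-cong : ∀ {f g : X → ℤ} → (∀ x → f x ≡ g x) → ∀ xs → sumOver f xs ≡ sumOver g xs
  sumOver-cong e []       = refl
  sumOver-cong e (x ∷ xs) = ≡.cong₂ ℤ._+_ (e x) (sumOver-cong e xs)

  sumOver-++ : ∀ (f : X → ℤ) xs ys → sumOver f (xs ++ ys) ≡ sumOver f xs ℤ.+ sumOver f ys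
  sumOver-++ f []       ys = ≡.sym (ℤP.+-identityˡ _)
  sumOver-++ f (x ∷ xs) ys = ≡.trans (≡.cong (λ z → f x ℤ.+ z) (sumOver-++ f xs ys)) (≡.sym (ℤP.+-assoc (f x) _ _))

  sumOver-map : ∀ {Y : Set} (f : X → ℤ) (g : Y → X) ys → sumOver f (map g ys) ≡ sumOver (f ∘ g) ys
  sumOver-map f g []       = refl
  sumOver-map f g (y ∷ ys) = ≡.cong (λ z → f (g y) ℤ.+ z) (sumOver-map f g ys)

  sumOver-concatMap : ∀ {Y : Set} (f : X → ℤ) (g : Y → List X) ys → sumOver f (concatMap g ys) ≡ sumOver (λ y → sumOver f (g y)) ys
  sumOver-concatMap f g []       = refl
  sumOver-concatMap f g (y ∷ ys) = ≡.trans (sumOver-++ f (g y) (concatMap g ys)) (≡.cong (λ z → sumOver f (g y) ℤ.+ z) (sumOver-concatMap f g ys))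

  sumOver-applyUpTo : ∀ (f : X → ℤ) (g : ℕ → X) n → sumOver f (applyUpTo g n) ≡ sumOver (f ∘ g) (upTo n)
  sumOver-applyUpTo f g n = ≡.trans (≡.cong (sumOver f) (≡.sym (map-upTo g n))) (sumOver-map f g (upTo n))
    where open import Data.List.Properties using (map-upTo)

coeff-sumP : ∀ {X : Set} (f : X → Poly) xs n ms → coeff (sumP (map f xs)) n ms ≡ sumOver (λ x → coeff (f x) n ms) xs
coeff-sumP f []       n ms = refl
coeff-sumP f (x ∷ xs) n ms = ≡.trans (coeff-++ (f x) (sumP (map f xs)) n ms) (≡.cong (λ z → coeff (f x) n ms ℤ.+ z) (coeff-sumP f xs n ms))

sumOver-comps : ∀ (f : List ℕ → ℤ) p n →
  sumOver f (comps (suc p) n) ≡ sumOver (λ a → sumOver (f ∘ (a ∷_)) (comps p (n ℕ.∸ a))) (range n)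
sumOver-comps f p n = ≡.trans (sumOver-concatMap f (λ a → map (a ∷_) (comps p (n ℕ.∸ a))) (range n))
  (sumOver-cong (λ a → sumOver-map f (a ∷_) (comps p (n ℕ.∸ a))) (range n))

coeff-t-zero : ∀ p ms → coeff (tP *P p) 0 ms ≡ + 0
coeff-t-zero []                  ms = refl
coeff-t-zero ((c , (n , hs)) ∷ p) ms = ≡.trans (ℤP.+-identityˡ _) (coeff-t-zero p ms)

coeff-t-suc : ∀ p n ms → coeff (tP *P p) (suc n) ms ≡ coeff p n ms
coeff-t-suc []                   n ms = refl
coeff-t-suc ((c , (m , hs)) ∷ p) n ms = ≡.cong₂ ℤ._+_
  (≡.cong₂ (λ b z → if b then z else + 0) (sameKey-cong m (sortℕ hs) m hs n ms n ms (refl , sort-sort hs) (refl , refl)) (ℤP.*-identityˡ c))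
  (coeff-t-suc p n ms)

-- The coefficient of t^n in H is assembled from Schur functions, which must therefore contain no t
-- themselves; this is visible on their term lists.
TFree : Poly → Set
TFree = All λ x → proj₁ (proj₂ x) ≡ 0

TFree-coeff : ∀ {p} → TFree p → ∀ n ms → coeff p (suc n) ms ≡ + 0
TFree-coeff []                                  n ms = refl
TFree-coeff (_∷_ {c , (.0 , hs)} {p} refl F) n ms = ≡.trans (ℤP.+-identityˡ _) (TFree-coeff F n ms)

TFree-neg : ∀ {p} → TFree p → TFree (negP p)
TFree-neg F = AllP.map⁺ (All.map (λ e → e) F)

TFree-*P : ∀ {p q} → TFree p → TFree q → TFree (p *P q)
TFree-*P []                             G = []
TFree-*P (_∷_ {c , (.0 , hs)} refl F) G = AllP.++⁺ (AllP.map⁺ (All.map (λ e → e) G)) (TFree-*P F G)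

TFree-signP : ∀ n → TFree (signP n)
TFree-signP zero    = refl ∷ []
TFree-signP (suc n) = TFree-neg (TFree-signP n)

TFree-hZ : ∀ i → TFree (hZ i)
TFree-hZ (+ zero)  = refl ∷ []
TFree-hZ (+ suc d) = refl ∷ []
TFree-hZ -[1+ d ]  = []

TFree-sumP : ∀ {X : Set} (f : X → Poly) → (∀ x → TFree (f x)) → ∀ xs → TFree (sumP (map f xs))
TFree-sumP f F []       = []
TFree-sumP f F (x ∷ xs) = AllP.++⁺ (F x) (TFree-sumP f F xs)

TFree-detAux : ∀ {M} → (∀ i j → TFree (M i j)) → ∀ f row cols → TFree (detAux M f row cols)
TFree-detAux F zero    row cols = refl ∷ []
TFree-detAux F (suc f) row cols = TFree-sumP _ (λ { (i , c) →
  TFree-*P (TFree-*P (TFree-signP i) (F row c)) (TFree-detAux F f (suc row) (removeAt cols i)) }) (indexed cols)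

TFree-schur : ∀ γ → TFree (schur γ)
TFree-schur γ = TFree-detAux (λ i j → TFree-hZ (lookupZ γ i ℤ.+ + j ℤ.- + i)) (length γ) 1 (applyUpTo suc (length γ))

-- Dividing by 1 − t R_ij is summing the geometric series in t R_ij.
coeff-geometric : ∀ (Y : List ℤ → Poly) i j n γ ms →
  coeff (Y γ) n ms ≡ sumOver (λ a → coeff (V.pairOp (i , j) Y (shiftZ i j (+ a) γ)) (n ℕ.∸ a) ms) (range n)
coeff-geometric Y i j n γ ms = go n γ
  where
  X = V.pairOp (i , j) Y
  open ≡.≡-Reasoning
  unfold : ∀ γ n → coeff (X γ) n ms ≡ coeff (Y γ) n ms ℤ.- coeff (tP *P Y (shiftZ i j (+ 1) γ)) n ms
  unfold γ n = ≡.trans (coeff-++ (Y γ) (negP (tP *P Y (shiftZ i j (+ 1) γ))) n ms)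
    (≡.cong (λ z → coeff (Y γ) n ms ℤ.+ z) (coeff-neg (tP *P Y (shiftZ i j (+ 1) γ)) n ms))
  restore : ∀ x y z u → x ≡ y ℤ.- z → z ≡ u → y ≡ x ℤ.+ u
  restore x y z u refl refl = cancel y z
    where
    cancel : ∀ y z → y ≡ y ℤ.- z ℤ.+ z
    cancel y z = ≡.sym (≡.trans (ℤP.+-assoc y (ℤ.- z) z)
      (≡.trans (≡.cong (λ w → y ℤ.+ w) (ℤP.+-inverseˡ z)) (ℤP.+-identityʳ y)))
  at-zero : ∀ γ → X (shiftZ i j (+ 0) γ) ≡ X γ
  at-zero γ = ≡.cong X (shiftZ-zero i j γ)
  go : ∀ n γ → coeff (Y γ) n ms ≡ sumOver (λ a → coeff (X (shiftZ i j (+ a) γ)) (n ℕ.∸ a) ms) (range n)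
  go zero    γ = ≡.trans (restore _ _ _ (+ 0) (unfold γ 0) (coeff-t-zero (Y (shiftZ i j (+ 1) γ)) ms))
    (≡.cong (λ p → coeff p 0 ms ℤ.+ + 0) (≡.sym (at-zero γ)))
  go (suc n) γ = ≡.trans (restore _ _ _ _ (unfold γ (suc n)) (coeff-t-suc (Y (shiftZ i j (+ 1) γ)) n ms))
    (≡.cong₂ ℤ._+_ (≡.cong (λ p → coeff p (suc n) ms) (≡.sym (at-zero γ))) (begin
      coeff (Y (shiftZ i j (+ 1) γ)) n ms
        ≡⟨ go n (shiftZ i j (+ 1) γ) ⟩
      sumOver (λ a → coeff (X (shiftZ i j (+ a) (shiftZ i j (+ 1) γ))) (n ℕ.∸ a) ms) (upTo (suc n))
        ≡⟨ sumOver-cong (λ a → ≡.cong (λ δ → coeff (X δ) (n ℕ.∸ a) ms) (shiftZ-+1 i j a γ)) (upTo (suc n)) ⟩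
      sumOver (λ a → coeff (X (shiftZ i j (+ suc a) γ)) (n ℕ.∸ a) ms) (upTo (suc n))
        ≡⟨ sumOver-applyUpTo (λ a → coeff (X (shiftZ i j (+ a) γ)) (suc n ℕ.∸ a) ms) suc (suc n) ⟨
      sumOver (λ a → coeff (X (shiftZ i j (+ a) γ)) (suc n ℕ.∸ a) ms) (applyUpTo suc (suc n)) ∎))

-- The factors are inverted one at a time, and their exponents run over the compositions of `n`. The
-- hypothesis covers all indices of the given length because each inversion shifts the index.
coeff-pairOps-inverse : ∀ (S : List ℤ → Poly) → (∀ γ n ms → coeff (S γ) (suc n) ms ≡ + 0) →
  ∀ Ψ Y γ → (∀ γ′ → length γ′ ≡ length γ → V.pairOps Ψ Y γ′ ≃ S γ′) → ∀ n ms →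
  coeff (Y γ) n ms ≡ sumOver (λ es → coeff (S (applyM Ψ es γ)) 0 ms) (comps (length Ψ) n)
coeff-pairOps-inverse S free []            Y γ e zero    ms = ≡.trans (at (e γ refl) 0 ms) (≡.sym (ℤP.+-identityʳ _))
-- No factor remains to absorb a positive exponent, and `S` is free of t: both sides are 0.
coeff-pairOps-inverse S free []            Y γ e (suc n) ms = ≡.trans (at (e γ refl) (suc n) ms) (free γ n ms)
coeff-pairOps-inverse S free ((i , j) ∷ Ψ) Y γ e n       ms = begin
  coeff (Y γ) n ms
    ≡⟨ coeff-geometric Y i j n γ ms ⟩
  sumOver (λ a → coeff (V.pairOp (i , j) Y (shiftZ i j (+ a) γ)) (n ℕ.∸ a) ms) (range n)
    ≡⟨ sumOver-cong (λ a → ≡.trans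
         (coeff-pairOps-inverse S free Ψ (V.pairOp (i , j) Y) (shiftZ i j (+ a) γ)
           (λ γ′ l → e γ′ (≡.trans l (shiftZ-length i j (+ a) γ))) (n ℕ.∸ a) ms)
         (sumOver-cong (λ es → ≡.cong (λ δ → coeff (S δ) 0 ms) (applyM-shiftZ Ψ es i j (+ a) γ)) (comps (length Ψ) (n ℕ.∸ a)))) (range n) ⟩
  sumOver (λ a → sumOver (λ es → coeff (S (shiftZ i j (+ a) (applyM Ψ es γ))) 0 ms) (comps (length Ψ) (n ℕ.∸ a))) (range n)
    ≡⟨ sumOver-comps (λ es → coeff (S (applyM ((i , j) ∷ Ψ) es γ)) 0 ms) (length Ψ) n ⟨
  sumOver (λ es → coeff (S (applyM ((i , j) ∷ Ψ) es γ)) 0 ms) (comps (suc (length Ψ)) n) ∎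
  where open ≡.≡-Reasoning

-- The factors over the roots carry the finite form to s_γ, for every γ of the length of μ;
-- inverting them gives the series.
s-EqSeries : ∀ k μ → EqSeries (Th.s k μ) (kSchurCoeff k μ)
s-EqSeries k μ n ms = ≡.trans
  (coeff-pairOps-inverse schur (λ γ → TFree-coeff (TFree-schur γ)) (kRootIdeal k μ) (V.Fr 1P ns) (toZ μ) product n ms)
  (≡.sym (coeff-sumP (λ es → schur (applyM (kRootIdeal k μ) es (toZ μ))) (comps (length (kRootIdeal k μ)) n) 0 ms))
  where
  ns = map (k ℕ.∸_) μ
  product : ∀ γ → length γ ≡ length (toZ μ) → V.pairOps (kRootIdeal k μ) (V.Fr 1P ns) γ ≃ schur γ
  product γ e = ≃-trans (≃-reflexive (≡.cong (λ Ψ → V.pairOps Ψ (V.Fr 1P ns) γ) (kRootIdeal-rootPairs k μ)))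
    (≃-trans (V.pairOps-roots 1P ns γ len)
    (≃-trans (≃-reflexive (≡.cong (λ l → V.Fr 1P (stair l) γ) (≡.sym len))) (≃-sym (schur-Fr γ))))
    where
    len : length γ ≡ length ns
    len = ≡.trans e (≡.trans (length-map +_ μ) (≡.sym (length-map (k ℕ.∸_) μ)))

theorem6p3 : (k : ℕ) → 1 ≤ k → (μ : List ℕ) → IsParK k μ →
    Σ Poly (λ f → ATilde k μ f × EqSeries f (kSchurCoeff k μ))
theorem6p3 k _ μ P = Th.s k μ , s-ATilde k μ (IsParK⇒Dec k μ P) , s-EqSeries k μ
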